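{- Let $G=(V,E)$ be a graph and $d \geq 2$ an integer. Then $E$ is independent in the generic $d$-parallel matroid (that is, $E$ is $d$-parallel independent) if and only if the polynomial in $q$ $$([d]_q-1)^{\mathbf{v}(G)-\mathbf{c}(G)} \, \mathbf{T}_G\!\left(\frac{[2]_q\,[d]_q}{[d]_q-1},\,[d]_q\right)$$ is monic of degree $d(\mathbf{v}(G)-\mathbf{c}(G))$.
   Context: A graph $G=(V,E)$ consists of a finite nonempty set $V$ of vertices and a finite set $E$ of edges; each edge has two endpoints in $V$, not necessarily distinct. An edge whose endpoints coincide is a loop; parallel edges are allowed. $\mathbf{v}(G)$ and $\mathbf{c}(G)$ denote the numbers of vertices and of connected components of $G$. For a positive integer $m$, $[m]_q=(1-q^m)/(1-q)=1+q+\dots+q^{m-1}$. Tutte polynomial: for $F\subset E$ let $r(F)$ be the cardinality of a maximal acyclic subset of $F$. Then $\mathbf{T}_G(x,y)=\sum_{F\subset E}(x-1)^{r(E)-r(F)}(y-1)^{|F|-r(F)}$. Since $r(E)=\mathbf{v}(G)-\mathbf{c}(G)$, the displayed expression in the claim is a polynomial in $q$. $d$-parallel independence: a picture of $G$ in $\mathbb{P}^d=\mathbb{P}^d_{\mathbb{C}}$ assigns to each vertex $v$ a point $\mathbf{P}(v)\in\mathbb{P}^d$ and to each edge $e$ a line $\mathbf{P}(e)\subset\mathbb{P}^d$ containing $\mathbf{P}(v)$ for each endpoint $v$ of $e$; it is generic if the points $\mathbf{P}(v)$ are pairwise distinct. The edge set $E$ is $d$-parallel independent (independent in the generic $d$-parallel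 matroid) if $G$ has no loops and the directions of the lines representing the edges in a generic picture are mutually unconstrained. Precisely, the second condition says that the map sending a tuple $(p_v)_{v\in V}$ of pairwise distinct points of $\mathbb{C}^d$ to $([p_v-p_w])_{e=vw\in E}\in(\mathbb{P}^{d-1}_{\mathbb{C}})^E$ has Zariski-dense image, where $[p_v-p_w]$ is the direction of the line through $p_v$ and $p_w$. In particular a single loop, and a pair of parallel nonloop edges, are dependent. -}

module Defs where

open import Algebra.Bundles.Raw using (RawRing)
import Algebra.Definitions.RawMonoid as RawMonoidDefs
import Algebra.Definitions.RawSemiring as RawSemiringDefs
open import Data.Empty using (⊥-elim)
open import Data.Fin using (Fin; zero; suc; punchOut; punchIn)
import Data.Fin.Properties as Fin
open import Data.Fin.Subset using (Subset; inside; outside; _⊆_; _⊂_; ∣_∣; ⊤; ⊥)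
  renaming (_∈_ to _∈ˢ_)
open import Data.Fin.Subset.Properties
  using (_∈?_; _⊆?_; _⊂?_; anySubset?; p⊂q⇒∣p∣<∣q∣; ∣p∣≤n; ⊆-min; ∉⊥)
open import Data.Integer as ℤ using (ℤ; 0ℤ; 1ℤ)
import Data.Integer.Properties as ℤ
open import Data.List as List using (List; []; _∷_)
open import Data.Nat as ℕ using (ℕ; zero; suc; _≤_; _<_; s≤s; z≤n; _∸_; _⊔_; NonZero)
import Data.Nat.Properties as ℕ
open import Data.Product using (Σ; ∃; _×_; _,_; proj₁; proj₂)
open import Data.Rational as ℚ using (ℚ; 0ℚ; 1ℚ; ½)
import Data.Rational.Properties as ℚ
import Data.Rational.Solver as ℚSolver
open import Data.Sum using (_⊎_; inj₁; inj₂)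
open import Data.Vec as Vec using (Vec; []; _∷_; _∷ʳ_; lookup)
open import Data.Vec.Relation.Unary.Unique.Propositional using (Unique)
open import Data.Vec.Relation.Unary.Unique.Propositional.Properties using (lookup-injective)
open import Data.Vec.Relation.Unary.AllPairs using (allPairs?)
open import Function using (_∘_; _⇔_; mk⇔; Equivalence; StrictlySurjective)
open import Level using (0ℓ)
open import Relation.Binary.Construct.Closure.Equivalence as EqC using (EqClosure)
open import Relation.Binary.PropositionalEquality
  using (_≡_; _≢_; refl; sym; trans; cong; subst; isEquivalence)
open import Relation.Nullary using (¬_; Dec; yes; no; ¬?)
open import Relation.Nullary.Decidable using (_×-dec_; _⊎-dec_; map′)
open import Relation.Unary using (Pred; Decidable)

------------------------------------------------------------------------
-- Graphs

-- Edges are undirected: the order in which `ends` lists the two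
-- endpoints of an edge is immaterial to all notions below.
record Graph : Set where
  field
    v            : ℕ
    {{nonempty}} : NonZero v
    size         : ℕ
    ends         : Fin size → Fin v × Fin v

Loop : (G : Graph) → Fin (Graph.size G) → Set
Loop G e = let (a , b) = Graph.ends G e in a ≡ b

Joins : ∀ {n m} → (Fin m → Fin n × Fin n) → Fin m → Fin n → Fin n → Set
Joins ends e a b = ends e ≡ (a , b) ⊎ ends e ≡ (b , a)

------------------------------------------------------------------------
-- Connected components

Connected : ∀ {n m} → (Fin m → Fin n × Fin n) → Fin n → Fin n → Set
Connected ends = EqClosure (λ a b → ∃ λ e → ends e ≡ (a , b))

-- A bijection between Fin c and the set of connected components.
record ComponentLabelling {n m} (ends : Fin m → Fin n × Fin n) (c : ℕ) : Set where
  field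
    label      : Fin n → Fin c
    surjective : StrictlySurjective _≡_ label
    classes    : ∀ {a b} → label a ≡ label b ⇔ Connected ends a b

private
  Connected-suc : ∀ {n m} {ends : Fin (suc m) → Fin n × Fin n} {a b} →
                  Connected (ends ∘ suc) a b → Connected ends a b
  Connected-suc = EqC.map (λ (e , eq) → suc e , eq)

  module Merge {n m c} (ends : Fin (suc m) → Fin n × Fin n)
               (L : ComponentLabelling (ends ∘ suc) (suc c)) where
    open ComponentLabelling L

    a b : Fin n
    a = proj₁ (ends zero)
    b = proj₂ (ends zero)

    a~b : Connected ends a b
    a~b = EqC.return (zero , refl)

    old : ∀ {v w} → label v ≡ label w → Connected ends v w
    old eq = Connected-suc (Equivalence.to classes eq)

    old⁻ : ∀ {v w} → (∃ λ e → ends (suc e) ≡ (v , w)) → label v ≡ label w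
    old⁻ r = Equivalence.from classes (EqC.return r)

    module _ (a≢b : label a ≢ label b) where

      collapse : ∀ x → Dec (label b ≡ x) → Fin c
      collapse x (yes _) = punchOut (a≢b ∘ sym)
      collapse x (no ≢x) = punchOut ≢x

      merge : Fin (suc c) → Fin c
      merge x = collapse x (label b Fin.≟ x)

      merge-b : merge (label b) ≡ punchOut (a≢b ∘ sym)
      merge-b with label b Fin.≟ label b
      ... | yes _ = refl
      ... | no ¬p = ⊥-elim (¬p refl)

      merge-≢ : ∀ {x} (p : label b ≢ x) → merge x ≡ punchOut p
      merge-≢ {x} p with label b Fin.≟ x
      ... | yes q = ⊥-elim (p q)
      ... | no _  = Fin.punchOut-cong (label b) refl

      to : ∀ {v w} → merge (label v) ≡ merge (label w) → Connected ends v w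
      to {v} {w} eq with label b Fin.≟ label v | label b Fin.≟ label w
      ... | yes p | yes q = old (trans (sym p) q)
      ... | yes p | no q  = EqC.transitive _ (old (sym p))
                              (EqC.transitive _ (EqC.symmetric _ a~b)
                                 (old (Fin.punchOut-injective _ q eq)))
      ... | no p  | yes q = EqC.transitive _ (old (Fin.punchOut-injective p _ eq))
                              (EqC.transitive _ a~b (old q))
      ... | no p  | no q  = old (Fin.punchOut-injective p q eq)

      from : ∀ {v w} → Connected ends v w → merge (label v) ≡ merge (label w)
      from = EqC.gfold isEquivalence (merge ∘ label) λ where
        (zero , refl) → trans (merge-≢ (a≢b ∘ sym)) (sym merge-b)
        (suc e , eq)  → cong merge (old⁻ (e , eq))

      onto : StrictlySurjective _≡_ (merge ∘ label)
      onto y with surjective (punchIn (label b) y)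
      ... | v , eq = v , trans (cong merge eq)
              (trans (merge-≢ (Fin.punchInᵢ≢i (label b) y ∘ sym))
                     (Fin.punchOut-punchIn (label b)))

      merged : ComponentLabelling ends c
      merged = record { label = merge ∘ label ; surjective = onto ; classes = mk⇔ to from }

    kept : label a ≡ label b → ComponentLabelling ends (suc c)
    kept a≡b = record
      { label      = label
      ; surjective = surjective
      ; classes    = mk⇔ old (EqC.gfold isEquivalence label λ where
          (zero , refl) → a≡b
          (suc e , eq)  → old⁻ (e , eq))
      }

components : ∀ {n} m (ends : Fin m → Fin n × Fin n) → ∃ (ComponentLabelling ends)
components {n} zero ends = n , record
  { label      = λ a → a
  ; surjective = λ a → a , refl
  ; classes    = mk⇔ (λ { refl → EqC.reflexive _ })
                     (EqC.gfold isEquivalence (λ a → a) λ ())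
  }
components (suc m) ends with components m (ends ∘ suc)
... | zero , L = ⊥-elim (Fin.¬Fin0 (ComponentLabelling.label L (proj₁ (ends zero))))
... | suc c , L with ComponentLabelling.label L (proj₁ (ends zero))
                       Fin.≟ ComponentLabelling.label L (proj₂ (ends zero))
...   | yes a≡b = suc c , Merge.kept ends L a≡b
...   | no  a≢b = c , Merge.merged ends L a≢b

c : Graph → ℕ
c G = proj₁ (components (Graph.size G) (Graph.ends G))

------------------------------------------------------------------------
-- Cycles and rank

-- A cycle of length suc k: distinct vertices v₀, …, v_k and distinct
-- edges e₀, …, e_k such that e_i joins v_i and v_{i+1 mod (k+1)}.  The case
-- k = 0 is a loop, and k = 1 is a pair of parallel edges.
IsCycle : ∀ {n m} → (Fin m → Fin n × Fin n) →
          ∀ {k} → Vec (Fin n) (suc k) → Vec (Fin m) (suc k) → Set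
IsCycle ends (v₀ ∷ vs) es =
    Unique (v₀ ∷ vs)
  × Unique es
  × (∀ i → Joins ends (lookup es i) (lookup (v₀ ∷ vs) i) (lookup (vs ∷ʳ v₀) i))

HasCycle : (G : Graph) → Subset (Graph.size G) → Set
HasCycle G F = ∃ λ k →
  Σ (Vec (Fin v) (suc k)) λ vs → Σ (Vec (Fin size) (suc k)) λ es →
  IsCycle ends vs es × (∀ i → lookup es i ∈ˢ F)
  where open Graph G

Acyclic : (G : Graph) → Subset (Graph.size G) → Set
Acyclic G F = ¬ HasCycle G F

record MaximalAcyclic (G : Graph) (F A : Subset (Graph.size G)) : Set where
  field
    subset  : A ⊆ F
    acyclic : Acyclic G A
    maximal : ∀ B → B ⊆ F → Acyclic G B → ¬ A ⊂ B

private
  anyVec? : ∀ {n} k {P : Pred (Vec (Fin n) k) 0ℓ} → Decidable P → Dec (∃ P)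
  anyVec? zero    P? = map′ (λ p → [] , p) (λ { ([] , p) → p }) (P? [])
  anyVec? (suc k) P? =
    map′ (λ (x , xs , p) → x ∷ xs , p) (λ { (x ∷ xs , p) → x , xs , p })
         (Fin.any? λ x → anyVec? k λ xs → P? (x ∷ xs))

  joins? : ∀ {n m} (ends : Fin m → Fin n × Fin n) e a b → Dec (Joins ends e a b)
  joins? ends e a b = (ends e ≟² (a , b)) ⊎-dec (ends e ≟² (b , a))
    where
    _≟²_ : ∀ {n} (p q : Fin n × Fin n) → Dec (p ≡ q)
    (x , y) ≟² (z , w) = map′ (λ { (refl , refl) → refl }) (λ { refl → refl , refl })
                              ((x Fin.≟ z) ×-dec (y Fin.≟ w))

  unique? : ∀ {n k} (xs : Vec (Fin n) k) → Dec (Unique xs)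
  unique? = allPairs? (λ x y → ¬? (x Fin.≟ y))

  isCycle? : ∀ {n m} (ends : Fin m → Fin n × Fin n) {k}
             (vs : Vec (Fin n) (suc k)) (es : Vec (Fin m) (suc k)) → Dec (IsCycle ends vs es)
  isCycle? ends (v₀ ∷ vs) es =
    unique? (v₀ ∷ vs) ×-dec (unique? es ×-dec
      Fin.all? λ i → joins? ends (lookup es i) (lookup (v₀ ∷ vs) i) (lookup (vs ∷ʳ v₀) i))

hasCycle? : (G : Graph) → Decidable (HasCycle G)
hasCycle? G F =
  map′ (λ (k , _ , cyc) → k , cyc) (λ (k , cyc) → k , short cyc , cyc)
    (ℕ.anyUpTo? (λ k → anyVec? (suc k) λ vs → anyVec? (suc k) λ es →
       isCycle? ends vs es ×-dec Fin.all? λ i → lookup es i ∈? F) v)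
  where
  open Graph G
  short : ∀ {k} → (Σ (Vec (Fin v) (suc k)) λ vs → Σ (Vec (Fin size) (suc k)) λ es →
            IsCycle ends vs es × (∀ i → lookup es i ∈ˢ F)) → k < v
  short (v₀ ∷ vs , es , (uniq , _) , _) = Fin.injective⇒≤ (λ {i} {j} → lookup-injective uniq i j)

maximalAcyclic : (G : Graph) (F : Subset (Graph.size G)) → ∃ (MaximalAcyclic G F)
maximalAcyclic G F = grow size ⊥ (ℕ.m≤m+n size _) (⊆-min F)
                       (λ (_ , _ , _ , _ , es⊆⊥) → ∉⊥ (es⊆⊥ zero))
  where
  open Graph G
  grow : ∀ fuel A → size ≤ fuel ℕ.+ ∣ A ∣ → A ⊆ F → Acyclic G A → ∃ (MaximalAcyclic G F)
  grow fuel A bound A⊆F acyc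
    with anySubset? (λ B → (B ⊆? F) ×-dec (¬? (hasCycle? G B) ×-dec (A ⊂? B)))
  grow fuel A bound A⊆F acyc | no none = A , record
    { subset = A⊆F ; acyclic = acyc
    ; maximal = λ B B⊆F acycB A⊂B → none (B , B⊆F , acycB , A⊂B) }
  grow zero A bound A⊆F acyc | yes (B , B⊆F , acycB , A⊂B) =
    ⊥-elim (ℕ.<⇒≱ (ℕ.<-≤-trans (p⊂q⇒∣p∣<∣q∣ A⊂B) (∣p∣≤n B)) bound)
  grow (suc fuel) A bound A⊆F acyc | yes (B , B⊆F , acycB , A⊂B) =
    grow fuel B (ℕ.≤-trans bound (ℕ.≤-trans (ℕ.≤-reflexive (sym (ℕ.+-suc fuel ∣ A ∣)))
                                            (ℕ.+-monoʳ-≤ fuel (p⊂q⇒∣p∣<∣q∣ A⊂B)))) B⊆F acycB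

r : (G : Graph) → Subset (Graph.size G) → ℕ
r G F = ∣ proj₁ (maximalAcyclic G F) ∣

------------------------------------------------------------------------
-- The Tutte polynomial, evaluated in a ring

module Tutte (R : RawRing 0ℓ 0ℓ) where
  open RawRing R
  open RawSemiringDefs rawSemiring using (_^_)

  sumSubsets : ∀ {n} → (Subset n → Carrier) → Carrier
  sumSubsets {zero}  f = f []
  sumSubsets {suc n} f = sumSubsets (f ∘ (outside ∷_)) + sumSubsets (f ∘ (inside ∷_))

  tutte : Graph → Carrier → Carrier → Carrier
  tutte G x y = sumSubsets λ F →
    (x + - 1#) ^ (r G ⊤ ∸ r G F) * (y + - 1#) ^ (∣ F ∣ ∸ r G F)

------------------------------------------------------------------------
-- Integer polynomials in q, as lists of coefficients (constant term
-- first, trailing zeros allowed)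

ℤ[q] : Set
ℤ[q] = List ℤ

coeff : ℤ[q] → ℕ → ℤ
coeff []      _       = 0ℤ
coeff (a ∷ p) zero    = a
coeff (a ∷ p) (suc i) = coeff p i

infix  4 _≈ₚ_ _≉ₚ_
infixl 6 _+ₚ_ _-ₚ_
infixl 7 _*ₚ_

_≈ₚ_ _≉ₚ_ : ℤ[q] → ℤ[q] → Set
p ≈ₚ p′ = ∀ i → coeff p i ≡ coeff p′ i
p ≉ₚ p′ = ¬ p ≈ₚ p′

0ₚ 1ₚ : ℤ[q]
0ₚ = []
1ₚ = 1ℤ ∷ []

_+ₚ_ _*ₚ_ _-ₚ_ : ℤ[q] → ℤ[q] → ℤ[q]
[]      +ₚ p′       = p′
(a ∷ p) +ₚ []       = a ∷ p
(a ∷ p) +ₚ (b ∷ p′) = a ℤ.+ b ∷ p +ₚ p′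

negₚ : ℤ[q] → ℤ[q]
negₚ = List.map (λ a → ℤ.- a)

p -ₚ p′ = p +ₚ negₚ p′

[]      *ₚ p′ = []
(a ∷ p) *ₚ p′ = List.map (a ℤ.*_) p′ +ₚ (0ℤ ∷ p *ₚ p′)

MonicOfDegree : ℕ → ℤ[q] → Set
MonicOfDegree n p = coeff p n ≡ 1ℤ × (∀ i → n < i → coeff p i ≡ 0ℤ)

[_]q : ℕ → ℤ[q]
[ m ]q = List.replicate m 1ℤ

[d]-1≉0 : ∀ {d} → 2 ≤ d → [ d ]q -ₚ 1ₚ ≉ₚ 0ₚ
[d]-1≉0 (s≤s (s≤s z≤n)) eq with () ← eq 1

1ₚ≉0 : 1ₚ ≉ₚ 0ₚ
1ₚ≉0 eq with () ← eq 0

private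
  coeff-+ : ∀ p p′ i → coeff (p +ₚ p′) i ≡ coeff p i ℤ.+ coeff p′ i
  coeff-+ []      p′       i       = sym (ℤ.+-identityˡ _)
  coeff-+ (a ∷ p) []       i       = sym (ℤ.+-identityʳ _)
  coeff-+ (a ∷ p) (b ∷ p′) zero    = refl
  coeff-+ (a ∷ p) (b ∷ p′) (suc i) = coeff-+ p p′ i

  coeff-scale : ∀ a p i → coeff (List.map (a ℤ.*_) p) i ≡ a ℤ.* coeff p i
  coeff-scale a []      i       = sym (ℤ.*-zeroʳ a)
  coeff-scale a (b ∷ p) zero    = refl
  coeff-scale a (b ∷ p) (suc i) = coeff-scale a p i

  coeff-*ˡ : ∀ a p p′ i → coeff ((a ∷ p) *ₚ p′) i ≡ a ℤ.* coeff p′ i ℤ.+ coeff (0ℤ ∷ p *ₚ p′) i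
  coeff-*ˡ a p p′ i = trans (coeff-+ (List.map (a ℤ.*_) p′) _ i)
                            (cong (ℤ._+ coeff (0ℤ ∷ p *ₚ p′) i) (coeff-scale a p′ i))

  *-shiftʳ : ∀ p p′ → p *ₚ (0ℤ ∷ p′) ≈ₚ 0ℤ ∷ p *ₚ p′
  *-shiftʳ []      p′ zero    = refl
  *-shiftʳ []      p′ (suc i) = refl
  *-shiftʳ (a ∷ p) p′ zero    = trans (ℤ.+-identityʳ _) (ℤ.*-zeroʳ a)
  *-shiftʳ (a ∷ p) p′ (suc i) = trans (coeff-*ˡ a p (0ℤ ∷ p′) (suc i))
    (trans (cong (λ z → a ℤ.* coeff p′ i ℤ.+ z) (*-shiftʳ p p′ i)) (sym (coeff-*ˡ a p p′ i)))

  tail≉0 : ∀ {a p} → a ≡ 0ℤ → a ∷ p ≉ₚ 0ₚ → p ≉ₚ 0ₚ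
  tail≉0 a≡0 ap≉0 p≈0 = ap≉0 λ { zero → a≡0 ; (suc i) → p≈0 i }

  dropˡ : ∀ {a} p p′ → a ≡ 0ℤ → (a ∷ p) *ₚ p′ ≈ₚ 0ₚ → p *ₚ p′ ≈ₚ 0ₚ
  dropˡ p p′ refl eq i = trans (sym (ℤ.+-identityˡ _))
    (trans (cong (ℤ._+ coeff (p *ₚ p′) i) (sym (ℤ.*-zeroˡ (coeff p′ (suc i)))))
    (trans (sym (coeff-*ˡ 0ℤ p p′ (suc i))) (eq (suc i))))

  dropʳ : ∀ {b} p p′ → b ≡ 0ℤ → p *ₚ (b ∷ p′) ≈ₚ 0ₚ → p *ₚ p′ ≈ₚ 0ₚ
  dropʳ p p′ refl eq i = trans (sym (*-shiftʳ p p′ (suc i))) (eq (suc i))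

  ∷-≉0 : ∀ a p b p′ → (p ≉ₚ 0ₚ → p *ₚ (b ∷ p′) ≉ₚ 0ₚ) → (p′ ≉ₚ 0ₚ → (a ∷ p) *ₚ p′ ≉ₚ 0ₚ) →
         a ∷ p ≉ₚ 0ₚ → b ∷ p′ ≉ₚ 0ₚ → (a ∷ p) *ₚ (b ∷ p′) ≉ₚ 0ₚ
  ∷-≉0 a p b p′ ihˡ ihʳ ap≉0 bp′≉0 eq with a ℤ.≟ 0ℤ | b ℤ.≟ 0ℤ
  ... | yes a≡0 | _     = ihˡ (tail≉0 a≡0 ap≉0) (dropˡ p (b ∷ p′) a≡0 eq)
  ... | no _  | yes b≡0 = ihʳ (tail≉0 b≡0 bp′≉0) (dropʳ (a ∷ p) p′ b≡0 eq)
  ... | no a≢0 | no b≢0 with ℤ.i*j≡0⇒i≡0∨j≡0 a (trans (sym (ℤ.+-identityʳ _)) (eq 0))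
  ...   | inj₁ a≡0 = a≢0 a≡0
  ...   | inj₂ b≡0 = b≢0 b≡0

*ₚ-≉0 : ∀ p p′ → p ≉ₚ 0ₚ → p′ ≉ₚ 0ₚ → p *ₚ p′ ≉ₚ 0ₚ
*ₚ-≉0 []      p′ p≉0 p′≉0 _ = p≉0 λ _ → refl
*ₚ-≉0 (a ∷ p) [] p≉0 p′≉0 _ = p′≉0 λ _ → refl
*ₚ-≉0 (a ∷ p) (b ∷ p′) p≉0 p′≉0 =
  ∷-≉0 a p b p′ (λ h → *ₚ-≉0 p (b ∷ p′) h p′≉0) (λ h → *ₚ-≉0 (a ∷ p) p′ p≉0 h) p≉0 p′≉0

------------------------------------------------------------------------
-- The field ℚ(q) of rational functions, as fractions over ℤ[q]

record ℚ⟨q⟩ : Set where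
  constructor fraction
  field
    numerator     : ℤ[q]
    denominator   : ℤ[q]
    denominator≉0 : denominator ≉ₚ 0ₚ

fromPoly : ℤ[q] → ℚ⟨q⟩
fromPoly p = fraction p 1ₚ 1ₚ≉0

ℚ⟨q⟩-rawRing : RawRing 0ℓ 0ℓ
ℚ⟨q⟩-rawRing = record
  { Carrier = ℚ⟨q⟩
  ; _≈_ = λ (fraction a b _) (fraction a′ b′ _) → a *ₚ b′ ≈ₚ a′ *ₚ b
  ; _+_ = λ (fraction a b b≉0) (fraction a′ b′ b′≉0) →
            fraction (a *ₚ b′ +ₚ a′ *ₚ b) (b *ₚ b′) (*ₚ-≉0 b b′ b≉0 b′≉0)
  ; _*_ = λ (fraction a b b≉0) (fraction a′ b′ b′≉0) →
            fraction (a *ₚ a′) (b *ₚ b′) (*ₚ-≉0 b b′ b≉0 b′≉0)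
  ; -_  = λ (fraction a b b≉0) → fraction (negₚ a) b b≉0
  ; 0#  = fromPoly 0ₚ
  ; 1#  = fromPoly 1ₚ
  }

------------------------------------------------------------------------
-- Real numbers, as Cauchy sequences of rationals

IsCauchy : (ℕ → ℚ) → Set
IsCauchy x = ∀ ε → 0ℚ ℚ.< ε →
  ∃ λ N → ∀ m n → N ≤ m → N ≤ n → ℚ.∣ x m ℚ.- x n ∣ ℚ.< ε

record ℝ : Set where
  constructor real
  field
    seq    : ℕ → ℚ
    cauchy : IsCauchy seq

infix 4 _≈ᵣ_
_≈ᵣ_ : ℝ → ℝ → Set
real x _ ≈ᵣ real y _ = ∀ ε → 0ℚ ℚ.< ε → ∃ λ N → ∀ n → N ≤ n → ℚ.∣ x n ℚ.- y n ∣ ℚ.< ε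

private
  module S = ℚSolver.+-*-Solver

  half>0 : ∀ {ε} → 0ℚ ℚ.< ε → 0ℚ ℚ.< ½ ℚ.* ε
  half>0 {ε} ε>0 = ℚ.positive⁻¹ _ {{ℚ.pos*pos⇒pos ½ ε {{ℚ.positive ε>0}}}}

  halves : ∀ ε → ½ ℚ.* ε ℚ.+ ½ ℚ.* ε ≡ ε
  halves ε = trans (sym (ℚ.*-distribʳ-+ ε ½ ½)) (ℚ.*-identityˡ ε)

  opaque
    +-cauchy : ∀ {x y} → IsCauchy x → IsCauchy y → IsCauchy (λ n → x n ℚ.+ y n)
    +-cauchy {x} {y} cx cy ε ε>0 with cx (½ ℚ.* ε) (half>0 ε>0) | cy (½ ℚ.* ε) (half>0 ε>0)
    ... | M , hx | N , hy = M ⊔ N , λ m n M⊔N≤m M⊔N≤n → begin-strict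
      ℚ.∣ (x m ℚ.+ y m) ℚ.- (x n ℚ.+ y n) ∣         ≡⟨ cong ℚ.∣_∣ (regroup (x m) (y m) (x n) (y n)) ⟩
      ℚ.∣ (x m ℚ.- x n) ℚ.+ (y m ℚ.- y n) ∣         ≤⟨ ℚ.∣p+q∣≤∣p∣+∣q∣ (x m ℚ.- x n) (y m ℚ.- y n) ⟩
      ℚ.∣ x m ℚ.- x n ∣ ℚ.+ ℚ.∣ y m ℚ.- y n ∣       <⟨ ℚ.+-mono-<
        (hx m n (ℕ.m⊔n≤o⇒m≤o M N M⊔N≤m) (ℕ.m⊔n≤o⇒m≤o M N M⊔N≤n))
        (hy m n (ℕ.m⊔n≤o⇒n≤o M N M⊔N≤m) (ℕ.m⊔n≤o⇒n≤o M N M⊔N≤n)) ⟩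
      ½ ℚ.* ε ℚ.+ ½ ℚ.* ε                           ≡⟨ halves ε ⟩
      ε                                             ∎
      where
      open ℚ.≤-Reasoning
      regroup : ∀ a b c d → (a ℚ.+ b) ℚ.- (c ℚ.+ d) ≡ (a ℚ.- c) ℚ.+ (b ℚ.- d)
      regroup = S.solve 4 (λ a b c d → (a S.:+ b) S.:- (c S.:+ d) S.:= (a S.:- c) S.:+ (b S.:- d)) refl

    neg-cauchy : ∀ {x} → IsCauchy x → IsCauchy (λ n → ℚ.- x n)
    neg-cauchy {x} cx ε ε>0 with cx ε ε>0
    ... | N , hx = N , λ m n N≤m N≤n → subst (ℚ._< ε) (flip (x m) (x n)) (hx m n N≤m N≤n)
      where
      flip : ∀ a b → ℚ.∣ a ℚ.- b ∣ ≡ ℚ.∣ (ℚ.- a) ℚ.- (ℚ.- b) ∣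
      flip a b = trans (sym (ℚ.∣-p∣≡∣p∣ (a ℚ.- b)))
        (cong ℚ.∣_∣ (S.solve 2 (λ a b → S.:- (a S.:- b) S.:= (S.:- a) S.:- (S.:- b)) refl a b))

  opaque
    const-cauchy : ∀ p → IsCauchy (λ _ → p)
    const-cauchy p ε ε>0 = 0 , λ _ _ _ _ →
      subst (ℚ._< ε) (sym (cong ℚ.∣_∣ (ℚ.+-inverseʳ p))) ε>0

  bounded : ∀ {x} → IsCauchy x → ∃ λ B → 0ℚ ℚ.< B × ∃ λ N → ∀ n → N ≤ n → ℚ.∣ x n ∣ ℚ.≤ B
  bounded {x} cx with cx 1ℚ (ℚ.positive⁻¹ 1ℚ)
  ... | N , hx = 1ℚ ℚ.+ ℚ.∣ x N ∣
               , ℚ.+-mono-<-≤ (ℚ.positive⁻¹ 1ℚ) (ℚ.0≤∣p∣ (x N))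
               , N , λ n N≤n → begin
    ℚ.∣ x n ∣                           ≡⟨ cong ℚ.∣_∣ (split (x n) (x N)) ⟩
    ℚ.∣ (x n ℚ.- x N) ℚ.+ x N ∣         ≤⟨ ℚ.∣p+q∣≤∣p∣+∣q∣ (x n ℚ.- x N) (x N) ⟩
    ℚ.∣ x n ℚ.- x N ∣ ℚ.+ ℚ.∣ x N ∣     ≤⟨ ℚ.+-monoˡ-≤ ℚ.∣ x N ∣ (ℚ.<⇒≤ (hx n N N≤n ℕ.≤-refl)) ⟩
    1ℚ ℚ.+ ℚ.∣ x N ∣                    ∎
    where
    open ℚ.≤-Reasoning
    split : ∀ a b → a ≡ (a ℚ.- b) ℚ.+ b
    split = S.solve 2 (λ a b → a S.:= (a S.:- b) S.:+ b) refl

  scale-< : ∀ {p q B δ} → 0ℚ ℚ.< B → ℚ.∣ p ∣ ℚ.≤ B → ℚ.∣ q ∣ ℚ.< δ → ℚ.∣ p ℚ.* q ∣ ℚ.< B ℚ.* δ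
  scale-< {p} {q} {B} {δ} B>0 p≤B q<δ = begin-strict
    ℚ.∣ p ℚ.* q ∣           ≡⟨ ℚ.∣p*q∣≡∣p∣*∣q∣ p q ⟩
    ℚ.∣ p ∣ ℚ.* ℚ.∣ q ∣     ≤⟨ ℚ.*-monoʳ-≤-nonNeg ℚ.∣ q ∣ {{ℚ.nonNegative (ℚ.0≤∣p∣ q)}} p≤B ⟩
    B ℚ.* ℚ.∣ q ∣           <⟨ ℚ.*-monoʳ-<-pos B {{ℚ.positive B>0}} q<δ ⟩
    B ℚ.* δ                 ∎
    where open ℚ.≤-Reasoning

  shrink : ∀ {K ε} → 0ℚ ℚ.< K → 0ℚ ℚ.< ε → ∃ λ δ → 0ℚ ℚ.< δ × K ℚ.* δ ≡ ε
  shrink {K} {ε} K>0 ε>0 =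
      K⁻¹ ℚ.* ε
    , ℚ.positive⁻¹ _ {{ℚ.pos*pos⇒pos K⁻¹ {{ℚ.1/pos⇒pos K}} ε {{ℚ.positive ε>0}}}}
    , trans (sym (ℚ.*-assoc K K⁻¹ ε))
            (trans (cong (ℚ._* ε) (ℚ.*-inverseʳ K)) (ℚ.*-identityˡ ε))
    where
    instance
      K-pos : ℚ.Positive K
      K-pos = ℚ.positive K>0
      K-nonZero : ℚ.NonZero K
      K-nonZero = ℚ.pos⇒nonZero K
    K⁻¹ : ℚ
    K⁻¹ = ℚ.1/ K

  product-regroup : ∀ a b c d → a ℚ.* b ℚ.- c ℚ.* d ≡ a ℚ.* (b ℚ.- d) ℚ.+ d ℚ.* (a ℚ.- c)
  product-regroup = S.solve 4 (λ a b c d → (a S.:* b) S.:- (c S.:* d) S.:=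
                                           (a S.:* (b S.:- d)) S.:+ (d S.:* (a S.:- c))) refl

  product-bound : ∀ {B C δ ε} a b c d → 0ℚ ℚ.< B → 0ℚ ℚ.< C → (B ℚ.+ C) ℚ.* δ ≡ ε →
    ℚ.∣ a ∣ ℚ.≤ B → ℚ.∣ b ℚ.- d ∣ ℚ.< δ → ℚ.∣ d ∣ ℚ.≤ C → ℚ.∣ a ℚ.- c ∣ ℚ.< δ →
    ℚ.∣ a ℚ.* b ℚ.- c ℚ.* d ∣ ℚ.< ε
  product-bound {B} {C} {δ} {ε} a b c d B>0 C>0 Kδ≡ε a≤B bd<δ d≤C ac<δ = begin-strict
    ℚ.∣ a ℚ.* b ℚ.- c ℚ.* d ∣
      ≡⟨ cong ℚ.∣_∣ (product-regroup a b c d) ⟩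
    ℚ.∣ a ℚ.* (b ℚ.- d) ℚ.+ d ℚ.* (a ℚ.- c) ∣
      ≤⟨ ℚ.∣p+q∣≤∣p∣+∣q∣ (a ℚ.* (b ℚ.- d)) (d ℚ.* (a ℚ.- c)) ⟩
    ℚ.∣ a ℚ.* (b ℚ.- d) ∣ ℚ.+ ℚ.∣ d ℚ.* (a ℚ.- c) ∣
      <⟨ ℚ.+-mono-< (scale-< {a} {b ℚ.- d} B>0 a≤B bd<δ) (scale-< {d} {a ℚ.- c} C>0 d≤C ac<δ) ⟩
    B ℚ.* δ ℚ.+ C ℚ.* δ
      ≡⟨ ℚ.*-distribʳ-+ δ B C ⟨
    (B ℚ.+ C) ℚ.* δ
      ≡⟨ Kδ≡ε ⟩
    ε ∎
    where open ℚ.≤-Reasoning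

  opaque
    *-cauchy : ∀ {x y} → IsCauchy x → IsCauchy y → IsCauchy (λ n → x n ℚ.* y n)
    *-cauchy {x} {y} cx cy ε ε>0 = fromBounds (bounded {x} cx) (bounded {y} cy)
      where
      Close : Set
      Close = ∃ λ N → ∀ m n → N ≤ m → N ≤ n → ℚ.∣ x m ℚ.* y m ℚ.- x n ℚ.* y n ∣ ℚ.< ε

      fromBounds : (∃ λ B → 0ℚ ℚ.< B × ∃ λ K → ∀ n → K ≤ n → ℚ.∣ x n ∣ ℚ.≤ B) →
                   (∃ λ C → 0ℚ ℚ.< C × ∃ λ L → ∀ n → L ≤ n → ℚ.∣ y n ∣ ℚ.≤ C) → Close
      fromBounds (B , B>0 , K , hB) (C , C>0 , L , hC) =
        fromModulus (shrink (ℚ.+-mono-< B>0 C>0) ε>0)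
        where
        fromModulus : (∃ λ δ → 0ℚ ℚ.< δ × (B ℚ.+ C) ℚ.* δ ≡ ε) → Close
        fromModulus (δ , δ>0 , Kδ≡ε) =
          let X , hx = cx δ δ>0
              Y , hy = cy δ δ>0
          in (K ⊔ L) ⊔ (X ⊔ Y) , λ m n N≤m N≤n →
            let KL≤m = ℕ.m⊔n≤o⇒m≤o (K ⊔ L) (X ⊔ Y) N≤m
                XY≤m = ℕ.m⊔n≤o⇒n≤o (K ⊔ L) (X ⊔ Y) N≤m
                KL≤n = ℕ.m⊔n≤o⇒m≤o (K ⊔ L) (X ⊔ Y) N≤n
                XY≤n = ℕ.m⊔n≤o⇒n≤o (K ⊔ L) (X ⊔ Y) N≤n
            in product-bound (x m) (y m) (x n) (y n) B>0 C>0 Kδ≡ε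
                 (hB m (ℕ.m⊔n≤o⇒m≤o K L KL≤m))
                 (hy m n (ℕ.m⊔n≤o⇒n≤o X Y XY≤m) (ℕ.m⊔n≤o⇒n≤o X Y XY≤n))
                 (hC n (ℕ.m⊔n≤o⇒n≤o K L KL≤n))
                 (hx m n (ℕ.m⊔n≤o⇒m≤o X Y XY≤m) (ℕ.m⊔n≤o⇒m≤o X Y XY≤n))

infixl 6 _+ᵣ_
infixl 7 _*ᵣ_
infix  8 -ᵣ_

_+ᵣ_ _*ᵣ_ : ℝ → ℝ → ℝ
real x cx +ᵣ real y cy = real (λ n → x n ℚ.+ y n) (+-cauchy {x} {y} cx cy)
real x cx *ᵣ real y cy = real (λ n → x n ℚ.* y n) (*-cauchy {x} {y} cx cy)

-ᵣ_ : ℝ → ℝ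
-ᵣ real x cx = real (λ n → ℚ.- x n) (neg-cauchy {x} cx)

fromℚ : ℚ → ℝ
fromℚ p = real (λ _ → p) (const-cauchy p)

------------------------------------------------------------------------
-- Complex numbers

ℂ : Set
ℂ = ℝ × ℝ

ℂ-rawRing : RawRing 0ℓ 0ℓ
ℂ-rawRing = record
  { Carrier = ℂ
  ; _≈_ = λ (a , b) (a′ , b′) → a ≈ᵣ a′ × b ≈ᵣ b′
  ; _+_ = λ (a , b) (a′ , b′) → a +ᵣ a′ , b +ᵣ b′
  ; _*_ = λ (a , b) (a′ , b′) → a *ᵣ a′ +ᵣ -ᵣ (b *ᵣ b′) , a *ᵣ b′ +ᵣ b *ᵣ a′
  ; -_  = λ (a , b) → -ᵣ a , -ᵣ b
  ; 0#  = fromℚ 0ℚ , fromℚ 0ℚ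
  ; 1#  = fromℚ 1ℚ , fromℚ 0ℚ
  }

open RawRing ℂ-rawRing using ()
  renaming (_≈_ to _≈ᶜ_; _+_ to _+ᶜ_; _*_ to _*ᶜ_; -_ to -ᶜ_; 0# to 0ᶜ; 1# to 1ᶜ)

private
  diff≈0⇒≈ᵣ : ∀ x y → x +ᵣ -ᵣ y ≈ᵣ fromℚ 0ℚ → x ≈ᵣ y
  diff≈0⇒≈ᵣ (real x _) (real y _) eq ε ε>0 with eq ε ε>0
  ... | N , h = N , λ n N≤n → subst (λ z → ℚ.∣ z ∣ ℚ.< ε) (ℚ.+-identityʳ _) (h n N≤n)

diff≈0⇒≈ : ∀ x y → x +ᶜ -ᶜ y ≈ᶜ 0ᶜ → x ≈ᶜ y
diff≈0⇒≈ (a , b) (a′ , b′) (p , q) = diff≈0⇒≈ᵣ a a′ p , diff≈0⇒≈ᵣ b b′ q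

------------------------------------------------------------------------
-- Projective space and the Zariski topology on its powers

-- Homogeneous coordinates of a point of ℙᵈ⁻¹, the space of lines through
-- the origin of ℂᵈ.  Proportional vectors represent the same point; they
-- are not identified here, but multihomogeneous polynomials cannot
-- distinguish them.
record ℙ[ℂ^_] (d : ℕ) : Set where
  constructor point
  field
    coords  : Fin d → ℂ
    nonzero : ¬ (∀ i → coords i ≈ᶜ 0ᶜ)

module _ (m d : ℕ) where
  open RawSemiringDefs (RawRing.rawSemiring ℂ-rawRing) using (product; _^_)
  open RawMonoidDefs ℕ.+-0-rawMonoid using (sum)

  -- A term with coefficient in ℂ in the variables x_{e,i}, e : Fin m,
  -- i : Fin d, of degree δ e in the block x_{e,0}, …, x_{e,d-1}.
  record Term (δ : Fin m → ℕ) : Set where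
    field
      coefficient : ℂ
      exponent    : Fin m → Fin d → ℕ
      multidegree : ∀ e → sum (exponent e) ≡ δ e

  record MultihomogeneousPolynomial : Set where
    field
      degree : Fin m → ℕ
      terms  : List (Term degree)

  evalTerm : ∀ {δ} → Term δ → (Fin m → Fin d → ℂ) → ℂ
  evalTerm t x = coefficient *ᶜ product λ e → product λ i → x e i ^ exponent e i
    where open Term t

  eval : MultihomogeneousPolynomial → (Fin m → Fin d → ℂ) → ℂ
  eval f x = List.foldr (λ t s → evalTerm t x +ᶜ s) 0ᶜ (MultihomogeneousPolynomial.terms f)

  -- The Zariski-closed subset of (ℙᵈ⁻¹)ᵐ cut out by a family of
  -- multihomogeneous polynomials.
  ZeroLocus : {I : Set} → (I → MultihomogeneousPolynomial) → Pred (Fin m → ℙ[ℂ^ d ]) 0ℓ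
  ZeroLocus f x = ∀ i → eval (f i) (ℙ[ℂ^_].coords ∘ x) ≈ᶜ 0ᶜ

  -- Every Zariski-closed set containing the image is the whole space.
  HasDenseImage : {A : Set} → (A → Fin m → ℙ[ℂ^ d ]) → Set₁
  HasDenseImage φ = ∀ {I : Set} (f : I → MultihomogeneousPolynomial) →
    (∀ a → ZeroLocus f (φ a)) → ∀ x → ZeroLocus f x

------------------------------------------------------------------------
-- Generic d-parallel independence

record DistinctPoints (n d : ℕ) : Set where
  field
    position : Fin n → Fin d → ℂ
    distinct : ∀ {a b} → a ≢ b → ¬ (∀ i → position a i ≈ᶜ position b i)

  direction : ∀ a b → a ≢ b → ℙ[ℂ^ d ]
  direction a b a≢b = point (λ i → position a i +ᶜ -ᶜ position b i)
    λ zeros → distinct a≢b λ i → diff≈0⇒≈ (position a i) (position b i) (zeros i)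

Loopless : Graph → Set
Loopless G = ∀ e → ¬ Loop G e

directions : (G : Graph) → Loopless G → ∀ {d} →
             DistinctPoints (Graph.v G) d → Fin (Graph.size G) → ℙ[ℂ^ d ]
directions G loopless p e = DistinctPoints.direction p _ _ (loopless e)

ParallelIndependent : ℕ → Graph → Set₁
ParallelIndependent d G = Σ (Loopless G) λ loopless →
  HasDenseImage (Graph.size G) d (directions G loopless {d})

------------------------------------------------------------------------
-- ([d]_q − 1)^{v(G) − c(G)} T_G([2]_q [d]_q / ([d]_q − 1), [d]_q)

open RawRing ℚ⟨q⟩-rawRing public
  using () renaming (_≈_ to _≈𝕢_; _*_ to _*𝕢_)
open RawSemiringDefs (RawRing.rawSemiring ℚ⟨q⟩-rawRing) using () renaming (_^_ to _^𝕢_)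

specialization : Graph → ∀ d → 2 ≤ d → ℚ⟨q⟩
specialization G d 2≤d =
  fromPoly ([ d ]q -ₚ 1ₚ) ^𝕢 (Graph.v G ∸ c G) *𝕢
  Tutte.tutte ℚ⟨q⟩-rawRing G
    (fraction ([ 2 ]q *ₚ [ d ]q) ([ d ]q -ₚ 1ₚ) ([d]-1≉0 2≤d))
    (fromPoly [ d ]q)

{-# OPTIONS --safe #-}

-- Call G sparse if (d − 1)∣F∣ < d ρ(F) for every nonempty edge set F, where
-- ρ(F) is the number of vertices minus the number of components of (V , F).
--
-- Expanding the Tutte polynomial turns the specialization into
-- Σ_F [d+1]^(ρ(E) − ρ(F)) ([d] − 1)^∣F∣.  Every summand is monic with
-- nonnegative coefficients, of degree d ρ(E) − (d ρ(F) − (d − 1)∣F∣), and the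
-- summand of F = ∅ has degree d ρ(E).  So the sum is monic of degree d ρ(E) if
-- and only if G is sparse.
--
-- Let G be sparse and e₀ an edge.  By Nash-Williams' theorem there are d
-- spanning forests that all contain e₀ such that every edge is missed by at
-- most one of them.  For directions x and scalars t, the vectors t e · x e are
-- differences of points as soon as, for every edge e missed by the i-th
-- forest, the i-th coordinate of t e · x e is the sum of those along the path
-- of that forest joining the ends of e.  This is one linear equation in t per
-- missed edge.  Fraction-free elimination solves the system with t polynomial
-- in x, and t e₀ = 1 where x e is the i-th basis vector for the missed edges e
-- and 0 for all others.
-- Combining the solutions for all e₀, generic directions are realised with
-- all t e ≠ 0, and a polynomial vanishing on the image vanishes everywhere.
--
-- Conversely, let F be a minimal nonempty set with d ρ(F) ≤ (d − 1)∣F∣.  By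
-- Nash-Williams' theorem there are d forests spanning F such that every edge
-- of F is missed by one of them.  The same equations form a square system for
-- the scalars on F, solved by t = 1 on the image.  The product of the pivots
-- of the elimination is thus a multihomogeneous polynomial vanishing on the
-- image, and it is 1 at the basis vectors.

module Submission where

open import Defs
open import Algebra.Bundles using (CommutativeRing; RawRing)
import Algebra.Definitions.RawSemiring as RawSemiringDefs
import Algebra.Properties.CommutativeMonoid.Sum
import Algebra.Properties.CommutativeSemigroup
import Algebra.Properties.CommutativeSemiring.Exp
import Algebra.Properties.Monoid.Sum
import Algebra.Properties.Ring
import Algebra.Properties.Semiring.Exp
import Algebra.Properties.Semiring.Mult
import Algebra.Properties.Semiring.Sum
import Algebra.Solver.Ring
open import Algebra.Solver.Ring.AlmostCommutativeRing using (fromCommutativeRing; _-Raw-AlmostCommutative⟶_)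
open import Data.Bool using (if_then_else_)
open import Data.Empty using (⊥-elim)
open import Data.Fin using (Fin; zero; suc)
import Data.Fin.Properties as Fin
open import Data.Fin.Subset using (Subset; inside; outside; _⊆_; ∣_∣; ⊤; ⊥; _∪_; _∩_; ⁅_⁆; Nonempty)
  renaming (_∈_ to _∈ˢ_; _∉_ to _∉ˢ_; _-_ to _∖_)
open import Data.Fin.Subset.Properties
  using ( _∈?_; _⊆?_; nonempty?; anySubset?; Empty-unique; ∉⊥; ∈⊤; ⊆⊤; ∣⊥∣≡0; x∈⁅x⁆; x∈⁅y⁆⇒x≡y
        ; x∈p∪q⁺; x∈p∪q⁻; x∈p∩q⁺; x∈p∩q⁻; p⊆p∪q; q⊆p∪q; p∩q⊆p; p∩q⊆q; p─q⊆p; x∈p∧x≢y⇒x∈p-y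
        ; ∪-identityˡ; ∪-identityʳ; ∩-identityˡ; ⊆-antisym; p⊆q⇒∣p∣≤∣q∣; p⊂q⇒∣p∣<∣q∣ )
open import Data.Integer as ℤ using (ℤ; 0ℤ; 1ℤ)
import Data.Integer.Properties as ℤ
open import Data.List as List using (List; []; _∷_; _++_)
open import Data.Maybe as Maybe using (Maybe; just; nothing)
import Data.Maybe.Properties as Maybe
open import Data.Nat as ℕ using (ℕ; zero; suc; _≤_; _<_; z≤n; s≤s; _∸_; _⊔_)
open import Data.Nat.Induction using (<-wellFounded)
import Data.Nat.Properties as ℕ
open import Data.Nat.Tactic.RingSolver using (solve-∀)
open import Data.Product using (∃; Σ; _×_; _,_; proj₁; proj₂)
open import Data.Product.Properties using (≡-dec)
open import Data.Rational as ℚ using (ℚ; 0ℚ; 1ℚ; ½)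
import Data.Rational.Properties as ℚ
import Data.Rational.Solver as ℚSolver
open import Data.Sum using (_⊎_; inj₁; inj₂; [_,_]′)
import Data.Unit as Unit
open import Data.Vec as Vec using (Vec; []; _∷_; here; there)
open import Data.Vec.Functional using (updateAt)
open import Data.Vec.Functional.Properties using (updateAt-updates; updateAt-minimal)
open import Function using (_∘_; _⇔_; mk⇔; Equivalence; id; const)
open import Induction.WellFounded using (Acc; acc)
open import Level using (0ℓ)
import Relation.Binary.Construct.Closure.Equivalence as EqC
open import Relation.Binary.Definitions using (tri<; tri≈; tri>)
open import Relation.Binary.PropositionalEquality as ≡ using (_≡_; _≢_)
import Relation.Binary.Reasoning.Setoid
open import Relation.Nullary using (¬_; Dec; yes; no; does; ¬?)
open import Relation.Nullary.Decidable using (_×-dec_; decidable-stable; dec⇒maybe; map′)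

-- Ring identities

-- Equality of complex numbers is not decidable here, so there is no choice of pivots, no rank of a
-- complex matrix and no dimension count. Elimination therefore runs in a fixed order without
-- division, and one point at which the matrix is the identity certifies that the polynomials
-- obtained do not vanish identically. Forests supply that point: an edge missed by the i-th forest
-- lies on no path in it, so letting every missed edge point along the axis of its own forest kills
-- all entries off the diagonal. Both directions use one kind of matrix and differ in the number of
-- equations. In the sparse case the extra copy of e₀ puts it into all forests, which frees it from
-- any equation and leaves room for a nonzero solution. In the dependent case every edge of F
-- carries an equation, so a nonzero solution forces the pivots to vanish. Nonvanishing is only
-- carried along under double negation. This suffices because being zero is stable under double
-- negation in ℂ.

module RingSolver (R : CommutativeRing 0ℓ 0ℓ) where
  open CommutativeRing R hiding (zero)
  open Algebra.Properties.Semiring.Mult semiring using (×-homo-+; ×1-homo-*) renaming (_×_ to _·_)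
  open Algebra.Properties.Ring ring using (-0#≈0#; -‿+-comm; -‿involutive; -‿distribˡ-*; -‿distribʳ-*)
  open Relation.Binary.Reasoning.Setoid setoid
  open import Algebra.Properties.CommutativeSemigroup +-commutativeSemigroup using (interchange)

  -- Cancelling until one side is zero gives every integer a single representative, so that
  -- `coefficient≟` can compare coefficients by `_≡_` although equality in the ring itself may be
  -- undecidable.
  normalise : ℕ × ℕ → ℕ × ℕ
  normalise (zero  , b)     = zero , b
  normalise (suc a , zero)  = suc a , zero
  normalise (suc a , suc b) = normalise (a , b)

  -- The pair (a , b) stands for the integer a − b.
  ⟦_⟧ : ℕ × ℕ → Carrier
  ⟦ a , b ⟧ = a · 1# - b · 1#

  integers : RawRing 0ℓ 0ℓ
  integers = record
    { Carrier = ℕ × ℕ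
    ; _≈_ = _≡_
    ; _+_ = λ (a , b) (c , d) → normalise (a ℕ.+ c , b ℕ.+ d)
    ; _*_ = λ (a , b) (c , d) → normalise (a ℕ.* c ℕ.+ b ℕ.* d , a ℕ.* d ℕ.+ b ℕ.* c)
    ; -_  = λ (a , b) → normalise (b , a)
    ; 0#  = 0 , 0
    ; 1#  = 1 , 0
    }

  +-diff : ∀ x y z w → (x + y) - (z + w) ≈ (x - z) + (y - w)
  +-diff x y z w = trans (+-congˡ (sym (-‿+-comm z w))) (interchange x y (- z) (- w))

  normalise-sound : ∀ p → ⟦ normalise p ⟧ ≈ ⟦ p ⟧
  normalise-sound (zero  , b)     = refl
  normalise-sound (suc a , zero)  = refl
  normalise-sound (suc a , suc b) = begin
    ⟦ normalise (a , b) ⟧                 ≈⟨ normalise-sound (a , b) ⟩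
    a · 1# - b · 1#                       ≈⟨ +-identityˡ _ ⟨
    0# + (a · 1# - b · 1#)                ≈⟨ +-congʳ (-‿inverseʳ 1#) ⟨
    (1# - 1#) + (a · 1# - b · 1#)         ≈⟨ +-diff 1# (a · 1#) 1# (b · 1#) ⟨
    (1# + a · 1#) - (1# + b · 1#)         ∎

  +-sound : ∀ p q → ⟦ RawRing._+_ integers p q ⟧ ≈ ⟦ p ⟧ + ⟦ q ⟧
  +-sound (a , b) (c , d) = begin
    ⟦ normalise (a ℕ.+ c , b ℕ.+ d) ⟧               ≈⟨ normalise-sound (a ℕ.+ c , b ℕ.+ d) ⟩
    (a ℕ.+ c) · 1# - (b ℕ.+ d) · 1#                 ≈⟨ +-cong (×-homo-+ 1# a c) (-‿cong (×-homo-+ 1# b d)) ⟩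
    (a · 1# + c · 1#) - (b · 1# + d · 1#)           ≈⟨ +-diff _ _ _ _ ⟩
    ⟦ a , b ⟧ + ⟦ c , d ⟧                           ∎

  ·-homo : ∀ a b c d → (a ℕ.* b ℕ.+ c ℕ.* d) · 1# ≈ a · 1# * b · 1# + c · 1# * d · 1#
  ·-homo a b c d = trans (×-homo-+ 1# (a ℕ.* b) (c ℕ.* d)) (+-cong (×1-homo-* a b) (×1-homo-* c d))

  *-diff : ∀ x y z w → (x * z + y * w) - (x * w + y * z) ≈ (x - y) * (z - w)
  *-diff x y z w = begin
    (x * z + y * w) - (x * w + y * z)           ≈⟨ +-diff _ _ _ _ ⟩
    (x * z - x * w) + (y * w - y * z)           ≈⟨ +-cong (+-congˡ (-‿distribʳ-* x w)) (+-comm _ _) ⟩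
    (x * z + x * - w) + (- (y * z) + y * w)     ≈⟨ +-congˡ (+-cong (-‿distribˡ-* y z)
      (trans (sym (-‿involutive _)) (trans (-‿cong (-‿distribʳ-* y w)) (-‿distribˡ-* y (- w))))) ⟩
    (x * z + x * - w) + (- y * z + - y * - w)   ≈⟨ +-cong (distribˡ x z (- w)) (distribˡ (- y) z (- w)) ⟨
    x * (z - w) + - y * (z - w)                 ≈⟨ distribʳ (z - w) x (- y) ⟨
    (x - y) * (z - w)                           ∎

  *-sound : ∀ p q → ⟦ RawRing._*_ integers p q ⟧ ≈ ⟦ p ⟧ * ⟦ q ⟧
  *-sound (a , b) (c , d) = begin
    ⟦ normalise (ac+bd , ad+bc) ⟧             ≈⟨ normalise-sound (ac+bd , ad+bc) ⟩
    ac+bd · 1# - ad+bc · 1#                   ≈⟨ +-cong (·-homo a c b d) (-‿cong (·-homo a d b c)) ⟩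
    (a · 1# * c · 1# + b · 1# * d · 1#) - (a · 1# * d · 1# + b · 1# * c · 1#)
                                              ≈⟨ *-diff _ _ _ _ ⟩
    ⟦ a , b ⟧ * ⟦ c , d ⟧                     ∎
    where
    ac+bd = a ℕ.* c ℕ.+ b ℕ.* d
    ad+bc = a ℕ.* d ℕ.+ b ℕ.* c

  -‿sound : ∀ p → ⟦ RawRing.-_ integers p ⟧ ≈ - ⟦ p ⟧
  -‿sound (a , b) = begin
    ⟦ normalise (b , a) ⟧        ≈⟨ normalise-sound (b , a) ⟩
    b · 1# - a · 1#              ≈⟨ +-comm _ _ ⟩
    - (a · 1#) + b · 1#          ≈⟨ +-congˡ (-‿involutive _) ⟨
    - (a · 1#) - - (b · 1#)      ≈⟨ -‿+-comm _ _ ⟩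
    - (a · 1# - b · 1#)          ∎

  morphism : integers -Raw-AlmostCommutative⟶ fromCommutativeRing R
  morphism = record
    { ⟦_⟧    = ⟦_⟧
    ; +-homo = +-sound
    ; *-homo = *-sound
    ; -‿homo = -‿sound
    ; 0-homo = -‿inverseʳ 0#
    ; 1-homo = trans (+-congˡ -0#≈0#) (trans (+-identityʳ _) (+-identityʳ 1#))
    }

  coefficient≟ : ∀ p q → Maybe (⟦ p ⟧ ≈ ⟦ q ⟧)
  coefficient≟ p q = Maybe.map (λ { ≡.refl → refl }) (dec⇒maybe (≡-dec ℕ._≟_ ℕ._≟_ p q))

  open Algebra.Solver.Ring integers (fromCommutativeRing R) morphism coefficient≟
    public using (solve; _:=_; _:+_; _:*_; _:-_; :-_)

-- Linear systems and polynomial maps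

module Elimination (R : CommutativeRing 0ℓ 0ℓ) where
  open CommutativeRing R hiding (zero)
  open RingSolver R
  open Algebra.Properties.Ring ring using (-0#≈0#)
  open Algebra.Properties.Semiring.Sum semiring using (sum; sum-cong-≋; ∑-distrib-+; *-distribˡ-sum; sum-replicate-zero)
  open Relation.Binary.Reasoning.Setoid setoid

  Matrix : ℕ → Set
  Matrix n = Fin n → Fin n → Carrier

  δ : ∀ {n} → Matrix n
  δ zero    zero    = 1#
  δ zero    (suc j) = 0#
  δ (suc i) zero    = 0#
  δ (suc i) (suc j) = δ i j

  δ-diagonal : ∀ {n} (i : Fin n) → δ i i ≈ 1#
  δ-diagonal zero    = refl
  δ-diagonal (suc i) = δ-diagonal i

  δ-off-diagonal : ∀ {n} {i j : Fin n} → i ≢ j → δ i j ≈ 0#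
  δ-off-diagonal {i = zero}  {zero}  i≢j = ⊥-elim (i≢j ≡.refl)
  δ-off-diagonal {i = zero}  {suc j} i≢j = refl
  δ-off-diagonal {i = suc i} {zero}  i≢j = refl
  δ-off-diagonal {i = suc i} {suc j} i≢j = δ-off-diagonal (i≢j ∘ ≡.cong suc)

  -- Fraction-free elimination of the first unknown.
  reduce : ∀ {n} → Matrix (suc n) → Matrix n
  reduce A i j = A zero zero * A (suc i) (suc j) - A (suc i) zero * A zero (suc j)

  reduceᵛ : ∀ {n} → Matrix (suc n) → (Fin (suc n) → Carrier) → Fin n → Carrier
  reduceᵛ A b i = A zero zero * b (suc i) - A (suc i) zero * b zero

  -- By Chió's condensation, det (reduce A) is a power of the leading entry times det A, so this is
  -- a multiple of the determinant. It can vanish on an invertible matrix, since rows are never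
  -- exchanged; it is 1 at the identity matrix.
  pivots : ∀ {n} → Matrix n → Carrier
  pivots {zero}  A = 1#
  pivots {suc n} A = A zero zero * pivots (reduce A)

  -- Back substitution without division: the first unknown takes the factor `pivots (reduce A)` from
  -- the later ones, and these take the leading entry from the first, so that all carry the common
  -- factor `pivots A`.
  solution : ∀ {n} → Matrix n → (Fin n → Carrier) → Fin n → Carrier
  solution A b zero    = pivots (reduce A) * b zero -
                         sum λ j → A zero (suc j) * solution (reduce A) (reduceᵛ A b) j
  solution A b (suc j) = A zero zero * solution (reduce A) (reduceᵛ A b) j

  sum-0 : ∀ {n} (f : Fin n → Carrier) → (∀ i → f i ≈ 0#) → sum f ≈ 0#
  sum-0 {n} f f≈0 = trans (sum-cong-≋ f≈0) (sum-replicate-zero n)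

  sum-scaled : ∀ {n} c (a t : Fin n → Carrier) → sum (λ j → a j * (c * t j)) ≈ c * sum (λ j → a j * t j)
  sum-scaled c a t = trans (sum-cong-≋ λ j → swap (a j) c (t j)) (sym (*-distribˡ-sum c λ j → a j * t j))
    where
    swap : ∀ a c t → a * (c * t) ≈ c * (a * t)
    swap = solve 3 (λ a c t → a :* (c :* t) := c :* (a :* t)) refl

  sum-reduced : ∀ {n} (A : Matrix (suc n)) i (t : Fin n → Carrier) →
    sum (λ j → reduce A i j * t j) ≈
    A zero zero * sum (λ j → A (suc i) (suc j) * t j) - A (suc i) zero * sum (λ j → A zero (suc j) * t j)
  sum-reduced A i t = begin
    sum (λ j → reduce A i j * t j)
      ≈⟨ sum-cong-≋ (λ j → expand (A zero zero) (A (suc i) (suc j)) (A (suc i) zero) (A zero (suc j)) (t j)) ⟩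
    sum (λ j → p * (A (suc i) (suc j) * t j) + (- q) * (A zero (suc j) * t j))
      ≈⟨ ∑-distrib-+ (λ j → p * (A (suc i) (suc j) * t j)) (λ j → (- q) * (A zero (suc j) * t j)) ⟩
    sum (λ j → p * (A (suc i) (suc j) * t j)) + sum (λ j → (- q) * (A zero (suc j) * t j))
      ≈⟨ +-cong (sym (*-distribˡ-sum p (λ j → A (suc i) (suc j) * t j)))
                (sym (*-distribˡ-sum (- q) (λ j → A zero (suc j) * t j))) ⟩
    p * sum (λ j → A (suc i) (suc j) * t j) + (- q) * sum (λ j → A zero (suc j) * t j)
      ≈⟨ negate p q _ _ ⟩
    p * sum (λ j → A (suc i) (suc j) * t j) - q * sum (λ j → A zero (suc j) * t j) ∎
    where
    p = A zero zero
    q = A (suc i) zero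
    expand : ∀ p a c d t → (p * a - c * d) * t ≈ p * (a * t) + (- c) * (d * t)
    expand = solve 5 (λ p a c d t → (p :* a :- c :* d) :* t := p :* (a :* t) :+ (:- c) :* (d :* t)) refl
    negate : ∀ p c u v → p * u + (- c) * v ≈ p * u - c * v
    negate = solve 4 (λ p c u v → p :* u :+ (:- c) :* v := p :* u :- c :* v) refl

  -- A reduced row is the leading entry times a later row minus a multiple of the first row. Reading
  -- this backwards turns the reduced equation into that of the later row, the two terms q * P * b
  -- zero cancelling.
  solution-solves : ∀ {n} (A : Matrix n) b i → sum (λ j → A i j * solution A b j) ≈ pivots A * b i
  solution-solves {suc n} A b zero = begin
    p * (P * b zero - S) + sum (λ j → A zero (suc j) * (p * t j))   ≈⟨ +-congˡ (sum-scaled p (λ j → A zero (suc j)) t) ⟩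
    p * (P * b zero - S) + p * S                                    ≈⟨ cancel p P (b zero) S ⟩
    p * P * b zero                                                  ∎
    where
    p = A zero zero
    P = pivots (reduce A)
    t = solution (reduce A) (reduceᵛ A b)
    S = sum λ j → A zero (suc j) * t j
    cancel : ∀ p P b S → p * (P * b - S) + p * S ≈ p * P * b
    cancel = solve 4 (λ p P b S → p :* (P :* b :- S) :+ p :* S := p :* P :* b) refl
  solution-solves {suc n} A b (suc i) = begin
    q * (P * b zero - S) + sum (λ j → A (suc i) (suc j) * (p * t j))
      ≈⟨ +-congˡ (sum-scaled p (λ j → A (suc i) (suc j)) t) ⟩
    q * (P * b zero - S) + p * U
      ≈⟨ regroup q P (b zero) S p U ⟩
    q * P * b zero + (p * U - q * S)
      ≈⟨ +-congˡ (sym (sum-reduced A i t)) ⟩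
    q * P * b zero + sum (λ j → reduce A i j * t j)
      ≈⟨ +-congˡ (solution-solves (reduce A) (reduceᵛ A b) i) ⟩
    q * P * b zero + P * (p * b (suc i) - q * b zero)
      ≈⟨ cancel q P (b zero) p (b (suc i)) ⟩
    p * P * b (suc i) ∎
    where
    p = A zero zero
    q = A (suc i) zero
    P = pivots (reduce A)
    t = solution (reduce A) (reduceᵛ A b)
    S = sum λ j → A zero (suc j) * t j
    U = sum λ j → A (suc i) (suc j) * t j
    regroup : ∀ c P b S p U → c * (P * b - S) + p * U ≈ c * P * b + (p * U - c * S)
    regroup = solve 6 (λ c P b S p U → c :* (P :* b :- S) :+ p :* U := c :* P :* b :+ (p :* U :- c :* S)) refl
    cancel : ∀ c P b p d → c * P * b + P * (p * d - c * b) ≈ p * P * d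
    cancel = solve 5 (λ c P b p d → c :* P :* b :+ P :* (p :* d :- c :* b) := p :* P :* d) refl

  -- The reduction multiplies every kernel equation by the pivot, so a kernel
  -- vector of A restricts to one of the reduced matrix.
  cramer : ∀ {n} (A : Matrix n) (t : Fin n → Carrier) → (∀ i → sum (λ j → A i j * t j) ≈ 0#) → ∀ j → pivots A * t j ≈ 0#
  cramer {suc n} A t At≈0 = pivots-kernel
    where
    p = A zero zero
    P = pivots (reduce A)
    U : Fin n → Carrier
    U i = sum λ j → A (suc i) (suc j) * t (suc j)
    S = sum λ j → A zero (suc j) * t (suc j)

    combine : ∀ p U c S t → p * U - c * S ≈ p * (c * t + U) - c * (p * t + S)
    combine = solve 5 (λ p U c S t → p :* U :- c :* S := p :* (c :* t :+ U) :- c :* (p :* t :+ S)) refl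

    vanish : ∀ p c → p * 0# - c * 0# ≈ 0#
    vanish p c = trans (+-cong (zeroʳ p) (-‿cong (zeroʳ c))) (-‿inverseʳ 0#)

    reduced : ∀ i → sum (λ j → reduce A i j * t (suc j)) ≈ 0#
    reduced i = begin
      sum (λ j → reduce A i j * t (suc j))    ≈⟨ sum-reduced A i (λ j → t (suc j)) ⟩
      p * U i - A (suc i) zero * S            ≈⟨ combine p (U i) (A (suc i) zero) S (t zero) ⟩
      p * (A (suc i) zero * t zero + U i) - A (suc i) zero * (p * t zero + S)
        ≈⟨ +-cong (*-congˡ (At≈0 (suc i))) (-‿cong (*-congˡ (At≈0 zero))) ⟩
      p * 0# - A (suc i) zero * 0#            ≈⟨ vanish p (A (suc i) zero) ⟩
      0#                                      ∎

    ih : ∀ j → P * t (suc j) ≈ 0#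
    ih = cramer (reduce A) (λ j → t (suc j)) reduced

    swap : ∀ a b c → a * (b * c) ≈ b * (a * c)
    swap = solve 3 (λ a b c → a :* (b :* c) := b :* (a :* c)) refl

    P*S≈0 : P * S ≈ 0#
    P*S≈0 = begin
      P * S                                          ≈⟨ *-distribˡ-sum P (λ j → A zero (suc j) * t (suc j)) ⟩
      sum (λ j → P * (A zero (suc j) * t (suc j)))   ≈⟨ sum-0 _ (λ j → trans (swap P (A zero (suc j)) (t (suc j)))
                                                          (trans (*-congˡ (ih j)) (zeroʳ _))) ⟩
      0#                                             ∎

    isolate : ∀ p P t S → p * P * t ≈ P * (p * t + S) - P * S
    isolate = solve 4 (λ p P t S → p :* P :* t := P :* (p :* t :+ S) :- P :* S) refl

    pivots-kernel : ∀ j → p * P * t j ≈ 0#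
    pivots-kernel zero    = begin
      p * P * t zero                   ≈⟨ isolate p P (t zero) S ⟩
      P * (p * t zero + S) - P * S     ≈⟨ +-cong (*-congˡ (At≈0 zero)) (-‿cong P*S≈0) ⟩
      P * 0# - 0#                      ≈⟨ +-congʳ (zeroʳ P) ⟩
      0# - 0#                          ≈⟨ -‿inverseʳ 0# ⟩
      0#                               ∎
    pivots-kernel (suc j) = trans (*-assoc p P _) (trans (*-congˡ (ih j)) (zeroʳ p))

  pivots-identity : ∀ {n} (A : Matrix n) → (∀ i j → A i j ≈ δ i j) → pivots A ≈ 1#
  pivots-identity {zero}  A A≈δ = refl
  pivots-identity {suc n} A A≈δ = trans (*-cong (A≈δ zero zero) (pivots-identity (reduce A) λ i j →
      trans (+-cong (*-cong (A≈δ zero zero) (A≈δ (suc i) (suc j))) (-‿cong (*-cong (A≈δ (suc i) zero) (A≈δ zero (suc j)))))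
            (simplify (δ i j))))
    (*-identityˡ 1#)
    where
    simplify : ∀ x → 1# * x - 0# * 0# ≈ x
    simplify x = trans (+-cong (*-identityˡ x) (trans (-‿cong (zeroˡ 0#)) -0#≈0#)) (+-identityʳ x)

  sum-δ : ∀ {n} i (t : Fin n → Carrier) → sum (λ j → δ i j * t j) ≈ t i
  sum-δ zero    t = trans (+-cong (*-identityˡ _) (sum-0 (λ j → 0# * t (suc j)) λ j → zeroˡ (t (suc j)))) (+-identityʳ (t zero))
  sum-δ (suc i) t = trans (+-cong (zeroˡ _) (sum-δ i λ j → t (suc j))) (+-identityˡ _)

  solution-identity : ∀ {n} (A : Matrix n) b → (∀ i j → A i j ≈ δ i j) → ∀ i → solution A b i ≈ b i
  solution-identity A b A≈δ i = begin
    solution A b i                      ≈⟨ sum-δ i (solution A b) ⟨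
    sum (λ j → δ i j * solution A b j)  ≈⟨ sum-cong-≋ (λ j → *-congʳ (A≈δ i j)) ⟨
    sum (λ j → A i j * solution A b j)  ≈⟨ solution-solves A b i ⟩
    pivots A * b i                      ≈⟨ *-congʳ (pivots-identity A A≈δ) ⟩
    1# * b i                            ≈⟨ *-identityˡ (b i) ⟩
    b i                                 ∎

-- The double negation permits arguing by cases on whether a ring element is zero without deciding
-- it; it is discharged only into a contradiction or a stable equation.
Eventually : (ℕ → Set) → Set
Eventually P = ¬ ¬ ∃ λ N → ∀ n → N ≤ n → P n

module PolynomialMaps (R : CommutativeRing 0ℓ 0ℓ) where
  open CommutativeRing R hiding (zero)
  open RingSolver R
  open Algebra.Properties.Semiring.Mult semiring using (×-homo-+) renaming (_×_ to _·_)
  open Algebra.Properties.Semiring.Sum semiring using (sum)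
  open Algebra.Properties.Semiring.Exp semiring using (_^_)
  open Algebra.Properties.Monoid.Sum *-monoid using () renaming (sum to product)

  restore : ∀ a b → a + (b - a) ≈ b
  restore = solve 2 (λ a b → a :+ (b :- a) := b) refl

  ι : ℕ → Carrier
  ι n = n · 1#

  -- Sequences given by a polynomial of degree less than n, described through
  -- the quotients of their difference quotients at every natural number.
  Degree< : ℕ → (ℕ → Carrier) → Set
  Degree< zero    h = ∀ s → h s ≈ 0#
  Degree< (suc n) h = ∀ a → ∃ λ q → Degree< n q × ∀ s → h s ≈ h a + (ι s - ι a) * q s

  Degree<-suc : ∀ n {h} → Degree< n h → Degree< (suc n) h
  Degree<-suc zero    {h} h≈0 a = (λ _ → 0#) , (λ _ → refl) , λ s →
    trans (h≈0 s) (sym (trans (+-cong (h≈0 a) (zeroʳ _)) (+-identityʳ 0#)))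
  Degree<-suc (suc n) deg a with deg a
  ... | q , deg-q , eq = q , Degree<-suc n deg-q , eq

  Degree<-mono : ∀ {m n h} → m ≤ n → Degree< m h → Degree< n h
  Degree<-mono {m} {n} {h} m≤n deg = ≡.subst (λ k → Degree< k h) (ℕ.m∸n+n≡m m≤n) (pad (n ℕ.∸ m))
    where
    pad : ∀ k → Degree< (k ℕ.+ m) h
    pad zero    = deg
    pad (suc k) = Degree<-suc (k ℕ.+ m) (pad k)

  Degree<-cong : ∀ n {f g} → (∀ s → f s ≈ g s) → Degree< n f → Degree< n g
  Degree<-cong zero    f≈g f≈0 s = trans (sym (f≈g s)) (f≈0 s)
  Degree<-cong (suc n) f≈g deg a with deg a
  ... | q , deg-q , eq = q , deg-q , λ s → trans (sym (f≈g s)) (trans (eq s) (+-congʳ (f≈g a)))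

  Degree<-+ : ∀ n {f g} → Degree< n f → Degree< n g → Degree< n (λ s → f s + g s)
  Degree<-+ zero f≈0 g≈0 s = trans (+-cong (f≈0 s) (g≈0 s)) (+-identityʳ 0#)
  Degree<-+ (suc n) {f} {g} deg-f deg-g a with deg-f a | deg-g a
  ... | q , deg-q , eq | q′ , deg-q′ , eq′ = (λ s → q s + q′ s) , Degree<-+ n deg-q deg-q′ , λ s →
    trans (+-cong (eq s) (eq′ s)) (regroup (f a) (g a) (ι s - ι a) (q s) (q′ s))
    where
    regroup : ∀ f g d q r → (f + d * q) + (g + d * r) ≈ (f + g) + d * (q + r)
    regroup = solve 5 (λ f g d q r → (f :+ d :* q) :+ (g :+ d :* r) := (f :+ g) :+ d :* (q :+ r)) refl

  Degree<-scale : ∀ n c {f} → Degree< n f → Degree< n (λ s → c * f s)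
  Degree<-scale zero    c f≈0 s = trans (*-congˡ (f≈0 s)) (zeroʳ c)
  Degree<-scale (suc n) c {f} deg a with deg a
  ... | q , deg-q , eq = (λ s → c * q s) , Degree<-scale n c deg-q , λ s →
    trans (*-congˡ (eq s)) (regroup c (f a) (ι s - ι a) (q s))
    where
    regroup : ∀ c f d q → c * (f + d * q) ≈ c * f + d * (c * q)
    regroup = solve 4 (λ c f d q → c :* (f :+ d :* q) := c :* f :+ d :* (c :* q)) refl

  -- Product rule for difference quotients. Weakening the bound on g by one gives its quotient the
  -- bound n even when n = 0, so a recursion on m alone is enough.
  Degree<-* : ∀ m n {f g} → Degree< m f → Degree< n g → Degree< (m ℕ.+ n) (λ s → f s * g s)
  Degree<-* zero    n f≈0 _ = Degree<-mono z≤n λ s → trans (*-congʳ (f≈0 s)) (zeroˡ _)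
  Degree<-* (suc m) n {f} {g} deg-f deg-g a with deg-f a | Degree<-suc n deg-g a
  ... | q , deg-q , eq | q′ , deg-q′ , eq′ =
      (λ s → q s * g s + f a * q′ s)
    , Degree<-+ (m ℕ.+ n) (Degree<-* m n deg-q deg-g) (Degree<-mono (ℕ.m≤n+m n m) (Degree<-scale n (f a) deg-q′))
    , λ s → trans (*-congʳ (eq s)) (trans (distribute (f a) (ι s - ι a) (q s) (g s))
        (trans (+-congʳ (*-congˡ (eq′ s))) (regroup (f a) (ι s - ι a) (q s) (g s) (g a) (q′ s))))
    where
    distribute : ∀ f d q g → (f + d * q) * g ≈ f * g + d * (q * g)
    distribute = solve 4 (λ f d q g → (f :+ d :* q) :* g := f :* g :+ d :* (q :* g)) refl
    regroup : ∀ f d q g h r → f * (h + d * r) + d * (q * g) ≈ f * h + d * (q * g + f * r)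
    regroup = solve 6 (λ f d q g h r → f :* (h :+ d :* r) :+ d :* (q :* g) := f :* h :+ d :* (q :* g :+ f :* r)) refl

  Degree<-const : ∀ c → Degree< 1 (λ _ → c)
  Degree<-const c a = (λ _ → 0#) , (λ _ → refl) , λ s → sym (trans (+-congˡ (zeroʳ _)) (+-identityʳ c))

  Degree<-ι : Degree< 2 ι
  Degree<-ι a = (λ _ → 1#) , Degree<-const 1# , λ s → regroup (ι s) (ι a)
    where
    regroup : ∀ s a → s ≈ a + (s - a) * 1#
    regroup s a = sym (trans (+-congˡ (*-identityʳ (s - a))) (restore a s))

  IsPolynomial : (ℕ → Carrier) → Set
  IsPolynomial h = ∃ λ n → Degree< n h

  IsPolynomial-+ : ∀ {f g} → IsPolynomial f → IsPolynomial g → IsPolynomial (λ s → f s + g s)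
  IsPolynomial-+ (m , deg-f) (n , deg-g) =
    m ⊔ n , Degree<-+ (m ⊔ n) (Degree<-mono (ℕ.m≤m⊔n m n) deg-f) (Degree<-mono (ℕ.m≤n⊔m m n) deg-g)

  Point : ℕ → ℕ → Set
  Point k l = Fin k → Fin l → Carrier

  line : ∀ {k l} → Point k l → Point k l → ℕ → Point k l
  line x y s e i = x e i + ι s * (y e i - x e i)

  -- Polynomials are recorded by their restrictions to the integer points of lines. This is what the
  -- density argument consumes, and it passes through sums, products and elimination without any
  -- syntax for polynomials.
  record PolynomialMap {k l} (F : Point k l → Carrier) : Set where
    field
      respects : ∀ {x y} → (∀ e i → x e i ≈ y e i) → F x ≈ F y
      on-lines : ∀ x y → IsPolynomial (λ s → F (line x y s))
  open PolynomialMap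

  module _ {k l : ℕ} where
    constantᵖ : ∀ c → PolynomialMap {k} {l} (λ _ → c)
    constantᵖ c = record { respects = λ _ → refl ; on-lines = λ _ _ → 1 , Degree<-const c }

    coordinateᵖ : ∀ e i → PolynomialMap {k} {l} (λ x → x e i)
    coordinateᵖ e i = record
      { respects = λ x≈y → x≈y e i
      ; on-lines = λ x y → IsPolynomial-+ (1 , Degree<-const (x e i))
          (3 , Degree<-* 2 1 Degree<-ι (Degree<-const (y e i - x e i))) }

    infixl 6 _+ᵖ_
    infixl 7 _*ᵖ_
    _+ᵖ_ : ∀ {F G} → PolynomialMap {k} {l} F → PolynomialMap G → PolynomialMap (λ x → F x + G x)
    F +ᵖ G = record
      { respects = λ x≈y → +-cong (respects F x≈y) (respects G x≈y)
      ; on-lines = λ x y → IsPolynomial-+ (on-lines F x y) (on-lines G x y) }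

    _*ᵖ_ : ∀ {F G} → PolynomialMap {k} {l} F → PolynomialMap G → PolynomialMap (λ x → F x * G x)
    F *ᵖ G = record
      { respects = λ x≈y → *-cong (respects F x≈y) (respects G x≈y)
      ; on-lines = λ x y → _ , Degree<-* _ _ (proj₂ (on-lines F x y)) (proj₂ (on-lines G x y)) }

    sumᵖ : ∀ {n} {F : Fin n → Point k l → Carrier} → (∀ j → PolynomialMap (F j)) → PolynomialMap (λ x → sum λ j → F j x)
    sumᵖ {zero}  F = constantᵖ 0#
    sumᵖ {suc n} F = F zero +ᵖ sumᵖ λ j → F (suc j)

    productᵖ : ∀ {n} {F : Fin n → Point k l → Carrier} → (∀ j → PolynomialMap (F j)) →
               PolynomialMap (λ x → product λ j → F j x)
    productᵖ {zero}  F = constantᵖ 1#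
    productᵖ {suc n} F = F zero *ᵖ productᵖ λ j → F (suc j)

    _^ᵖ_ : ∀ {F} → PolynomialMap {k} {l} F → ∀ n → PolynomialMap (λ x → F x ^ n)
    F ^ᵖ zero  = constantᵖ 1#
    F ^ᵖ suc n = F *ᵖ (F ^ᵖ n)

    negateᵖ : ∀ {F} → PolynomialMap {k} {l} F → PolynomialMap (λ x → - F x)
    negateᵖ {F} F-poly = record
      { respects = λ x≈y → -‿cong (respects F-poly x≈y)
      ; on-lines = λ x y → let (n , deg) = on-lines F-poly x y in
          n , negated n deg }
      where
      negated : ∀ n {h} → Degree< n h → Degree< n (λ s → - h s)
      negated zero    h≈0 s = trans (-‿cong (h≈0 s)) (trans (sym (+-identityˡ _)) (-‿inverseʳ 0#))
      negated (suc n) {h} deg a with deg a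
      ... | q , deg-q , eq = (λ s → - q s) , negated n deg-q , λ s →
            trans (-‿cong (eq s)) (regroup (h a) (ι s - ι a) (q s))
        where
        regroup : ∀ h d q → - (h + d * q) ≈ - h + d * - q
        regroup = solve 3 (λ h d q → :- (h :+ d :* q) := :- h :+ d :* :- q) refl

  module Nonvanishing (stable : ∀ x → ¬ ¬ x ≈ 0# → x ≈ 0#)
                      (domain : ∀ x y → x * y ≈ 0# → ¬ x ≈ 0# → y ≈ 0#)
                      (characteristic : ∀ n → ¬ suc n · 1# ≈ 0#) where

    ι-injective : ∀ {a s} → a < s → ¬ ι s - ι a ≈ 0#
    ι-injective {a} {s} a<s ιs≈ιa = characteristic (s ℕ.∸ suc a) (trans (sym (trans
      (+-congʳ (trans (reflexive (≡.cong ι (≡.sym (≡.trans (ℕ.+-suc a _) (ℕ.m+[n∸m]≡n a<s)))))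
                      (×-homo-+ 1# a (suc (s ℕ.∸ suc a)))))
      (cancel (ι a) (ι (suc (s ℕ.∸ suc a)))))) ιs≈ιa)
      where
      cancel : ∀ x y → (x + y) - x ≈ y
      cancel = solve 2 (λ x y → (x :+ y) :- x := y) refl

    -- A root a can be divided out: the quotient has smaller degree and is still nonzero at y, so it
    -- is eventually nonzero by induction, and the factor ι s - ι a is nonzero for s > a.
    eventually-nonzero : ∀ n {h} → Degree< n h → ∀ y → ¬ h y ≈ 0# → Eventually (λ s → ¬ h s ≈ 0#)
    eventually-nonzero zero    h≈0 y h≉0 = ⊥-elim (h≉0 (h≈0 y))
    eventually-nonzero (suc n) {h} deg y h≉0 none =
      -- Instead of searching for a root, 0 is proposed as the bound: whatever refutes the proposal
      -- is a root.
      none (0 , λ a _ ha≈0 → beyond-root a ha≈0 none)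
      where
      beyond-root : ∀ a → h a ≈ 0# → Eventually (λ s → ¬ h s ≈ 0#)
      beyond-root a ha≈0 none with deg a
      ... | q , deg-q , eq = eventually-nonzero n deg-q y
            (λ q≈0 → h≉0 (trans (eq y) (trans (+-cong ha≈0 (*-congˡ q≈0)) (trans (+-identityˡ _) (zeroʳ _)))))
            λ (N , q≉0) → none (N ⊔ suc a , λ s N⊔a<s hs≈0 →
              q≉0 s (ℕ.m⊔n≤o⇒m≤o N (suc a) N⊔a<s)
                (domain _ _ (trans (sym (trans (eq s) (trans (+-congʳ ha≈0) (+-identityˡ _)))) hs≈0)
                            (ι-injective (ℕ.m⊔n≤o⇒n≤o N (suc a) N⊔a<s))))

    eventually-all : ∀ {k} {P : Fin k → ℕ → Set} → (∀ j → Eventually (P j)) → Eventually (λ s → ∀ j → P j s)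
    eventually-all {zero}  _ none = none (0 , λ _ _ ())
    eventually-all {suc k} P none = P zero λ (M , p) → eventually-all (λ j → P (suc j)) λ (N , ps) →
      none (M ⊔ N , λ s M⊔N≤s → λ where
        zero    → p s (ℕ.m⊔n≤o⇒m≤o M N M⊔N≤s)
        (suc j) → ps s (ℕ.m⊔n≤o⇒n≤o M N M⊔N≤s) j)

    line-start : ∀ {k l} (x y : Point k l) e i → line x y 0 e i ≈ x e i
    line-start x y e i = trans (+-congˡ (zeroˡ _)) (+-identityʳ _)

    line-end : ∀ {k l} (x y : Point k l) e i → line x y 1 e i ≈ y e i
    line-end x y e i = trans (+-congˡ (trans (*-congʳ (+-identityʳ 1#)) (*-identityˡ _))) (restore (x e i) (y e i))

    -- A polynomial vanishing off finitely many proper hypersurfaces vanishes: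
    -- on the line from a point x to one where g₀ is nonzero, nonvanishing is
    -- a cofinite condition.
    vanishes-everywhere : ∀ {k l n} {H : Point k l → Carrier} {g : Fin n → Point k l → Carrier} →
      PolynomialMap H → (∀ j → PolynomialMap (g j)) → (∀ j → ∃ λ y → ¬ g j y ≈ 0#) →
      (∀ x → (∀ j → ¬ g j x ≈ 0#) → H x ≈ 0#) → ∀ x → H x ≈ 0#
    vanishes-everywhere {n = zero}  H-poly g-poly g≉0 vanishes x = vanishes x λ ()
    vanishes-everywhere {n = suc n} {H} {g} H-poly g-poly g≉0 vanishes =
      vanishes-everywhere H-poly (λ j → g-poly (suc j)) (λ j → g≉0 (suc j)) λ x gx≉0 →
        let (y , gy≉0) = g≉0 zero
            nonzero-from : ∀ {F} → PolynomialMap F → ∀ s z → (∀ e i → line x y s e i ≈ z e i) → ¬ F z ≈ 0# →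
                           Eventually (λ s → ¬ F (line x y s) ≈ 0#)
            nonzero-from F s z at-s Fz≉0 = eventually-nonzero _ (proj₂ (on-lines F x y)) s
              λ Fs≈0 → Fz≉0 (trans (sym (respects F at-s)) Fs≈0)
        in stable (H x) λ Hx≉0 →
          eventually-all {P = λ j s → ¬ g j (line x y s) ≈ 0#}
            (λ where
              zero    → nonzero-from (g-poly zero) 1 y (line-end x y) gy≉0
              (suc j) → nonzero-from (g-poly (suc j)) 0 x (line-start x y) (gx≉0 j))
            λ (M , g-nonzero) → nonzero-from H-poly 0 x (line-start x y) Hx≉0
              λ (N , H-nonzero) →
                H-nonzero (M ⊔ N) (ℕ.m≤n⊔m M N) (vanishes _ (g-nonzero (M ⊔ N) (ℕ.m≤m⊔n M N)))

-- Real and complex numbers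

module RealNumbers where
  open ≡ using (refl; sym; trans; cong; subst)
  open ℚSolver.+-*-Solver using (solve; _:=_; _:+_; _:*_; _:-_; :-_)
  open ℚ.≤-Reasoning

  <⇒≱ : ∀ {p q} → p ℚ.< q → ¬ q ℚ.≤ p
  <⇒≱ p<q q≤p = ℚ.<-irrefl refl (ℚ.<-≤-trans p<q q≤p)

  Null : (ℕ → ℚ) → Set
  Null z = ∀ ε → 0ℚ ℚ.< ε → ∃ λ N → ∀ n → N ≤ n → ℚ.∣ z n ∣ ℚ.< ε

  EventuallyBounded : (ℕ → ℚ) → Set
  EventuallyBounded z = ∃ λ B → 0ℚ ℚ.< B × ∃ λ N → ∀ n → N ≤ n → ℚ.∣ z n ∣ ℚ.≤ B

  halve : ∀ ε → 0ℚ ℚ.< ε → ∃ λ δ → 0ℚ ℚ.< δ × δ ℚ.+ δ ≡ ε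
  halve ε ε>0 = ½ ℚ.* ε
    , ℚ.positive⁻¹ _ {{ℚ.pos*pos⇒pos ½ ε {{ℚ.positive ε>0}}}}
    , trans (sym (ℚ.*-distribʳ-+ ε ½ ½)) (ℚ.*-identityˡ ε)

  divide : ∀ B ε → 0ℚ ℚ.< B → 0ℚ ℚ.< ε → ∃ λ δ → 0ℚ ℚ.< δ × B ℚ.* δ ≡ ε
  divide B ε B>0 ε>0 =
    let instance _ = ℚ.positive B>0
                 _ = ℚ.pos⇒nonZero B
                 _ = ℚ.1/pos⇒pos B
                 _ = ℚ.positive ε>0
    in ℚ.1/ B ℚ.* ε
     , ℚ.positive⁻¹ _ {{ℚ.pos*pos⇒pos (ℚ.1/ B) ε}}
     , trans (sym (ℚ.*-assoc B (ℚ.1/ B) ε))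
         (trans (cong (ℚ._* ε) (ℚ.*-inverseʳ B)) (ℚ.*-identityˡ ε))

  null-cong : ∀ {y z} → (∀ n → y n ≡ z n) → Null y → Null z
  null-cong y≡z nullY ε ε>0 with nullY ε ε>0
  ... | N , h = N , λ n N≤n → subst (λ t → ℚ.∣ t ∣ ℚ.< ε) (y≡z n) (h n N≤n)

  null-0 : ∀ {z} → (∀ n → z n ≡ 0ℚ) → Null z
  null-0 z≡0 = null-cong (λ n → sym (z≡0 n)) λ ε ε>0 → 0 , λ _ _ → ε>0

  null-+ : ∀ {y z} → Null y → Null z → Null (λ n → y n ℚ.+ z n)
  null-+ {y} {z} nullY nullZ ε ε>0 with halve ε ε>0
  ... | δ , δ>0 , refl with nullY δ δ>0 | nullZ δ δ>0
  ...   | M , hy | N , hz = M ⊔ N , λ n M⊔N≤n → ℚ.≤-<-trans (ℚ.∣p+q∣≤∣p∣+∣q∣ (y n) (z n))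
      (ℚ.+-mono-< (hy n (ℕ.m⊔n≤o⇒m≤o M N M⊔N≤n)) (hz n (ℕ.m⊔n≤o⇒n≤o M N M⊔N≤n)))

  null-neg : ∀ {z} → Null z → Null (λ n → ℚ.- z n)
  null-neg {z} nullZ ε ε>0 with nullZ ε ε>0
  ... | N , h = N , λ n N≤n → subst (ℚ._< ε) (sym (ℚ.∣-p∣≡∣p∣ (z n))) (h n N≤n)

  null-* : ∀ {y z} → EventuallyBounded y → Null z → Null (λ n → y n ℚ.* z n)
  null-* {y} {z} (B , B>0 , M , hy) nullZ ε ε>0 with divide B ε B>0 ε>0
  ... | δ , δ>0 , refl with nullZ δ δ>0
  ...   | N , hz = M ⊔ N , λ n M⊔N≤n → begin-strict
    ℚ.∣ y n ℚ.* z n ∣          ≡⟨ ℚ.∣p*q∣≡∣p∣*∣q∣ (y n) (z n) ⟩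
    ℚ.∣ y n ∣ ℚ.* ℚ.∣ z n ∣    ≤⟨ ℚ.*-monoʳ-≤-nonNeg ℚ.∣ z n ∣ {{ℚ.nonNegative (ℚ.0≤∣p∣ (z n))}}
                                   (hy n (ℕ.m⊔n≤o⇒m≤o M N M⊔N≤n)) ⟩
    B ℚ.* ℚ.∣ z n ∣            <⟨ ℚ.*-monoʳ-<-pos B {{ℚ.positive B>0}} (hz n (ℕ.m⊔n≤o⇒n≤o M N M⊔N≤n)) ⟩
    B ℚ.* δ                    ∎

  ∣z∣≤∣z-y∣+∣y∣ : ∀ z y → ℚ.∣ z ∣ ℚ.≤ ℚ.∣ z ℚ.- y ∣ ℚ.+ ℚ.∣ y ∣
  ∣z∣≤∣z-y∣+∣y∣ z y = begin
    ℚ.∣ z ∣                        ≡⟨ cong ℚ.∣_∣ (solve 2 (λ z y → z := (z :- y) :+ y) refl z y) ⟩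
    ℚ.∣ (z ℚ.- y) ℚ.+ y ∣          ≤⟨ ℚ.∣p+q∣≤∣p∣+∣q∣ (z ℚ.- y) y ⟩
    ℚ.∣ z ℚ.- y ∣ ℚ.+ ℚ.∣ y ∣      ∎

  bounded : ∀ x → EventuallyBounded (ℝ.seq x)
  bounded (real x cauchy) with cauchy 1ℚ (ℚ.positive⁻¹ 1ℚ)
  ... | N , h = 1ℚ ℚ.+ ℚ.∣ x N ∣ , ℚ.+-mono-<-≤ (ℚ.positive⁻¹ 1ℚ) (ℚ.0≤∣p∣ (x N)) , N , λ n N≤n →
    ℚ.≤-trans (∣z∣≤∣z-y∣+∣y∣ (x n) (x N)) (ℚ.+-monoˡ-≤ ℚ.∣ x N ∣ (ℚ.<⇒≤ (h n N N≤n ℕ.≤-refl)))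

  -- The constructive substitute for deciding whether x is zero. With a Cauchy index for ε/4, one
  -- rational approximant is compared with ε/2, and either outcome leaves a margin of ε/4.
  small-or-apart : ∀ x ε → 0ℚ ℚ.< ε →
    (∃ λ N → ∀ n → N ≤ n → ℚ.∣ ℝ.seq x n ∣ ℚ.< ε) ⊎
    (∃ λ γ → 0ℚ ℚ.< γ × ∃ λ N → ∀ n → N ≤ n → γ ℚ.≤ ℚ.∣ ℝ.seq x n ∣)
  small-or-apart (real x cauchy) ε ε>0 with halve ε ε>0
  ... | δ , δ>0 , refl with halve δ δ>0
  ...   | γ , γ>0 , refl with cauchy γ γ>0
  ...     | N , h with ℚ.∣ x N ∣ ℚ.<? γ ℚ.+ γ
  ...       | yes xN<δ = inj₁ (N , λ n N≤n → ℚ.≤-<-trans (∣z∣≤∣z-y∣+∣y∣ (x n) (x N))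
                (ℚ.+-mono-< (ℚ.<-trans (h n N N≤n ℕ.≤-refl) γ<δ) xN<δ))
    where
    γ<δ : γ ℚ.< γ ℚ.+ γ
    γ<δ = subst (ℚ._< γ ℚ.+ γ) (ℚ.+-identityʳ γ) (ℚ.+-monoʳ-< γ γ>0)
  ...       | no xN≮δ = inj₂ (γ , γ>0 , N , λ n N≤n → ℚ.≮⇒≥ λ xn<γ →
                xN≮δ (ℚ.≤-<-trans (∣z∣≤∣z-y∣+∣y∣ (x N) (x n)) (ℚ.+-mono-< (h N n ℕ.≤-refl N≤n) xn<γ)))

  apart⇒¬null : ∀ {z} → (∃ λ γ → 0ℚ ℚ.< γ × ∃ λ N → ∀ n → N ≤ n → γ ℚ.≤ ℚ.∣ z n ∣) → ¬ Null z
  apart⇒¬null (γ , γ>0 , M , h) null with null γ γ>0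
  ... | N , h′ = <⇒≱ (h′ (M ⊔ N) (ℕ.m≤n⊔m M N)) (h (M ⊔ N) (ℕ.m≤m⊔n M N))

  -- For each ε the dichotomy itself computes the index, since its second branch contradicts the
  -- hypothesis.
  null-stable : ∀ x → ¬ ¬ Null (ℝ.seq x) → Null (ℝ.seq x)
  null-stable x ¬¬null ε ε>0 with small-or-apart x ε ε>0
  ... | inj₁ small = small
  ... | inj₂ apart = ⊥-elim (¬¬null (apart⇒¬null apart))

  null-cancel : (y z : ℕ → ℚ) → (∃ λ γ → 0ℚ ℚ.< γ × ∃ λ N → ∀ n → N ≤ n → γ ℚ.≤ ℚ.∣ y n ∣) →
                Null (λ n → y n ℚ.* z n) → Null z
  null-cancel y z (γ , γ>0 , M , hy) null ε ε>0
    with null (γ ℚ.* ε) (ℚ.positive⁻¹ _ {{ℚ.pos*pos⇒pos γ {{ℚ.positive γ>0}} ε {{ℚ.positive ε>0}}}})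
  ... | N , hyz = M ⊔ N , λ n M⊔N≤n → ℚ.≰⇒> λ ε≤z → <⇒≱ (hyz n (ℕ.m⊔n≤o⇒n≤o M N M⊔N≤n)) (begin
    γ ℚ.* ε                    ≤⟨ ℚ.*-monoˡ-≤-nonNeg γ {{ℚ.nonNegative (ℚ.<⇒≤ γ>0)}} ε≤z ⟩
    γ ℚ.* ℚ.∣ z n ∣            ≤⟨ ℚ.*-monoʳ-≤-nonNeg ℚ.∣ z n ∣ {{ℚ.nonNegative (ℚ.0≤∣p∣ (z n))}}
                                   (hy n (ℕ.m⊔n≤o⇒m≤o M N M⊔N≤n)) ⟩
    ℚ.∣ y n ∣ ℚ.* ℚ.∣ z n ∣    ≡⟨ ℚ.∣p*q∣≡∣p∣*∣q∣ (y n) (z n) ⟨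
    ℚ.∣ y n ℚ.* z n ∣          ∎)

  -- If y were not null, x could not be bounded away from zero, as `null-cancel` would then apply.
  -- Hence x would be small for every ε, that is, null.
  null-domain : ∀ x y → Null (λ n → ℝ.seq x n ℚ.* ℝ.seq y n) → ¬ Null (ℝ.seq x) → Null (ℝ.seq y)
  null-domain x y null ¬nullX = null-stable y λ ¬nullY → ¬nullX λ ε ε>0 → case-small ¬nullY (small-or-apart x ε ε>0)
    where
    case-small : ∀ {A : Set} → ¬ Null (ℝ.seq y) → A ⊎ _ → A
    case-small ¬nullY (inj₁ small) = small
    case-small ¬nullY (inj₂ apart) = ⊥-elim (¬nullY (null-cancel (ℝ.seq x) (ℝ.seq y) apart null))

  ∣q∣²≡q² : ∀ q → ℚ.∣ q ∣ ℚ.* ℚ.∣ q ∣ ≡ q ℚ.* q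
  ∣q∣²≡q² q with ℚ.∣p∣≡p∨∣p∣≡-p q
  ... | inj₁ eq = cong (λ p → p ℚ.* p) eq
  ... | inj₂ eq = trans (cong (λ p → p ℚ.* p) eq) (solve 1 (λ q → (:- q) :* (:- q) := q :* q) refl q)

  square≥0 : ∀ q → 0ℚ ℚ.≤ q ℚ.* q
  square≥0 q = subst (0ℚ ℚ.≤_) (trans (ℚ.∣p*q∣≡∣p∣*∣q∣ q q) (∣q∣²≡q² q)) (ℚ.0≤∣p∣ (q ℚ.* q))

  null-square : (y z : ℕ → ℚ) → Null (λ n → y n ℚ.* y n ℚ.+ z n ℚ.* z n) → Null y
  null-square y z null ε ε>0
    -- The tolerance is ε², because ε ≤ ∣y∣ forces ε² ≤ y² + z².
    with null (ε ℚ.* ε) (ℚ.positive⁻¹ _ {{ℚ.pos*pos⇒pos ε {{ℚ.positive ε>0}} ε {{ℚ.positive ε>0}}}})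
  ... | N , h = N , λ n N≤n → ℚ.≰⇒> λ ε≤y → <⇒≱ (h n N≤n) (begin
    ε ℚ.* ε                                      ≤⟨ ℚ.*-monoˡ-≤-nonNeg ε {{ℚ.nonNegative (ℚ.<⇒≤ ε>0)}} ε≤y ⟩
    ε ℚ.* ℚ.∣ y n ∣                              ≤⟨ ℚ.*-monoʳ-≤-nonNeg ℚ.∣ y n ∣ {{ℚ.nonNegative (ℚ.0≤∣p∣ (y n))}} ε≤y ⟩
    ℚ.∣ y n ∣ ℚ.* ℚ.∣ y n ∣                      ≡⟨ ∣q∣²≡q² (y n) ⟩
    y n ℚ.* y n                                  ≡⟨ ℚ.+-identityʳ _ ⟨
    y n ℚ.* y n ℚ.+ 0ℚ                           ≤⟨ ℚ.+-monoʳ-≤ (y n ℚ.* y n) (square≥0 (z n)) ⟩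
    y n ℚ.* y n ℚ.+ z n ℚ.* z n                  ≡⟨ ℚ.0≤p⇒∣p∣≡p (ℚ.+-mono-≤ (square≥0 (y n)) (square≥0 (z n))) ⟨
    ℚ.∣ y n ℚ.* y n ℚ.+ z n ℚ.* z n ∣            ∎)

  -- _≈ᵣ_ computes, so the two sides cannot be inferred from its proofs;
  -- a record makes inference possible.
  infix 4 _≃_
  record _≃_ (x y : ℝ) : Set where
    constructor null
    field null-difference : x ≈ᵣ y
  open _≃_ public

  pointwise : ∀ {x y} → (∀ n → ℝ.seq x n ≡ ℝ.seq y n) → x ≃ y
  pointwise {real x _} {real y _} x≡y = null (null-0 λ n →
    trans (cong (ℚ._- y n) (x≡y n)) (ℚ.+-inverseʳ (y n)))

  ≃-trans : ∀ {x y z} → x ≃ y → y ≃ z → x ≃ z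
  ≃-trans {real x _} {real y _} {real z _} (null p) (null q) = null (null-cong
    (λ n → solve 3 (λ x y z → (x :- y) :+ (y :- z) := x :- z) refl (x n) (y n) (z n)) (null-+ p q))

  ≃-sym : ∀ {x y} → x ≃ y → y ≃ x
  ≃-sym {real x _} {real y _} (null p) = null (null-cong
    (λ n → solve 2 (λ x y → :- (x :- y) := y :- x) refl (x n) (y n)) (null-neg p))

  +ᵣ-cong : ∀ {x x′ y y′} → x ≃ x′ → y ≃ y′ → x +ᵣ y ≃ x′ +ᵣ y′
  +ᵣ-cong {real x _} {real x′ _} {real y _} {real y′ _} (null p) (null q) = null (null-cong
    (λ n → solve 4 (λ x x′ y y′ → (x :- x′) :+ (y :- y′) := (x :+ y) :- (x′ :+ y′)) refl (x n) (x′ n) (y n) (y′ n))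
    (null-+ p q))

  -ᵣ-cong : ∀ {x x′} → x ≃ x′ → -ᵣ x ≃ -ᵣ x′
  -ᵣ-cong {real x _} {real x′ _} (null p) = null (null-cong
    (λ n → solve 2 (λ x x′ → :- (x :- x′) := (:- x) :- (:- x′)) refl (x n) (x′ n)) (null-neg p))

  *ᵣ-cong : ∀ {x x′ y y′} → x ≃ x′ → y ≃ y′ → x *ᵣ y ≃ x′ *ᵣ y′
  *ᵣ-cong {x@(real xₙ _)} {real x′ _} {real y _} {y′@(real y′ₙ _)} (null p) (null q) = null (null-cong
    (λ n → solve 4 (λ x x′ y y′ → x :* (y :- y′) :+ y′ :* (x :- x′) := (x :* y) :- (x′ :* y′)) refl
             (xₙ n) (x′ n) (y n) (y′ₙ n))
    (null-+ (null-* (bounded x) q) (null-* (bounded y′) p)))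

  ℝ-commutativeRing : CommutativeRing 0ℓ 0ℓ
  ℝ-commutativeRing = record
    { Carrier = ℝ ; _≈_ = _≃_ ; _+_ = _+ᵣ_ ; _*_ = _*ᵣ_ ; -_ = -ᵣ_ ; 0# = fromℚ 0ℚ ; 1# = fromℚ 1ℚ
    ; isCommutativeRing = record
      { isRing = record
        { +-isAbelianGroup = record
          { isGroup = record
            { isMonoid = record
              { isSemigroup = record
                { isMagma = record
                  { isEquivalence = record
                      { refl = pointwise λ _ → refl ; sym = ≃-sym ; trans = ≃-trans }
                  ; ∙-cong = +ᵣ-cong }
                ; assoc = λ (real x _) (real y _) (real z _) → pointwise λ n → ℚ.+-assoc (x n) (y n) (z n) }
              ; identity = (λ (real x _) → pointwise λ n → ℚ.+-identityˡ (x n))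
                         , (λ (real x _) → pointwise λ n → ℚ.+-identityʳ (x n)) }
            ; inverse = (λ (real x _) → pointwise λ n → ℚ.+-inverseˡ (x n))
                      , (λ (real x _) → pointwise λ n → ℚ.+-inverseʳ (x n))
            ; ⁻¹-cong = -ᵣ-cong }
          ; comm = λ (real x _) (real y _) → pointwise λ n → ℚ.+-comm (x n) (y n) }
        ; *-cong = *ᵣ-cong
        ; *-assoc = λ (real x _) (real y _) (real z _) → pointwise λ n → ℚ.*-assoc (x n) (y n) (z n)
        ; *-identity = (λ (real x _) → pointwise λ n → ℚ.*-identityˡ (x n))
                     , (λ (real x _) → pointwise λ n → ℚ.*-identityʳ (x n))
        ; distrib = (λ (real x _) (real y _) (real z _) → pointwise λ n → ℚ.*-distribˡ-+ (x n) (y n) (z n))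
                  , (λ (real x _) (real y _) (real z _) → pointwise λ n → ℚ.*-distribʳ-+ (x n) (y n) (z n)) }
      ; *-comm = λ (real x _) (real y _) → pointwise λ n → ℚ.*-comm (x n) (y n) } }

  ≃0⇒null : ∀ {x} → x ≃ fromℚ 0ℚ → Null (ℝ.seq x)
  ≃0⇒null {real x _} (null p) = null-cong (λ n → ℚ.+-identityʳ (x n)) p

  null⇒≃0 : ∀ {x} → Null (ℝ.seq x) → x ≃ fromℚ 0ℚ
  null⇒≃0 {real x _} p = null (null-cong (λ n → sym (ℚ.+-identityʳ (x n))) p)

  ≃0-stable : ∀ x → ¬ ¬ x ≃ fromℚ 0ℚ → x ≃ fromℚ 0ℚ
  ≃0-stable x ¬¬x≃0 = null⇒≃0 (null-stable x λ ¬null → ¬¬x≃0 λ x≃0 → ¬null (≃0⇒null x≃0))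

  ℝ-domain : ∀ x y → x *ᵣ y ≃ fromℚ 0ℚ → ¬ x ≃ fromℚ 0ℚ → y ≃ fromℚ 0ℚ
  ℝ-domain x y xy≃0 x≄0 = null⇒≃0 (null-domain x y (≃0⇒null xy≃0) λ null → x≄0 (null⇒≃0 null))

  sum-of-squares : ∀ x y → x *ᵣ x +ᵣ y *ᵣ y ≃ fromℚ 0ℚ → x ≃ fromℚ 0ℚ
  sum-of-squares (real x _) (real y _) p = null⇒≃0 (null-square x y (≃0⇒null p))

module Complexification (R : CommutativeRing 0ℓ 0ℓ) where
  open CommutativeRing R hiding (zero)
  open RingSolver R
  open Algebra.Properties.Ring ring using (-‿distribˡ-*; -0#≈0#)

  *-assoc-re : ∀ a b c d e f → (a * c + - (b * d)) * e + - ((a * d + b * c) * f) ≈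
                               a * (c * e + - (d * f)) + - (b * (c * f + d * e))
  *-assoc-re = solve 6 (λ a b c d e f →
    (a :* c :+ :- (b :* d)) :* e :+ :- ((a :* d :+ b :* c) :* f) :=
    a :* (c :* e :+ :- (d :* f)) :+ :- (b :* (c :* f :+ d :* e))) refl

  *-assoc-im : ∀ a b c d e f → (a * c + - (b * d)) * f + (a * d + b * c) * e ≈
                               a * (c * f + d * e) + b * (c * e + - (d * f))
  *-assoc-im = solve 6 (λ a b c d e f →
    (a :* c :+ :- (b :* d)) :* f :+ (a :* d :+ b :* c) :* e :=
    a :* (c :* f :+ d :* e) :+ b :* (c :* e :+ :- (d :* f))) refl

  *-identity-re : ∀ a b → 1# * a + - (0# * b) ≈ a
  *-identity-re a b = trans (+-cong (*-identityˡ a) (trans (-‿cong (zeroˡ b)) -0#≈0#)) (+-identityʳ a)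

  *-identity-im : ∀ a b → 1# * b + 0# * a ≈ b
  *-identity-im a b = trans (+-cong (*-identityˡ b) (zeroˡ a)) (+-identityʳ b)

  *-distrib-re : ∀ a b c d e f → a * (c + e) + - (b * (d + f)) ≈ (a * c + - (b * d)) + (a * e + - (b * f))
  *-distrib-re = solve 6 (λ a b c d e f → a :* (c :+ e) :+ :- (b :* (d :+ f)) :=
    (a :* c :+ :- (b :* d)) :+ (a :* e :+ :- (b :* f))) refl

  *-distrib-im : ∀ a b c d e f → a * (d + f) + b * (c + e) ≈ (a * d + b * c) + (a * f + b * e)
  *-distrib-im = solve 6 (λ a b c d e f → a :* (d :+ f) :+ b :* (c :+ e) :=
    (a :* d :+ b :* c) :+ (a :* f :+ b :* e)) refl

  *-comm-re : ∀ a b c d → a * c + - (b * d) ≈ c * a + - (d * b)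
  *-comm-re a b c d = +-cong (*-comm a c) (-‿cong (*-comm b d))

  *-comm-im : ∀ a b c d → a * d + b * c ≈ c * b + d * a
  *-comm-im a b c d = trans (+-comm _ _) (+-cong (*-comm b c) (*-comm a d))

  infix 4 _≋_
  record _≋_ (z w : Carrier × Carrier) : Set where
    constructor _,_
    field
      re : proj₁ z ≈ proj₁ w
      im : proj₂ z ≈ proj₂ w

  complexification : CommutativeRing 0ℓ 0ℓ
  complexification = record
    { Carrier = Carrier × Carrier
    ; _≈_ = _≋_
    ; _+_ = λ (a , b) (a′ , b′) → a + a′ , b + b′
    ; _*_ = λ (a , b) (a′ , b′) → a * a′ + - (b * b′) , a * b′ + b * a′
    ; -_  = λ (a , b) → - a , - b
    ; 0#  = 0# , 0#
    ; 1#  = 1# , 0#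
    ; isCommutativeRing = record
      { isRing = record
        { +-isAbelianGroup = record
          { isGroup = record
            { isMonoid = record
              { isSemigroup = record
                { isMagma = record
                  { isEquivalence = record
                    { refl  = refl , refl
                    ; sym   = λ (p , q) → sym p , sym q
                    ; trans = λ (p , q) (p′ , q′) → trans p p′ , trans q q′ }
                  ; ∙-cong = λ (p , q) (p′ , q′) → +-cong p p′ , +-cong q q′ }
                ; assoc = λ _ _ _ → +-assoc _ _ _ , +-assoc _ _ _ }
              ; identity = (λ _ → +-identityˡ _ , +-identityˡ _) , (λ _ → +-identityʳ _ , +-identityʳ _) }
            ; inverse = (λ _ → -‿inverseˡ _ , -‿inverseˡ _) , (λ _ → -‿inverseʳ _ , -‿inverseʳ _)
            ; ⁻¹-cong = λ (p , q) → -‿cong p , -‿cong q }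
          ; comm = λ _ _ → +-comm _ _ , +-comm _ _ }
        ; *-cong = λ (p , q) (p′ , q′) →
            +-cong (*-cong p p′) (-‿cong (*-cong q q′)) , +-cong (*-cong p q′) (*-cong q p′)
        ; *-assoc = λ (a , b) (c , d) (e , f) → *-assoc-re a b c d e f , *-assoc-im a b c d e f
        ; *-identity =
            (λ (a , b) → *-identity-re a b , *-identity-im a b)
          , (λ (a , b) → trans (*-comm-re a b 1# 0#) (*-identity-re a b)
                       , trans (*-comm-im a b 1# 0#) (*-identity-im a b))
        ; distrib =
            (λ (a , b) (c , d) (e , f) → *-distrib-re a b c d e f , *-distrib-im a b c d e f)
          , (λ (a , b) (c , d) (e , f) →
                trans (*-comm-re (c + e) (d + f) a b)
                  (trans (*-distrib-re a b c d e f) (+-cong (*-comm-re a b c d) (*-comm-re a b e f)))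
              , trans (*-comm-im (c + e) (d + f) a b)
                  (trans (*-distrib-im a b c d e f) (+-cong (*-comm-im a b c d) (*-comm-im a b e f)))) }
      ; *-comm = λ (a , b) (c , d) → *-comm-re a b c d , *-comm-im a b c d } }

  module _ (stable : ∀ x → ¬ ¬ x ≈ 0# → x ≈ 0#)
           (domain : ∀ x y → x * y ≈ 0# → ¬ x ≈ 0# → y ≈ 0#)
           (sum-of-squares : ∀ x y → x * x + y * y ≈ 0# → x ≈ 0#) where
    private
      module C = CommutativeRing complexification

    complexification-stable : ∀ z → ¬ ¬ z ≋ C.0# → z ≋ C.0#
    complexification-stable (a , b) ¬¬z≋0 =
        stable a (λ a≉0 → ¬¬z≋0 λ (a≈0 , _) → a≉0 a≈0)
      , stable b (λ b≉0 → ¬¬z≋0 λ (_ , b≈0) → b≉0 b≈0)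

    norm≉0 : ∀ a b → ¬ (a , b) ≋ C.0# → ¬ a * a + b * b ≈ 0#
    norm≉0 a b z≉0 norm≈0 = z≉0
      (sum-of-squares a b norm≈0 , sum-of-squares b a (trans (+-comm _ _) norm≈0))

    conjugate-re : ∀ a b c d → (a * a + b * b) * c ≈ a * (a * c + - (b * d)) + b * (a * d + b * c)
    conjugate-re = solve 4 (λ a b c d → (a :* a :+ b :* b) :* c :=
      a :* (a :* c :+ :- (b :* d)) :+ b :* (a :* d :+ b :* c)) refl

    conjugate-im : ∀ a b c d → (a * a + b * b) * d ≈ a * (a * d + b * c) - b * (a * c + - (b * d))
    conjugate-im = solve 4 (λ a b c d → (a :* a :+ b :* b) :* d :=
      a :* (a :* d :+ b :* c) :- b :* (a :* c :+ :- (b :* d))) refl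

    vanish : ∀ a b {x y} → x ≈ 0# → y ≈ 0# → a * x + b * y ≈ 0#
    vanish a b x≈0 y≈0 = trans (+-cong (trans (*-congˡ x≈0) (zeroʳ a)) (trans (*-congˡ y≈0) (zeroʳ b)))
                               (+-identityʳ 0#)

    -- Multiplying by the conjugate of z turns z w = 0 into ∣z∣² w = 0.
    complexification-domain : ∀ z w → z C.* w ≋ C.0# → ¬ z ≋ C.0# → w ≋ C.0#
    complexification-domain (a , b) (c , d) (re≈0 , im≈0) z≉0 =
        domain _ c (trans (conjugate-re a b c d) (vanish a b re≈0 im≈0)) (norm≉0 a b z≉0)
      , domain _ d (trans (conjugate-im a b c d)
          (trans (+-congˡ (-‿distribˡ-* b _)) (vanish a (- b) im≈0 re≈0))) (norm≉0 a b z≉0)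

module ComplexNumbers where
  open ≡ using (subst)
  open RealNumbers
  open Complexification ℝ-commutativeRing public using (_≋_; _,_) renaming (complexification to ℂ-commutativeRing)
  private
    module C = CommutativeRing ℂ-commutativeRing
    open Algebra.Properties.Semiring.Mult C.semiring renaming (_×_ to _·_)

  ℂ-stable : ∀ z → ¬ ¬ z ≋ C.0# → z ≋ C.0#
  ℂ-stable = Complexification.complexification-stable ℝ-commutativeRing ≃0-stable ℝ-domain sum-of-squares

  ℂ-domain : ∀ z w → z C.* w ≋ C.0# → ¬ z ≋ C.0# → w ≋ C.0#
  ℂ-domain = Complexification.complexification-domain ℝ-commutativeRing ≃0-stable ℝ-domain sum-of-squares

  ℂ-characteristic : ∀ n → ¬ suc n · C.1# ≋ C.0#
  ℂ-characteristic n (re≃0 , _) = apart⇒¬null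
    (1ℚ , ℚ.positive⁻¹ 1ℚ , 0 , λ k _ → subst (1ℚ ℚ.≤_) (≡.sym (ℚ.0≤p⇒∣p∣≡p (≥0 (suc n) k))) (≥1 k))
    (≃0⇒null re≃0)
    where
    ≥0 : ∀ n k → 0ℚ ℚ.≤ ℝ.seq (proj₁ (n · C.1#)) k
    ≥0 zero    k = ℚ.≤-refl
    ≥0 (suc n) k = ℚ.+-mono-≤ (ℚ.nonNegative⁻¹ 1ℚ) (≥0 n k)
    ≥1 : ∀ k → 1ℚ ℚ.≤ ℝ.seq (proj₁ (suc n · C.1#)) k
    ≥1 k = ℚ.+-monoʳ-≤ 1ℚ (≥0 n k)

  ≋⇒≈ : ∀ z w → z ≋ w → RawRing._≈_ ℂ-rawRing z w
  ≋⇒≈ z w (p , q) = null-difference p , null-difference q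

  ≈⇒≋ : ∀ z w → RawRing._≈_ ℂ-rawRing z w → z ≋ w
  ≈⇒≋ z w (p , q) = null p , null q

-- Polynomials in q

module PolynomialRing where
  open ≡ using (refl; sym; trans; cong; cong₂; subst)
  infix 4 _≃ₚ_
  record _≃ₚ_ (p p′ : ℤ[q]) : Set where
    constructor equal
    field coeff-≡ : p ≈ₚ p′
  open _≃ₚ_ public

  scale : ℤ → ℤ[q] → ℤ[q]
  scale a = List.map (a ℤ.*_)

  coeff-+ : ∀ p p′ i → coeff (p +ₚ p′) i ≡ coeff p i ℤ.+ coeff p′ i
  coeff-+ []      p′       i       = sym (ℤ.+-identityˡ _)
  coeff-+ (a ∷ p) []       i       = sym (ℤ.+-identityʳ _)
  coeff-+ (a ∷ p) (b ∷ p′) zero    = refl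
  coeff-+ (a ∷ p) (b ∷ p′) (suc i) = coeff-+ p p′ i

  coeff-scale : ∀ a p i → coeff (scale a p) i ≡ a ℤ.* coeff p i
  coeff-scale a []      i       = sym (ℤ.*-zeroʳ a)
  coeff-scale a (b ∷ p) zero    = refl
  coeff-scale a (b ∷ p) (suc i) = coeff-scale a p i

  coeff-neg : ∀ p i → coeff (negₚ p) i ≡ ℤ.- coeff p i
  coeff-neg []      i       = refl
  coeff-neg (a ∷ p) zero    = refl
  coeff-neg (a ∷ p) (suc i) = coeff-neg p i

  ≃-refl : ∀ {p} → p ≃ₚ p
  ≃-refl = equal λ _ → refl

  ≃-sym : ∀ {p p′} → p ≃ₚ p′ → p′ ≃ₚ p
  ≃-sym (equal eq) = equal (sym ∘ eq)

  ≃-trans : ∀ {p p′ p″} → p ≃ₚ p′ → p′ ≃ₚ p″ → p ≃ₚ p″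
  ≃-trans (equal eq) (equal eq′) = equal λ i → trans (eq i) (eq′ i)

  ∷-cong : ∀ a {p p′} → p ≃ₚ p′ → a ∷ p ≃ₚ a ∷ p′
  ∷-cong a (equal eq) = equal λ { zero → refl ; (suc i) → eq i }

  via-coeff₂ : ∀ {p p′ r r′} → (∀ i → coeff p i ℤ.+ coeff p′ i ≡ coeff r i ℤ.+ coeff r′ i) → p +ₚ p′ ≃ₚ r +ₚ r′
  via-coeff₂ {p} {p′} {r} {r′} eq = equal λ i → trans (coeff-+ p p′ i) (trans (eq i) (sym (coeff-+ r r′ i)))

  +-cong : ∀ {p p′ r r′} → p ≃ₚ p′ → r ≃ₚ r′ → p +ₚ r ≃ₚ p′ +ₚ r′
  +-cong {p} {p′} {r} {r′} (equal eq) (equal eq′) = via-coeff₂ {p} {r} {p′} {r′} λ i → cong₂ ℤ._+_ (eq i) (eq′ i)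

  +-comm : ∀ p r → p +ₚ r ≃ₚ r +ₚ p
  +-comm p r = via-coeff₂ {p} {r} {r} {p} λ i → ℤ.+-comm (coeff p i) (coeff r i)

  +-assoc : ∀ p r s → (p +ₚ r) +ₚ s ≃ₚ p +ₚ (r +ₚ s)
  +-assoc p r s = via-coeff₂ {p +ₚ r} {s} {p} {r +ₚ s} λ i →
    trans (cong (ℤ._+ coeff s i) (coeff-+ p r i))
      (trans (ℤ.+-assoc (coeff p i) (coeff r i) (coeff s i)) (cong (λ t → coeff p i ℤ.+ t) (sym (coeff-+ r s i))))

  +-identityʳ : ∀ p → p +ₚ [] ≃ₚ p
  +-identityʳ p = equal λ i → trans (coeff-+ p [] i) (ℤ.+-identityʳ _)

  +-inverseʳ : ∀ p → p +ₚ negₚ p ≃ₚ []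
  +-inverseʳ p = equal λ i → trans (coeff-+ p (negₚ p) i)
    (trans (cong (λ t → coeff p i ℤ.+ t) (coeff-neg p i)) (ℤ.+-inverseʳ (coeff p i)))

  neg-cong : ∀ {p p′} → p ≃ₚ p′ → negₚ p ≃ₚ negₚ p′
  neg-cong {p} {p′} (equal eq) = equal λ i → trans (coeff-neg p i) (trans (cong ℤ.-_ (eq i)) (sym (coeff-neg p′ i)))

  scale-cong : ∀ a {p p′} → p ≃ₚ p′ → scale a p ≃ₚ scale a p′
  scale-cong a {p} {p′} (equal eq) = equal λ i →
    trans (coeff-scale a p i) (trans (cong (a ℤ.*_) (eq i)) (sym (coeff-scale a p′ i)))

  scale-+ : ∀ a p r → scale a (p +ₚ r) ≃ₚ scale a p +ₚ scale a r
  scale-+ a p r = equal λ i → trans (coeff-scale a (p +ₚ r) i) (trans (cong (a ℤ.*_) (coeff-+ p r i))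
    (trans (ℤ.*-distribˡ-+ a (coeff p i) (coeff r i))
      (sym (trans (coeff-+ (scale a p) (scale a r) i) (cong₂ ℤ._+_ (coeff-scale a p i) (coeff-scale a r i))))))

  scale-scale : ∀ a b p → scale a (scale b p) ≃ₚ scale (a ℤ.* b) p
  scale-scale a b p = equal λ i → trans (coeff-scale a (scale b p) i)
    (trans (cong (a ℤ.*_) (coeff-scale b p i)) (trans (sym (ℤ.*-assoc a b _)) (sym (coeff-scale (a ℤ.* b) p i))))

  scale-0 : ∀ p → scale 0ℤ p ≃ₚ []
  scale-0 p = equal λ i → coeff-scale 0ℤ p i

  scale-1 : ∀ p → scale 1ℤ p ≃ₚ p
  scale-1 p = equal λ i → trans (coeff-scale 1ℤ p i) (ℤ.*-identityˡ _)

  0∷[] : 0ℤ ∷ [] ≃ₚ []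
  0∷[] = equal λ { zero → refl ; (suc i) → refl }

  interchange : ∀ p r s t → (p +ₚ r) +ₚ (s +ₚ t) ≃ₚ (p +ₚ s) +ₚ (r +ₚ t)
  interchange p r s t = ≃-trans (+-assoc p r (s +ₚ t)) (≃-trans (+-cong (≃-refl {p})
    (≃-trans (≃-sym (+-assoc r s t)) (≃-trans (+-cong (+-comm r s) (≃-refl {t})) (+-assoc s r t))))
    (≃-sym (+-assoc p s (r +ₚ t))))

  *-zeroʳ : ∀ p → p *ₚ [] ≃ₚ []
  *-zeroʳ []      = ≃-refl
  *-zeroʳ (a ∷ p) = ≃-trans (∷-cong 0ℤ (*-zeroʳ p)) 0∷[]

  *-congʳ : ∀ p {r r′} → r ≃ₚ r′ → p *ₚ r ≃ₚ p *ₚ r′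
  *-congʳ []      eq = ≃-refl
  *-congʳ (a ∷ p) eq = +-cong (scale-cong a eq) (∷-cong 0ℤ (*-congʳ p eq))

  *-∷ : ∀ p b r → p *ₚ (b ∷ r) ≃ₚ scale b p +ₚ (0ℤ ∷ p *ₚ r)
  *-∷ []      b r = ≃-sym 0∷[]
  *-∷ (a ∷ p) b r = equal λ { zero → cong (ℤ._+ 0ℤ) (ℤ.*-comm a b) ; (suc i) → coeff-≡ tail i }
    where
    tail : scale a r +ₚ p *ₚ (b ∷ r) ≃ₚ scale b p +ₚ (scale a r +ₚ (0ℤ ∷ p *ₚ r))
    tail = ≃-trans (+-cong (≃-refl {scale a r}) (*-∷ p b r))
      (≃-trans (≃-sym (+-assoc (scale a r) (scale b p) _))
        (≃-trans (+-cong (+-comm (scale a r) (scale b p)) (≃-refl {0ℤ ∷ p *ₚ r})) (+-assoc (scale b p) (scale a r) _)))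

  *-comm : ∀ p r → p *ₚ r ≃ₚ r *ₚ p
  *-comm []      r = ≃-sym (*-zeroʳ r)
  *-comm (a ∷ p) r = ≃-trans (+-cong (≃-refl {scale a r}) (∷-cong 0ℤ (*-comm p r))) (≃-sym (*-∷ r a p))

  *-cong : ∀ {p p′ r r′} → p ≃ₚ p′ → r ≃ₚ r′ → p *ₚ r ≃ₚ p′ *ₚ r′
  *-cong {p} {p′} {r} {r′} eq eq′ = ≃-trans (*-congʳ p eq′)
    (≃-trans (*-comm p r′) (≃-trans (*-congʳ r′ eq) (*-comm r′ p′)))

  *-distribˡ : ∀ p r s → p *ₚ (r +ₚ s) ≃ₚ p *ₚ r +ₚ p *ₚ s
  *-distribˡ []      r s = ≃-refl
  *-distribˡ (a ∷ p) r s = ≃-trans (+-cong (scale-+ a r s) (∷-cong 0ℤ (*-distribˡ p r s)))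
    (interchange (scale a r) (scale a s) (0ℤ ∷ p *ₚ r) (0ℤ ∷ p *ₚ s))

  *-distribʳ : ∀ p r s → (r +ₚ s) *ₚ p ≃ₚ r *ₚ p +ₚ s *ₚ p
  *-distribʳ p r s = ≃-trans (*-comm (r +ₚ s) p)
    (≃-trans (*-distribˡ p r s) (+-cong (*-comm p r) (*-comm p s)))

  scale-* : ∀ a p r → scale a p *ₚ r ≃ₚ scale a (p *ₚ r)
  scale-* a []      r = ≃-refl
  scale-* a (b ∷ p) r = ≃-trans (+-cong (≃-sym (scale-scale a b r)) (∷-cong 0ℤ (scale-* a p r)))
    (≃-trans (+-cong (≃-refl {scale a (scale b r)}) 0∷-scale) (≃-sym (scale-+ a (scale b r) (0ℤ ∷ p *ₚ r))))
    where
    0∷-scale : 0ℤ ∷ scale a (p *ₚ r) ≃ₚ scale a (0ℤ ∷ p *ₚ r)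
    0∷-scale = equal λ { zero → sym (ℤ.*-zeroʳ a) ; (suc i) → refl }

  0∷-* : ∀ p r → (0ℤ ∷ p) *ₚ r ≃ₚ 0ℤ ∷ p *ₚ r
  0∷-* p r = +-cong (scale-0 r) (≃-refl {0ℤ ∷ p *ₚ r})

  *-assoc : ∀ p r s → (p *ₚ r) *ₚ s ≃ₚ p *ₚ (r *ₚ s)
  *-assoc []      r s = ≃-refl
  *-assoc (a ∷ p) r s = ≃-trans (*-distribʳ s (scale a r) (0ℤ ∷ p *ₚ r))
    (+-cong (scale-* a r s) (≃-trans (0∷-* (p *ₚ r) s) (∷-cong 0ℤ (*-assoc p r s))))

  *-identityˡ : ∀ p → 1ₚ *ₚ p ≃ₚ p
  *-identityˡ p = ≃-trans (+-cong (scale-1 p) 0∷[]) (+-identityʳ p)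

  ℤ[q]-commutativeRing : CommutativeRing 0ℓ 0ℓ
  ℤ[q]-commutativeRing = record
    { Carrier = ℤ[q] ; _≈_ = _≃ₚ_ ; _+_ = _+ₚ_ ; _*_ = _*ₚ_ ; -_ = negₚ ; 0# = 0ₚ ; 1# = 1ₚ
    ; isCommutativeRing = record
      { isRing = record
        { +-isAbelianGroup = record
          { isGroup = record
            { isMonoid = record
              { isSemigroup = record
                { isMagma = record
                  { isEquivalence = record { refl = ≃-refl ; sym = ≃-sym ; trans = ≃-trans }
                  ; ∙-cong = +-cong }
                ; assoc = +-assoc }
              ; identity = (λ _ → ≃-refl) , +-identityʳ }
            ; inverse = (λ p → ≃-trans (+-comm (negₚ p) p) (+-inverseʳ p)) , +-inverseʳ
            ; ⁻¹-cong = neg-cong }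
          ; comm = +-comm }
        ; *-cong = *-cong
        ; *-assoc = *-assoc
        ; *-identity = *-identityˡ , λ p → ≃-trans (*-comm p 1ₚ) (*-identityˡ p)
        ; distrib = *-distribˡ , *-distribʳ }
      ; *-comm = *-comm } }

  open RingSolver ℤ[q]-commutativeRing

  *-cancelʳ : ∀ u p r → u ≉ₚ 0ₚ → p *ₚ u ≃ₚ r *ₚ u → p ≃ₚ r
  *-cancelʳ u p r u≉0 eq = equal λ i → decidable-stable (coeff p i ℤ.≟ coeff r i) λ pᵢ≢rᵢ →
    *ₚ-≉0 (p +ₚ negₚ r) u
      (λ p-r≈0 → pᵢ≢rᵢ (trans (coeff-≡ (difference p r) i)
        (trans (coeff-+ (p +ₚ negₚ r) r i) (trans (cong (ℤ._+ coeff r i) (p-r≈0 i)) (ℤ.+-identityˡ _)))))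
      u≉0
      (coeff-≡ (≃-trans (expand p r u) (≃-trans (+-cong eq (≃-refl {negₚ (r *ₚ u)})) (+-inverseʳ (r *ₚ u)))))
    where
    difference : ∀ p r → p ≃ₚ (p +ₚ negₚ r) +ₚ r
    difference = solve 2 (λ p r → p := (p :+ :- r) :+ r) ≃-refl
    expand : ∀ p r u → (p +ₚ negₚ r) *ₚ u ≃ₚ p *ₚ u +ₚ negₚ (r *ₚ u)
    expand = solve 3 (λ p r u → (p :+ :- r) :* u := p :* u :+ :- (r :* u)) ≃-refl

  -- Nonnegative coefficients prevent cancellation between summands, so the degree and leading
  -- coefficient of a sum reveal the degrees of its terms.
  record NonnegativeMonic (n : ℕ) (p : ℤ[q]) : Set where
    field
      leading     : coeff p n ≡ 1ℤ
      vanishing   : ∀ i → n < i → coeff p i ≡ 0ℤ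
      nonnegative : ∀ i → 0ℤ ℤ.≤ coeff p i
  open NonnegativeMonic public

  monic-cong : ∀ {n p p′} → p ≃ₚ p′ → NonnegativeMonic n p → NonnegativeMonic n p′
  monic-cong (equal eq) monic = record
    { leading     = trans (sym (eq _)) (leading monic)
    ; vanishing   = λ i n<i → trans (sym (eq i)) (vanishing monic i n<i)
    ; nonnegative = λ i → subst (0ℤ ℤ.≤_) (eq i) (nonnegative monic i) }

  coeff-*-∷ : ∀ a p r i → coeff ((a ∷ p) *ₚ r) i ≡ a ℤ.* coeff r i ℤ.+ coeff (0ℤ ∷ p *ₚ r) i
  coeff-*-∷ a p r i = trans (coeff-+ (scale a r) _ i) (cong (ℤ._+ coeff (0ℤ ∷ p *ₚ r) i) (coeff-scale a r i))

  0≤+ : ∀ {a b} → 0ℤ ℤ.≤ a → 0ℤ ℤ.≤ b → 0ℤ ℤ.≤ a ℤ.+ b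
  0≤+ = ℤ.+-mono-≤

  0≤* : ∀ {a b} → 0ℤ ℤ.≤ a → 0ℤ ℤ.≤ b → 0ℤ ℤ.≤ a ℤ.* b
  0≤* {a} {b} 0≤a 0≤b = subst (ℤ._≤ a ℤ.* b) (ℤ.*-zeroʳ a) (ℤ.*-monoˡ-≤-nonNeg a {{ℤ.nonNegative 0≤a}} 0≤b)

  *-nonnegative : ∀ p r → (∀ i → 0ℤ ℤ.≤ coeff p i) → (∀ i → 0ℤ ℤ.≤ coeff r i) → ∀ i → 0ℤ ℤ.≤ coeff (p *ₚ r) i
  *-nonnegative []      r 0≤p 0≤r i = ℤ.≤-refl
  *-nonnegative (a ∷ p) r 0≤p 0≤r i = subst (0ℤ ℤ.≤_) (sym (coeff-*-∷ a p r i)) (0≤+ (0≤* (0≤p 0) (0≤r i)) (shifted i))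
    where
    shifted : ∀ i → 0ℤ ℤ.≤ coeff (0ℤ ∷ p *ₚ r) i
    shifted zero    = ℤ.≤-refl
    shifted (suc i) = *-nonnegative p r (0≤p ∘ suc) 0≤r i

  *-vanishing : ∀ n m p r → (∀ i → n < i → coeff p i ≡ 0ℤ) → (∀ i → m < i → coeff r i ≡ 0ℤ) →
                ∀ i → n ℕ.+ m < i → coeff (p *ₚ r) i ≡ 0ℤ
  *-vanishing n m [] r p≡0 r≡0 i n+m<i = refl
  *-vanishing n m (a ∷ p) r p≡0 r≡0 i n+m<i = trans (coeff-*-∷ a p r i)
    (cong₂ ℤ._+_ (trans (cong (a ℤ.*_) (r≡0 i (ℕ.≤-<-trans (ℕ.m≤n+m m n) n+m<i))) (ℤ.*-zeroʳ a)) (shifted n i p≡0 n+m<i))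
    where
    shifted : ∀ n i → (∀ i → n < i → coeff (a ∷ p) i ≡ 0ℤ) → n ℕ.+ m < i → coeff (0ℤ ∷ p *ₚ r) i ≡ 0ℤ
    shifted zero    (suc i) p≡0 _           = coeff-≡ (*-cong {p} {[]} {r} (equal λ j → p≡0 (suc j) (s≤s z≤n)) ≃-refl) i
    shifted (suc n) (suc i) p≡0 (s≤s n+m<i) = *-vanishing n m p r (λ j n<j → p≡0 (suc j) (s≤s n<j)) r≡0 i n+m<i

  *-leading : ∀ n m p r → (∀ i → n < i → coeff p i ≡ 0ℤ) → (∀ i → m < i → coeff r i ≡ 0ℤ) →
              coeff (p *ₚ r) (n ℕ.+ m) ≡ coeff p n ℤ.* coeff r m
  *-leading n m [] r p≡0 r≡0 = refl
  *-leading zero m (a ∷ p) r p≡0 r≡0 = trans (coeff-*-∷ a p r m) (trans (cong (λ t → a ℤ.* coeff r m ℤ.+ t) (shifted m)) (ℤ.+-identityʳ _))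
    where
    shifted : ∀ i → coeff (0ℤ ∷ p *ₚ r) i ≡ 0ℤ
    shifted zero    = refl
    shifted (suc i) = coeff-≡ (*-cong {p} {[]} {r} (equal λ j → p≡0 (suc j) (s≤s z≤n)) ≃-refl) i
  *-leading (suc n) m (a ∷ p) r p≡0 r≡0 = trans (coeff-*-∷ a p r (suc n ℕ.+ m))
    (trans (cong (ℤ._+ coeff (p *ₚ r) (n ℕ.+ m)) (trans (cong (a ℤ.*_) (r≡0 _ (s≤s (ℕ.m≤n+m m n)))) (ℤ.*-zeroʳ a)))
      (trans (ℤ.+-identityˡ _) (*-leading n m p r (λ j n<j → p≡0 (suc j) (s≤s n<j)) r≡0)))

  monic-* : ∀ {n m p r} → NonnegativeMonic n p → NonnegativeMonic m r → NonnegativeMonic (n ℕ.+ m) (p *ₚ r)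
  monic-* {n} {m} {p} {r} P R = record
    { leading     = trans (*-leading n m p r (vanishing P) (vanishing R)) (cong₂ ℤ._*_ (leading P) (leading R))
    ; vanishing   = *-vanishing n m p r (vanishing P) (vanishing R)
    ; nonnegative = *-nonnegative p r (nonnegative P) (nonnegative R) }

  open Algebra.Properties.Semiring.Exp (CommutativeRing.semiring ℤ[q]-commutativeRing) using (_^_)

  monic-1 : NonnegativeMonic 0 1ₚ
  monic-1 = record
    { leading = refl ; vanishing = λ { (suc i) _ → refl } ; nonnegative = λ { zero → ℤ.+≤+ z≤n ; (suc i) → ℤ.≤-refl } }

  monic-^ : ∀ {n p} → NonnegativeMonic n p → ∀ k → NonnegativeMonic (k ℕ.* n) (p ^ k)
  monic-^ P zero    = monic-1
  monic-^ P (suc k) = monic-* P (monic-^ P k)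

  monic-[] : ∀ n → NonnegativeMonic n [ suc n ]q
  monic-[] zero    = monic-1
  monic-[] (suc n) = record
    { leading = leading (monic-[] n)
    ; vanishing = λ { (suc i) (s≤s n<i) → vanishing (monic-[] n) i n<i }
    ; nonnegative = λ { zero → ℤ.+≤+ z≤n ; (suc i) → nonnegative (monic-[] n) i } }

  monic-0∷ : ∀ {n p} → NonnegativeMonic n p → NonnegativeMonic (suc n) (0ℤ ∷ p)
  monic-0∷ P = record
    { leading = leading P
    ; vanishing = λ { (suc i) (s≤s n<i) → vanishing P i n<i }
    ; nonnegative = λ { zero → ℤ.≤-refl ; (suc i) → nonnegative P i } }

-- Graphic rank

module Connectivity {n : ℕ} where
  open ≡ using (refl; sym; trans; cong; subst)
  open import Data.Nat using (_+_)
  open import Data.List using (length; lookup)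
  open import Data.List.Membership.Propositional using (_∈_)
  open import Data.List.Membership.Propositional.Properties using (∈-lookup; ∈-++⁺ˡ; ∈-++⁺ʳ; ∈-++⁻)
  import Data.List.Relation.Unary.Any as Any
  open import Data.List.Relation.Unary.Any.Properties using (lookup-index)

  Edges : Set
  Edges = List (Fin n × Fin n)

  -- A record, so that unification recovers `l` and `e` from a proof of connectedness.
  record Joined (l : Edges) (e : Fin n × Fin n) : Set where
    constructor joined
    field connected : Connected (lookup l) (proj₁ e) (proj₂ e)
  open Joined public

  -- Sending each class of the coarser labelling to the finer class of a chosen representative is
  -- injective, since finely connected representatives are coarsely connected.
  components-antitone : ∀ {m m′} {ends : Fin m → Fin n × Fin n} {ends′ : Fin m′ → Fin n × Fin n} {c c′} →
    ComponentLabelling ends c → ComponentLabelling ends′ c′ →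
    (∀ {a b} → Connected ends a b → Connected ends′ a b) → c′ ≤ c
  components-antitone {c = c} {c′} L L′ ⊆′ = Fin.injective⇒≤ {f = f} injective
    where
    module L = ComponentLabelling L
    module L′ = ComponentLabelling L′
    f : Fin c′ → Fin c
    f x = L.label (proj₁ (L′.surjective x))
    injective : ∀ {x y} → f x ≡ f y → x ≡ y
    injective {x} {y} fx≡fy = trans (sym (proj₂ (L′.surjective x)))
      (trans (Equivalence.from L′.classes (⊆′ (Equivalence.to L.classes fx≡fy))) (proj₂ (L′.surjective y)))

  components-of : (l : Edges) → ∃ (ComponentLabelling (lookup l))
  components-of l = components (length l) (lookup l)

  κ : Edges → ℕ
  κ l = proj₁ (components-of l)

  rank : Edges → ℕ
  rank l = n ∸ κ l

  joined? : ∀ l e → Dec (Joined l e)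
  joined? l (a , b) = map′ (joined ∘ Equivalence.to classes) (Equivalence.from classes ∘ connected) (label a Fin.≟ label b)
    where open ComponentLabelling (proj₂ (components-of l))

  ∈⇒Joined : ∀ {l e} → e ∈ l → Joined l e
  ∈⇒Joined e∈l = joined (EqC.return (Any.index e∈l , sym (lookup-index e∈l)))

  symmetric : ∀ {l a b} → Joined l (a , b) → Joined l (b , a)
  symmetric (joined path) = joined (EqC.symmetric _ path)

  transitive : ∀ {l a b c} → Joined l (a , b) → Joined l (b , c) → Joined l (a , c)
  transitive (joined path) (joined path′) = joined (EqC.transitive _ path path′)

  Joined-least : ∀ {l l′} → (∀ {e} → e ∈ l → Joined l′ e) → ∀ {e} → Joined l e → Joined l′ e
  Joined-least {l} {l′} ⊆′ (joined path) = joined (EqC.gfold (EqC.isEquivalence _) id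
    (λ (i , eq) → connected (subst (Joined l′) eq (⊆′ (∈-lookup {xs = l} i)))) path)

  Joined-mono : ∀ {l l′} → (∀ {e} → e ∈ l → e ∈ l′) → ∀ {e} → Joined l e → Joined l′ e
  Joined-mono ⊆′ = Joined-least (∈⇒Joined ∘ ⊆′)

  κ-antitone : ∀ {l l′} → (∀ {e} → Joined l e → Joined l′ e) → κ l′ ≤ κ l
  κ-antitone {l} {l′} ⊆′ = components-antitone (proj₂ (components-of l)) (proj₂ (components-of l′)) λ {a} {b} path → connected (⊆′ {a , b} (joined path))

  κ≤n : ∀ l → κ l ≤ n
  κ≤n l = κ-antitone {[]} {l} (Joined-mono λ ())

  rank-mono : ∀ {l l′} → (∀ {e} → Joined l e → Joined l′ e) → rank l ≤ rank l′
  rank-mono {l} {l′} ⊆′ = ℕ.∸-monoʳ-≤ n (κ-antitone {l} {l′} ⊆′)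

  rank-cong : ∀ {l l′} → (∀ {e} → e ∈ l → e ∈ l′) → (∀ {e} → e ∈ l′ → e ∈ l) → rank l ≡ rank l′
  rank-cong {l} {l′} ⊆′ ⊇′ = ℕ.≤-antisym (rank-mono {l} {l′} (Joined-mono ⊆′)) (rank-mono {l′} {l} (Joined-mono ⊇′))

  -- `components` treats the first edge last, either keeping the labels or merging two of them, so
  -- both cases are read off its own case split.
  κ-∷ : ∀ e l → (Joined l e × κ (e ∷ l) ≡ κ l) ⊎ (¬ Joined l e × suc (κ (e ∷ l)) ≡ κ l)
  κ-∷ (a , b) l with components-of l
  ... | zero , L = ⊥-elim (Fin.¬Fin0 (ComponentLabelling.label L a))
  ... | suc c , L with ComponentLabelling.label L a Fin.≟ ComponentLabelling.label L b
  ...   | yes a≡b = inj₁ (joined (Equivalence.to (ComponentLabelling.classes L) a≡b) , refl)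
  ...   | no  a≢b = inj₂ (a≢b ∘ Equivalence.from (ComponentLabelling.classes L) ∘ connected , refl)

  rank-[] : rank [] ≡ 0
  rank-[] = ℕ.n∸n≡0 n

  rank-∷ : ∀ e l → (Joined l e × rank (e ∷ l) ≡ rank l) ⊎ (¬ Joined l e × rank (e ∷ l) ≡ suc (rank l))
  rank-∷ e l with κ-∷ e l
  ... | inj₁ (joins , eq)  = inj₁ (joins , cong (n ∸_) eq)
  ... | inj₂ (¬joins , eq) = inj₂ (¬joins , sym (trans (cong (λ k → suc (n ∸ k)) (sym eq))
          (sym (ℕ.+-∸-assoc 1 (subst (_≤ n) (sym eq) (κ≤n l))))))

  rank≤length : ∀ l → rank l ≤ length l
  rank≤length [] = ℕ.≤-reflexive rank-[]
  rank≤length (e ∷ l) with rank-∷ e l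
  ... | inj₁ (_ , eq) = subst (_≤ suc (length l)) (sym eq) (ℕ.m≤n⇒m≤1+n (rank≤length l))
  ... | inj₂ (_ , eq) = subst (_≤ suc (length l)) (sym eq) (s≤s (rank≤length l))

  -- Diminishing returns: an edge that raises the rank over the larger list x ++ b also raises it
  -- over x ++ a. Submodularity of `ρ` is the instance where x, a and b list A, A ∩ B and B.
  rank-++ : ∀ x {a b} → (∀ {e} → e ∈ a → e ∈ b) → rank (x ++ b) + rank a ≤ rank (x ++ a) + rank b
  rank-++ []      {a} {b} a⊆b = ℕ.≤-reflexive (ℕ.+-comm (rank b) (rank a))
  rank-++ (e ∷ x) {a} {b} a⊆b with rank-∷ e (x ++ a) | rank-∷ e (x ++ b)
  ... | inj₁ (_ , eq) | inj₁ (_ , eq′) rewrite eq | eq′ = rank-++ x a⊆b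
  ... | inj₂ (_ , eq) | inj₁ (_ , eq′) rewrite eq | eq′ = ℕ.m≤n⇒m≤1+n (rank-++ x a⊆b)
  ... | inj₂ (_ , eq) | inj₂ (_ , eq′) rewrite eq | eq′ = s≤s (rank-++ x a⊆b)
  ... | inj₁ (joins , _) | inj₂ (¬joins , _) = ⊥-elim (¬joins (Joined-mono
          (λ e∈ → [ ∈-++⁺ˡ , ∈-++⁺ʳ x ∘ a⊆b ]′ (∈-++⁻ x e∈)) joins))

module GraphicRank {n : ℕ} where
  open ≡ using (refl; trans; cong; subst)
  open import Data.Nat using (_+_)
  open import Data.List using (length)
  open import Data.List.Membership.Propositional using (_∈_)
  open import Data.List.Membership.Propositional.Properties using (∈-++⁺ˡ; ∈-++⁺ʳ; ∈-++⁻)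
  open import Data.List.Relation.Unary.Any using (here; there)
  open Connectivity {n}

  select : ∀ {m} → (Fin m → Fin n × Fin n) → Subset m → Edges
  select ends []            = []
  select ends (outside ∷ J) = select (ends ∘ suc) J
  select ends (inside ∷ J)  = ends zero ∷ select (ends ∘ suc) J

  ∈-select⁺ : ∀ {m} (ends : Fin m → Fin n × Fin n) {J e} → e ∈ˢ J → ends e ∈ select ends J
  ∈-select⁺ ends {inside ∷ J}  here        = here refl
  ∈-select⁺ ends {inside ∷ J}  (there e∈J) = there (∈-select⁺ (ends ∘ suc) e∈J)
  ∈-select⁺ ends {outside ∷ J} (there e∈J) = ∈-select⁺ (ends ∘ suc) e∈J

  ∈-select⁻ : ∀ {m} (ends : Fin m → Fin n × Fin n) J {x} → x ∈ select ends J → ∃ λ e → e ∈ˢ J × ends e ≡ x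
  ∈-select⁻ ends (inside ∷ J)  (here refl) = zero , here , refl
  ∈-select⁻ ends (inside ∷ J)  (there x∈) with ∈-select⁻ (ends ∘ suc) J x∈
  ... | e , e∈J , eq = suc e , there e∈J , eq
  ∈-select⁻ ends (outside ∷ J) x∈ with ∈-select⁻ (ends ∘ suc) J x∈
  ... | e , e∈J , eq = suc e , there e∈J , eq

  length-select : ∀ {m} (ends : Fin m → Fin n × Fin n) J → length (select ends J) ≡ ∣ J ∣
  length-select ends []            = refl
  length-select ends (outside ∷ J) = length-select (ends ∘ suc) J
  length-select ends (inside ∷ J)  = cong suc (length-select (ends ∘ suc) J)

  module _ {m : ℕ} (ends : Fin m → Fin n × Fin n) where

    Spans : Subset m → Fin m → Set
    Spans J e = Joined (select ends J) (ends e)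

    ρ : Subset m → ℕ
    ρ J = rank (select ends J)

    spans? : ∀ J e → Dec (Spans J e)
    spans? J e = joined? (select ends J) (ends e)

    select-mono : ∀ J K → J ⊆ K → ∀ {x} → x ∈ select ends J → x ∈ select ends K
    select-mono J K J⊆K x∈ with ∈-select⁻ ends J x∈
    ... | e , e∈J , refl = ∈-select⁺ ends (J⊆K e∈J)

    spans-mono : ∀ {J K e} → J ⊆ K → Spans J e → Spans K e
    spans-mono {J} {K} J⊆K = Joined-mono (select-mono J K J⊆K)

    ρ-mono : ∀ {J K} → J ⊆ K → ρ J ≤ ρ K
    ρ-mono {J} {K} J⊆K = rank-mono {select ends J} {select ends K} (Joined-mono (select-mono J K J⊆K))

    ρ-spanned : ∀ {J K} → (∀ {e} → e ∈ˢ K → Spans J e) → ρ K ≤ ρ J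
    ρ-spanned {J} {K} spanned = rank-mono {select ends K} {select ends J} (Joined-least λ x∈ → spanned′ x∈)
      where
      spanned′ : ∀ {x} → x ∈ select ends K → Joined (select ends J) x
      spanned′ x∈ with ∈-select⁻ ends K x∈
      ... | e , e∈K , refl = spanned e∈K

    ρ≤∣∣ : ∀ J → ρ J ≤ ∣ J ∣
    ρ≤∣∣ J = subst (ρ J ≤_) (length-select ends J) (rank≤length (select ends J))

    ρ-submodular : ∀ A B → ρ (A ∪ B) + ρ (A ∩ B) ≤ ρ A + ρ B
    ρ-submodular A B = subst (λ k → k + ρ (A ∩ B) ≤ ρ A + ρ B) (rank-cong ⊆∪ ∪⊆)
      (subst (λ k → rank (select ends A ++ select ends B) + ρ (A ∩ B) ≤ k + ρ B) (rank-cong ⊆A A⊆)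
        (rank-++ (select ends A) (select-mono (A ∩ B) B ∩⊆B)))
      where
      ∩⊆A : A ∩ B ⊆ A
      ∩⊆A = proj₁ ∘ x∈p∩q⁻ A B
      ∩⊆B : A ∩ B ⊆ B
      ∩⊆B = proj₂ ∘ x∈p∩q⁻ A B
      ⊆∪ : ∀ {x} → x ∈ select ends A ++ select ends B → x ∈ select ends (A ∪ B)
      ⊆∪ x∈ = [ select-mono A (A ∪ B) (x∈p∪q⁺ ∘ inj₁) , select-mono B (A ∪ B) (x∈p∪q⁺ ∘ inj₂) ]′ (∈-++⁻ (select ends A) x∈)
      ∪⊆ : ∀ {x} → x ∈ select ends (A ∪ B) → x ∈ select ends A ++ select ends B
      ∪⊆ x∈ with ∈-select⁻ ends (A ∪ B) x∈
      ... | e , e∈ , refl = [ ∈-++⁺ˡ ∘ ∈-select⁺ ends , ∈-++⁺ʳ (select ends A) ∘ ∈-select⁺ ends ]′ (x∈p∪q⁻ A B e∈)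
      ⊆A : ∀ {x} → x ∈ select ends A ++ select ends (A ∩ B) → x ∈ select ends A
      ⊆A x∈ = [ id , select-mono (A ∩ B) A ∩⊆A ]′ (∈-++⁻ (select ends A) x∈)
      A⊆ : ∀ {x} → x ∈ select ends A → x ∈ select ends A ++ select ends (A ∩ B)
      A⊆ = ∈-++⁺ˡ

    module Insert (J : Subset m) (e : Fin m) where
      ∪⊆ : ∀ {x} → x ∈ select ends (J ∪ ⁅ e ⁆) → x ∈ ends e ∷ select ends J
      ∪⊆ x∈ with ∈-select⁻ ends (J ∪ ⁅ e ⁆) x∈
      ... | f , f∈ , refl = [ there ∘ ∈-select⁺ ends , (λ f∈e → here (cong ends (x∈⁅y⁆⇒x≡y e f∈e))) ]′ (x∈p∪q⁻ J ⁅ e ⁆ f∈)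
      ⊆∪ : ∀ {x} → x ∈ ends e ∷ select ends J → x ∈ select ends (J ∪ ⁅ e ⁆)
      ⊆∪ (here refl) = ∈-select⁺ ends (x∈p∪q⁺ {p = J} (inj₂ (x∈⁅x⁆ e)))
      ⊆∪ (there x∈)  = select-mono J (J ∪ ⁅ e ⁆) (x∈p∪q⁺ ∘ inj₁) x∈

    ρ-insert : ∀ J e → (Spans J e × ρ (J ∪ ⁅ e ⁆) ≡ ρ J) ⊎ (¬ Spans J e × ρ (J ∪ ⁅ e ⁆) ≡ suc (ρ J))
    ρ-insert J e with rank-∷ (ends e) (select ends J)
    ... | inj₁ (spans , eq)  = inj₁ (spans , trans (rank-cong ∪⊆ ⊆∪) eq)
      where
      open Insert J e
    ... | inj₂ (¬spans , eq) = inj₂ (¬spans , trans (rank-cong ∪⊆ ⊆∪) eq)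
      where
      open Insert J e

-- Cycles, forests and spanning

module Cycles {n m : ℕ} (ends : Fin m → Fin n × Fin n) where
  open ≡ using (refl; sym; trans; cong; subst)
  open import Relation.Binary.Construct.Closure.ReflexiveTransitive using (ε; _◅_)
  open import Relation.Binary.Construct.Closure.Symmetric using (fwd; bwd)
  open import Data.List using (lookup)
  import Data.List.Membership.Propositional.Properties as ListMembership
  open import Data.Vec using (_∷ʳ_)
  open import Data.Vec.Membership.Propositional using (_∈_; _∉_)
  open import Data.Vec.Membership.Propositional.Properties using (∈-lookup)
  open import Data.Vec.Relation.Unary.All as All using (All; []; _∷_)
  open import Data.Vec.Relation.Unary.All.Properties using (lookup⁺)
  open import Data.Vec.Relation.Unary.AllPairs using ([]; _∷_)
  open import Data.Vec.Relation.Unary.Any as Any using (here; there)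
  open import Data.Vec.Relation.Unary.Unique.Propositional using (Unique)
  open Connectivity {n}
  open GraphicRank {n}

  -- A walk through the listed vertices (after its starting point) and edges.
  data Walk (A : Subset m) : ∀ {k} → Fin n → Vec (Fin n) k → Vec (Fin m) k → Fin n → Set where
    []   : ∀ {a} → Walk A a [] [] a
    step : ∀ {k a b c e} {vs : Vec (Fin n) k} {es} → e ∈ˢ A → Joins ends e a b →
           Walk A b vs es c → Walk A a (b ∷ vs) (e ∷ es) c

  SimplePath : Subset m → Fin n → Fin n → Set
  SimplePath A a b = ∃ λ k → ∃ λ (vs : Vec (Fin n) k) → ∃ λ es →
    Walk A a vs es b × Unique (a ∷ vs) × Unique es

  suffix : ∀ {A k a b x} {vs : Vec (Fin n) k} {es} → Walk A a vs es b → Unique (a ∷ vs) → Unique es →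
           x ∈ a ∷ vs → SimplePath A x b
  suffix walk uniqᵥ uniqₑ (here refl) = _ , _ , _ , walk , uniqᵥ , uniqₑ
  suffix (step _ _ walk) (_ ∷ uniqᵥ) (_ ∷ uniqₑ) (there x∈) = suffix walk uniqᵥ uniqₑ x∈

  endpoint-visited : ∀ {A k a b e x y} {vs : Vec (Fin n) k} {es} → Walk A a vs es b → e ∈ es →
                     Joins ends e x y → x ∈ a ∷ vs
  endpoint-visited (step _ (inj₁ eq) walk) (here refl) (inj₁ eq′) = here (cong proj₁ (trans (sym eq′) eq))
  endpoint-visited (step _ (inj₁ eq) walk) (here refl) (inj₂ eq′) = there (here (cong proj₂ (trans (sym eq′) eq)))
  endpoint-visited (step _ (inj₂ eq) walk) (here refl) (inj₁ eq′) = there (here (cong proj₁ (trans (sym eq′) eq)))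
  endpoint-visited (step _ (inj₂ eq) walk) (here refl) (inj₂ eq′) = here (cong proj₂ (trans (sym eq′) eq))
  endpoint-visited (step _ _ walk) (there e∈) joins = there (endpoint-visited walk e∈ joins)

  ∉⇒All≢ : ∀ {A : Set} {k} {x : A} (xs : Vec A k) → x ∉ xs → All (x ≢_) xs
  ∉⇒All≢ []       x∉ = []
  ∉⇒All≢ (y ∷ xs) x∉ = (x∉ ∘ here) ∷ ∉⇒All≢ xs (x∉ ∘ there)

  -- If the new start already occurs on the path, the path is cut back to begin there. Otherwise the
  -- new edge cannot occur on the path, because its end a would have been visited.
  prepend : ∀ {A a b c e} → e ∈ˢ A → Joins ends e a b → SimplePath A b c → SimplePath A a c
  prepend {a = a} {b} e∈A joins (k , vs , es , walk , uniqᵥ , uniqₑ) with Any.any? (a Fin.≟_) (b ∷ vs)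
  ... | yes a∈ = suffix walk uniqᵥ uniqₑ a∈
  ... | no a∉  = suc k , b ∷ vs , _ ∷ es , step e∈A joins walk , ∉⇒All≢ _ a∉ ∷ uniqᵥ
               , ∉⇒All≢ es (λ e∈ → a∉ (endpoint-visited walk e∈ joins)) ∷ uniqₑ

  simplePath : ∀ {A} a b → Joined (select ends A) (a , b) → SimplePath A a b
  simplePath {A} a b (joined path) = go path
    where
    go : ∀ {a b} → Connected (lookup (select ends A)) a b → SimplePath A a b
    go ε = 0 , [] , [] , [] , [] ∷ [] , []
    go (fwd (i , eq) ◅ path) with ∈-select⁻ ends A (ListMembership.∈-lookup i)
    ... | e , e∈A , eq′ = prepend e∈A (inj₁ (trans eq′ eq)) (go path)
    go (bwd (i , eq) ◅ path) with ∈-select⁻ ends A (ListMembership.∈-lookup i)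
    ... | e , e∈A , eq′ = prepend e∈A (inj₂ (trans eq′ eq)) (go path)

  All-∷ʳ : ∀ {A : Set} {P : A → Set} {k x} {xs : Vec A k} → All P xs → P x → All P (xs ∷ʳ x)
  All-∷ʳ []         px = px ∷ []
  All-∷ʳ (py ∷ pys) px = py ∷ All-∷ʳ pys px

  Unique-∷ʳ : ∀ {A : Set} {k} {x : A} {xs : Vec A k} → Unique xs → All (_≢ x) xs → Unique (xs ∷ʳ x)
  Unique-∷ʳ []           []           = [] ∷ []
  Unique-∷ʳ (y≢ ∷ uniq) (y≢x ∷ xs≢x) = All-∷ʳ y≢ y≢x ∷ Unique-∷ʳ uniq xs≢x

  walk-joins : ∀ {A k a b c f} {vs : Vec (Fin n) k} {es} → Walk A a vs es b → Joins ends f b c →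
    ∀ i → Joins ends (Vec.lookup (es ∷ʳ f) i) (Vec.lookup (a ∷ vs) i) (Vec.lookup (vs ∷ʳ c) i)
  walk-joins []                  last zero    = last
  walk-joins (step _ joins walk) last zero    = joins
  walk-joins (step _ joins walk) last (suc i) = walk-joins walk last i

  walk-edges : ∀ {A k a b} {vs : Vec (Fin n) k} {es} → Walk A a vs es b → All (_∈ˢ A) es
  walk-edges []               = []
  walk-edges (step e∈ _ walk) = e∈ ∷ walk-edges walk

  joins-walk : ∀ {A k a b} (vs : Vec (Fin n) k) (es : Vec (Fin m) (suc k)) →
    (∀ i → Joins ends (Vec.lookup es i) (Vec.lookup (a ∷ vs) i) (Vec.lookup (vs ∷ʳ b) i)) →
    (∀ i → Vec.lookup es i ∈ˢ A) → Walk A a (vs ∷ʳ b) es b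
  joins-walk []       (e ∷ []) joins ∈A = step (∈A zero) (joins zero) []
  joins-walk (v ∷ vs) (e ∷ es) joins ∈A = step (∈A zero) (joins zero) (joins-walk vs es (joins ∘ suc) (∈A ∘ suc))

  spans-joins : ∀ A {e a b} → Joins ends e a b → Spans ends A e → Joined (select ends A) (a , b)
  spans-joins A (inj₁ eq) spans = subst (Joined (select ends A)) eq spans
  spans-joins A (inj₂ eq) spans = symmetric (subst (Joined (select ends A)) eq spans)

  joined-spans : ∀ A {e a b} → Joins ends e a b → Joined (select ends A) (a , b) → Spans ends A e
  joined-spans A (inj₁ eq) path = subst (Joined (select ends A)) (sym eq) path
  joined-spans A (inj₂ eq) path = subst (Joined (select ends A)) (sym eq) (symmetric path)

  walk-connects : ∀ {A B k a b} {vs : Vec (Fin n) k} {es} → Walk B a vs es b → All (_∈ˢ A) es →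
                  Joined (select ends A) (a , b)
  walk-connects {A} []                  []          = joined ε
  walk-connects {A} (step _ joins walk) (e∈A ∷ es∈) =
    transitive (spans-joins A joins (∈⇒Joined (∈-select⁺ ends e∈A))) (walk-connects walk es∈)

  -- The `Joined` hypothesis stores the part of a closed walk traversed so far, as a connection
  -- within A between the current vertex and the end of the walk. When e is reached, this part and
  -- the rest of the walk join the ends of e the other way round.
  removed-edge-spanned : ∀ {A B k a b e} {vs : Vec (Fin n) k} {es} → Walk B a vs es b → Unique es →
    (∀ {f} → f ∈ˢ B → f ≢ e → f ∈ˢ A) → e ∈ es → Joined (select ends A) (a , b) → Spans ends A e
  removed-edge-spanned {A} (step {e = e} _ joins walk) (e≢ ∷ _) B-e⊆A (here refl) path =
    joined-spans A joins (transitive path (symmetric (walk-connects walk (All.map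
      (λ (e≢f , f∈B) → B-e⊆A f∈B (e≢f ∘ sym)) (All.zip (e≢ , walk-edges walk))))))
  removed-edge-spanned {A} {e = e} (step {e = f} f∈B joins walk) (f≢ ∷ uniq) B-e⊆A (there e∈es) path =
    removed-edge-spanned walk uniq B-e⊆A e∈es
      (transitive (symmetric (spans-joins A joins (∈⇒Joined (∈-select⁺ ends (B-e⊆A f∈B (All.lookup f≢ e∈es)))))) path)

  -- Phrased by spanning instead of cycles, so that it restricts along the recursion in
  -- `forest-rank`; `close-cycle` obtains it from acyclicity.
  Forest : Subset m → Set
  Forest A = ∀ {e B} → e ∈ˢ A → B ⊆ A → e ∉ˢ B → ¬ Spans ends B e

  close-cycle : ∀ {A B e} → e ∈ˢ A → B ⊆ A → e ∉ˢ B → Spans ends B e →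
    ∃ λ k → ∃ λ (vs : Vec (Fin n) (suc k)) → ∃ λ es → IsCycle ends vs es × (∀ i → Vec.lookup es i ∈ˢ A)
  close-cycle {A} {B} {e} e∈A B⊆A e∉B spans with simplePath (proj₁ (ends e)) (proj₂ (ends e)) spans
  ... | k , vs , es , walk , uniqᵥ , uniqₑ = k , proj₁ (ends e) ∷ vs , es ∷ʳ e
      , (uniqᵥ , Unique-∷ʳ uniqₑ (All.map (λ { f∈B refl → e∉B f∈B }) (walk-edges walk))
              , walk-joins walk (inj₂ refl))
      , lookup⁺ (All-∷ʳ (All.map B⊆A (walk-edges walk)) e∈A)

  cycle-spans : ∀ {A B e k} (vs : Vec (Fin n) (suc k)) es → IsCycle ends vs es → (∀ i → Vec.lookup es i ∈ˢ B) →
    (∀ {f} → f ∈ˢ B → f ≢ e → f ∈ˢ A) → ¬ (∀ i → Vec.lookup es i ∈ˢ A) → Spans ends A e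
  cycle-spans {A} {B} {e} (v ∷ vs) es (_ , uniq , joins) es⊆B B-e⊆A es⊈A =
    removed-edge-spanned (joins-walk vs es joins es⊆B) uniq B-e⊆A e∈es (joined ε)
    where
    e∈es : e ∈ es
    e∈es with Any.any? (e Fin.≟_) es
    ... | yes e∈ = e∈
    ... | no e∉  = ⊥-elim (es⊈A λ i → B-e⊆A (es⊆B i) λ eq → e∉ (subst (_∈ es) eq (∈-lookup i es)))

module _ {n : ℕ} where
  open ≡ using (trans; cong)
  open Connectivity {n}
  open GraphicRank {n}
  open Cycles

  -- Each edge of the forest raises the rank, as the edges after it form a subset that does not span
  -- it.
  forest-rank : ∀ {m} (ends : Fin m → Fin n × Fin n) A → Forest ends A → ρ ends A ≡ ∣ A ∣
  forest-rank ends []            _      = rank-[]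
  forest-rank ends (outside ∷ A) forest = forest-rank (ends ∘ suc) A
    λ {e} {B} e∈A B⊆A e∉B → forest {suc e} {outside ∷ B} (there e∈A) (λ { (there f∈) → there (B⊆A f∈) })
      (λ { (there e∈) → e∉B e∈ })
  forest-rank ends (inside ∷ A)  forest with rank-∷ (ends zero) (select (ends ∘ suc) A)
  ... | inj₂ (_ , eq)    = trans eq (cong suc (forest-rank (ends ∘ suc) A
    λ {e} {B} e∈A B⊆A e∉B → forest {suc e} {outside ∷ B} (there e∈A) (λ { (there f∈) → there (B⊆A f∈) })
      (λ { (there e∈) → e∉B e∈ })))
  ... | inj₁ (spans , _) = ⊥-elim (forest {zero} {outside ∷ A} here (λ { (there f∈) → there f∈ }) (λ ()) spans)

module RankOfGraph (G : Graph) where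
  open ≡ using (sym; trans; cong; subst)
  import Data.List.Membership.Propositional.Properties as ListMembership
  open Graph G
  open Connectivity {v}
  open GraphicRank {v}
  open Cycles ends

  -- A maximal acyclic A spans F: a further edge e of F must close a cycle by maximality, and the
  -- remainder of this cycle joins the ends of e inside A.
  r≡ρ : ∀ F → r G F ≡ ρ ends F
  r≡ρ F with maximalAcyclic G F
  ... | A , maximalA = trans (sym (forest-rank ends A forest))
                             (ℕ.≤-antisym (ρ-mono ends subset) (ρ-spanned ends {A} {F} spanned))
    where
    open MaximalAcyclic maximalA
    forest : Forest A
    forest e∈A B⊆A e∉B spans = acyclic (close-cycle e∈A B⊆A e∉B spans)
    spanned : ∀ {e} → e ∈ˢ F → Spans ends A e
    spanned {e} e∈F with e ∈? A
    ... | yes e∈A = ∈⇒Joined (∈-select⁺ ends e∈A)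
    ... | no e∉A with hasCycle? G (A ∪ ⁅ e ⁆)
    ...   | yes (k , vs , es , cycle , es⊆) = cycle-spans vs es cycle es⊆
              (λ f∈ f≢e → [ id , (λ f∈e → ⊥-elim (f≢e (x∈⁅y⁆⇒x≡y e f∈e))) ]′ (x∈p∪q⁻ A ⁅ e ⁆ f∈))
              (λ es⊆A → acyclic (k , vs , es , cycle , es⊆A))
    ...   | no acyclic′ = ⊥-elim (maximal (A ∪ ⁅ e ⁆)
              (λ f∈ → [ subset , (λ f∈e → subst (_∈ˢ F) (sym (x∈⁅y⁆⇒x≡y e f∈e)) e∈F) ]′ (x∈p∪q⁻ A ⁅ e ⁆ f∈))
              acyclic′
              (p⊆p∪q ⁅ e ⁆ , e , x∈p∪q⁺ {p = A} (inj₂ (x∈⁅x⁆ e)) , e∉A))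

  v∸c≡ρ : v ∸ c G ≡ ρ ends ⊤
  v∸c≡ρ = cong (v ∸_) (ℕ.≤-antisym
    (components-antitone (proj₂ (components-of all)) (proj₂ (components size ends)) λ path → path⇒ (joined path))
    (components-antitone (proj₂ (components size ends)) (proj₂ (components-of all))
      (EqC.gfold (EqC.isEquivalence _) id λ (e , eq) → connected (subst (Joined all) eq (∈⇒Joined (∈-select⁺ ends ∈⊤))))))
    where
    all : Edges
    all = select ends ⊤
    path⇒ : ∀ {a b} → Joined all (a , b) → Connected ends a b
    path⇒ (joined path) = EqC.gfold (EqC.isEquivalence _) id
      (λ (i , eq) → let (e , _ , eq′) = ∈-select⁻ ends ⊤ (ListMembership.∈-lookup i) in EqC.return (e , trans eq′ eq)) path

-- The specialized Tutte polynomial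

module Fractions where
  open ≡ using (subst)
  open PolynomialRing
  open RingSolver ℤ[q]-commutativeRing
  open CommutativeRing ℤ[q]-commutativeRing using (setoid; rawRing; semiring)
  open Algebra.Properties.Semiring.Exp semiring using (_^_; ^-homo-*)
  open ℚ⟨q⟩
  private
    module Q = RawRing ℚ⟨q⟩-rawRing
  open RawSemiringDefs Q.rawSemiring using () renaming (_^_ to _^𝕢_)

  -- The fraction z equals A / u.
  record Represents (u : ℤ[q]) (z : ℚ⟨q⟩) (A : ℤ[q]) : Set where
    constructor represents
    field cross : numerator z *ₚ u ≃ₚ A *ₚ denominator z
  open Represents public

  represents-cong : ∀ {u u′ z A A′} → u ≃ₚ u′ → A ≃ₚ A′ → Represents u z A → Represents u′ z A′
  represents-cong {z = z} u≃u′ A≃A′ (represents eq) = represents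
    (≃-trans (*-congʳ (numerator z) (≃-sym u≃u′)) (≃-trans eq (*-cong A≃A′ ≃-refl)))

  represents-* : ∀ {u u′ z z′ A A′} → Represents u z A → Represents u′ z′ A′ →
                 Represents (u *ₚ u′) (z Q.* z′) (A *ₚ A′)
  represents-* {u} {u′} {fraction a b _} {fraction a′ b′ _} {A} {A′} (represents eq) (represents eq′) = represents
    (≃-trans (shuffle a a′ u u′) (≃-trans (*-cong eq eq′) (shuffle A b A′ b′)))
    where
    shuffle : ∀ a a′ u u′ → (a *ₚ a′) *ₚ (u *ₚ u′) ≃ₚ (a *ₚ u) *ₚ (a′ *ₚ u′)
    shuffle = solve 4 (λ a a′ u u′ → (a :* a′) :* (u :* u′) := (a :* u) :* (a′ :* u′)) ≃-refl

  represents-+ : ∀ {u z z′ A A′} → Represents u z A → Represents u z′ A′ → Represents u (z Q.+ z′) (A +ₚ A′)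
  represents-+ {u} {fraction a b _} {fraction a′ b′ _} {A} {A′} (represents eq) (represents eq′) = represents
    (≃-trans (separate a b′ a′ b u) (≃-trans (+-cong (*-cong eq (≃-refl {b′})) (*-cong eq′ (≃-refl {b})))
      (gather A b b′ A′)))
    where
    separate : ∀ a b′ a′ b u → (a *ₚ b′ +ₚ a′ *ₚ b) *ₚ u ≃ₚ (a *ₚ u) *ₚ b′ +ₚ (a′ *ₚ u) *ₚ b
    separate = solve 5 (λ a b′ a′ b u → (a :* b′ :+ a′ :* b) :* u := (a :* u) :* b′ :+ (a′ :* u) :* b) ≃-refl
    gather : ∀ A b b′ A′ → (A *ₚ b) *ₚ b′ +ₚ (A′ *ₚ b′) *ₚ b ≃ₚ (A +ₚ A′) *ₚ (b *ₚ b′)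
    gather = solve 4 (λ A b b′ A′ → (A :* b) :* b′ :+ (A′ :* b′) :* b := (A :+ A′) :* (b :* b′)) ≃-refl

  represents-scale : ∀ {u z A} v → Represents u z A → Represents (u *ₚ v) z (A *ₚ v)
  represents-scale {u} {fraction a b _} {A} v (represents eq) = represents
    (≃-trans (≃-sym (*-assoc a u v)) (≃-trans (*-cong eq (≃-refl {v})) (rearrange A b v)))
    where
    rearrange : ∀ A b v → (A *ₚ b) *ₚ v ≃ₚ (A *ₚ v) *ₚ b
    rearrange = solve 3 (λ A b v → (A :* b) :* v := (A :* v) :* b) ≃-refl

  represents-poly : ∀ p → Represents 1ₚ (fromPoly p) p
  represents-poly p = represents ≃-refl

  represents-^ : ∀ {u z A} → Represents u z A → ∀ n → Represents (u ^ n) (z ^𝕢 n) (A ^ n)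
  represents-^ R zero    = represents ≃-refl
  represents-^ R (suc n) = represents-* R (represents-^ R n)

  represents-sum : ∀ {u m} {f : Subset m → ℚ⟨q⟩} {g : Subset m → ℤ[q]} → (∀ F → Represents u (f F) (g F)) →
                   Represents u (Tutte.sumSubsets ℚ⟨q⟩-rawRing f) (Tutte.sumSubsets rawRing g)
  represents-sum {m = zero}  R = R []
  represents-sum {m = suc m} R = represents-+ (represents-sum (R ∘ (outside ∷_))) (represents-sum (R ∘ (inside ∷_)))

  ^-≉0 : ∀ {p} → p ≉ₚ 0ₚ → ∀ n → p ^ n ≉ₚ 0ₚ
  ^-≉0 p≉0 zero    = 1ₚ≉0
  ^-≉0 {p} p≉0 (suc n) = *ₚ-≉0 p (p ^ n) p≉0 (^-≉0 p≉0 n)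

  1^ : ∀ n → 1ₚ ^ n ≃ₚ 1ₚ
  1^ zero    = ≃-refl
  1^ (suc n) = ≃-trans (*-identityˡ _) (1^ n)

  ^-split : ∀ p {m n} → m ≤ n → p ^ (n ∸ m) *ₚ p ^ m ≃ₚ p ^ n
  ^-split p {m} {n} m≤n = ≃-trans (≃-sym (^-homo-* p (n ∸ m) m)) (subst (λ k → p ^ (n ∸ m ℕ.+ m) ≃ₚ p ^ k) (ℕ.m∸n+n≡m m≤n) ≃-refl)

module SumSubsets where
  open ≡ using (refl; trans; cong₂; subst)
  open PolynomialRing
  open CommutativeRing ℤ[q]-commutativeRing using (rawRing)
  open Tutte rawRing using () renaming (sumSubsets to sumₚ)
  open Tutte ℤ.+-*-rawRing using () renaming (sumSubsets to sumᶻ)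

  coeff-sum : ∀ {m} (g : Subset m → ℤ[q]) i → coeff (sumₚ g) i ≡ sumᶻ (λ F → coeff (g F) i)
  coeff-sum {zero}  g i = refl
  coeff-sum {suc m} g i = trans (coeff-+ (sumₚ (g ∘ (outside ∷_))) (sumₚ (g ∘ (inside ∷_))) i)
                                (cong₂ ℤ._+_ (coeff-sum (g ∘ (outside ∷_)) i) (coeff-sum (g ∘ (inside ∷_)) i))

  sum-zero : ∀ {m} (f : Subset m → ℤ) → (∀ F → f F ≡ 0ℤ) → sumᶻ f ≡ 0ℤ
  sum-zero {zero}  f f≡0 = f≡0 []
  sum-zero {suc m} f f≡0 = cong₂ ℤ._+_ (sum-zero _ (f≡0 ∘ (outside ∷_))) (sum-zero _ (f≡0 ∘ (inside ∷_)))

  sum-⊥ : ∀ {m} (f : Subset m → ℤ) → (∀ F → Nonempty F → f F ≡ 0ℤ) → sumᶻ f ≡ f ⊥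
  sum-⊥ {zero}  f f≡0 = refl
  sum-⊥ {suc m} f f≡0 = trans
    (cong₂ ℤ._+_ (sum-⊥ (f ∘ (outside ∷_)) λ F (e , e∈F) → f≡0 (outside ∷ F) (_ , there e∈F))
                 (sum-zero (f ∘ (inside ∷_)) λ F → f≡0 (inside ∷ F) (_ , here)))
    (ℤ.+-identityʳ _)

  0≤sum : ∀ {m} (f : Subset m → ℤ) → (∀ F → 0ℤ ℤ.≤ f F) → 0ℤ ℤ.≤ sumᶻ f
  0≤sum {zero}  f 0≤f = 0≤f []
  0≤sum {suc m} f 0≤f = 0≤+ (0≤sum _ (0≤f ∘ (outside ∷_))) (0≤sum _ (0≤f ∘ (inside ∷_)))

  term≤sum : ∀ {m} (f : Subset m → ℤ) → (∀ F → 0ℤ ℤ.≤ f F) → ∀ F → f F ℤ.≤ sumᶻ f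
  term≤sum {zero}  f 0≤f []            = ℤ.≤-refl
  term≤sum {suc m} f 0≤f (outside ∷ F) = subst (ℤ._≤ sumᶻ f) (ℤ.+-identityʳ _)
    (ℤ.+-mono-≤ (term≤sum (f ∘ (outside ∷_)) (0≤f ∘ (outside ∷_)) F) (0≤sum (f ∘ (inside ∷_)) (0≤f ∘ (inside ∷_))))
  term≤sum {suc m} f 0≤f (inside ∷ F)  = subst (ℤ._≤ sumᶻ f) (ℤ.+-identityˡ _)
    (ℤ.+-mono-≤ (0≤sum (f ∘ (outside ∷_)) (0≤f ∘ (outside ∷_))) (term≤sum (f ∘ (inside ∷_)) (0≤f ∘ (inside ∷_)) F))

  two-terms≤sum : ∀ {m} (f : Subset m → ℤ) → (∀ F → 0ℤ ℤ.≤ f F) → ∀ F → Nonempty F → f ⊥ ℤ.+ f F ℤ.≤ sumᶻ f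
  two-terms≤sum {suc m} f 0≤f (inside ∷ F)  _ =
    ℤ.+-mono-≤ (term≤sum (f ∘ (outside ∷_)) (0≤f ∘ (outside ∷_)) ⊥) (term≤sum (f ∘ (inside ∷_)) (0≤f ∘ (inside ∷_)) F)
  two-terms≤sum {suc m} f 0≤f (outside ∷ F) (_ , there e∈F) = subst (ℤ._≤ sumᶻ f) (ℤ.+-identityʳ _)
    (ℤ.+-mono-≤ (two-terms≤sum (f ∘ (outside ∷_)) (0≤f ∘ (outside ∷_)) F (_ , e∈F))
                (0≤sum (f ∘ (inside ∷_)) (0≤f ∘ (inside ∷_))))

-- The rank is a parameter: the expansion of the Tutte polynomial supplies `r`, the forest arguments
-- supply `ρ`.
Sparse : ∀ {m} → (Subset m → ℕ) → ℕ → Set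
Sparse rk d = ∀ F → Nonempty F → (d ∸ 1) ℕ.* ∣ F ∣ < d ℕ.* rk F

module Identities (R : CommutativeRing 0ℓ 0ℓ) where
  open CommutativeRing R using (_≈_; _+_; _*_; -_; 1#; *-identityʳ; *-cong; +-cong; +-congˡ; ring)
    renaming (refl to ≈-refl; sym to ≈-sym; trans to ≈-trans)
  open RingSolver R
  open Algebra.Properties.Ring ring using (-1*x≈-x)

  X-1-cross : ∀ x y D → (x * 1# + y * D) * D ≈ (x + y * D) * (D * 1#)
  X-1-cross x y D = *-cong (+-cong (*-identityʳ x) ≈-refl) (≈-sym (*-identityʳ D))

  Y-1-cross : ∀ y → (y * 1# + - 1# * 1#) * 1# ≈ (y + - 1#) * (1# * 1#)
  Y-1-cross y = *-cong (+-cong (*-identityʳ y) (*-identityʳ (- 1#))) (≈-sym (*-identityʳ 1#))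

  -- For y = [d] and t = q [d] this is [d+1] = [2] [d] - ([d] - 1), which explains the first
  -- argument of the Tutte polynomial.
  S-expansion : ∀ y t → t + 1# ≈ (y + t) + - 1# * (y + - 1#)
  S-expansion y t = ≈-trans (cancel y t 1#) (+-congˡ (≈-sym (-1*x≈-x (y + - 1#))))
    where
    cancel : ∀ y t o → t + o ≈ (y + t) + - (y + - o)
    cancel = solve 3 (λ y t o → t :+ o := (y :+ t) :+ :- (y :+ :- o)) ≈-refl

-- The denominator of X is Y - 1 itself, so X - 1 = S / D with D = Y - 1. After multiplication by D
-- ^ rE the summand of F contains D to the power rE - (rE - rk F) + (∣F∣ - rk F) = ∣F∣, and no
-- denominator remains.
module Expansion {m} (rk : Subset m → ℕ) (rE : ℕ) (rk≤rE : ∀ F → rk F ≤ rE) (rk≤∣∣ : ∀ F → rk F ≤ ∣ F ∣)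
                 (N Y : ℤ[q]) (Y-1≉0 : Y -ₚ 1ₚ ≉ₚ 0ₚ) (d : ℕ)
                 (monic-D : PolynomialRing.NonnegativeMonic (d ∸ 1) (Y -ₚ 1ₚ))
                 (monic-S : PolynomialRing.NonnegativeMonic d (N +ₚ negₚ 1ₚ *ₚ (Y -ₚ 1ₚ))) where
  open ≡ using (refl; sym; trans; cong; cong₂; subst; subst₂)
  open PolynomialRing
  open Fractions
  open SumSubsets
  open RingSolver ℤ[q]-commutativeRing using (solve; _:=_; _:*_)
  open Identities ℤ[q]-commutativeRing
  open CommutativeRing ℤ[q]-commutativeRing using (rawRing; semiring)
  open Algebra.Properties.Semiring.Exp semiring using (_^_)
  private
    module Q = RawRing ℚ⟨q⟩-rawRing
  open RawSemiringDefs Q.rawSemiring using () renaming (_^_ to _^𝕢_)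

  D S : ℤ[q]
  D = Y -ₚ 1ₚ
  S = N +ₚ negₚ 1ₚ *ₚ D

  X : ℚ⟨q⟩
  X = fraction N D Y-1≉0

  term : Subset m → ℤ[q]
  term F = S ^ (rE ∸ rk F) *ₚ D ^ ∣ F ∣

  A : ℤ[q]
  A = Tutte.sumSubsets rawRing term

  rankGenerating : ℚ⟨q⟩
  rankGenerating = Tutte.sumSubsets ℚ⟨q⟩-rawRing λ F →
    (X Q.+ Q.- Q.1#) ^𝕢 (rE ∸ rk F) Q.* (fromPoly Y Q.+ Q.- Q.1#) ^𝕢 (∣ F ∣ ∸ rk F)

  z : ℚ⟨q⟩
  z = fromPoly D ^𝕢 rE Q.* rankGenerating

  represents-X-1 : Represents D (X Q.+ Q.- Q.1#) S
  represents-X-1 = represents (X-1-cross N (negₚ 1ₚ) D)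

  represents-Y-1 : Represents 1ₚ (fromPoly Y Q.+ Q.- Q.1#) D
  represents-Y-1 = represents (Y-1-cross Y)

  represents-rankGenerating : Represents (D ^ rE) rankGenerating A
  represents-rankGenerating = represents-sum λ F → represents-cong (denominators F) (numerators F)
    -- The summand of F comes with denominator D ^ (rE ∸ rk F); this factor brings it to the common
    -- denominator D ^ rE.
    (represents-scale (D ^ rk F)
      (represents-* (represents-^ represents-X-1 (rE ∸ rk F)) (represents-^ represents-Y-1 (∣ F ∣ ∸ rk F))))
    where
    denominators : ∀ F → D ^ (rE ∸ rk F) *ₚ 1ₚ ^ (∣ F ∣ ∸ rk F) *ₚ D ^ rk F ≃ₚ D ^ rE
    denominators F = ≃-trans (*-cong (≃-trans (*-congʳ (D ^ (rE ∸ rk F)) (1^ (∣ F ∣ ∸ rk F)))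
        (≃-trans (*-comm (D ^ (rE ∸ rk F)) 1ₚ) (*-identityˡ _))) ≃-refl) (^-split D (rk≤rE F))
    numerators : ∀ F → S ^ (rE ∸ rk F) *ₚ D ^ (∣ F ∣ ∸ rk F) *ₚ D ^ rk F ≃ₚ term F
    numerators F = ≃-trans (*-assoc (S ^ (rE ∸ rk F)) (D ^ (∣ F ∣ ∸ rk F)) (D ^ rk F))
      (*-congʳ (S ^ (rE ∸ rk F)) (^-split D (rk≤∣∣ F)))

  z≈A : z ≈𝕢 fromPoly A
  z≈A = coeff-≡ {ℚ⟨q⟩.numerator z *ₚ 1ₚ} {A *ₚ ℚ⟨q⟩.denominator z} (*-cancelʳ (D ^ rE) _ _ (^-≉0 Y-1≉0 rE)
    (≃-trans (*-assoc (ℚ⟨q⟩.numerator z) 1ₚ (D ^ rE)) (≃-trans (*-congʳ (ℚ⟨q⟩.numerator z) (*-cong (≃-sym (1^ rE)) ≃-refl))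
      (≃-trans (cross full) (rearrange (D ^ rE) A (ℚ⟨q⟩.denominator z))))))
    where
    full : Represents (1ₚ ^ rE *ₚ D ^ rE) z (D ^ rE *ₚ A)
    full = represents-* (represents-^ (represents-poly D) rE) represents-rankGenerating
    rearrange : ∀ x y w → (x *ₚ y) *ₚ w ≃ₚ (y *ₚ w) *ₚ x
    rearrange = solve 3 (λ x y w → (x :* y) :* w := (y :* w) :* x) ≃-refl

  z-unique : ∀ P → z ≈𝕢 fromPoly P → P ≃ₚ A
  z-unique P eq = *-cancelʳ (ℚ⟨q⟩.denominator z) P A (ℚ⟨q⟩.denominator≉0 z)
    (≃-trans (≃-sym (equal {ℚ⟨q⟩.numerator z *ₚ 1ₚ} {P *ₚ ℚ⟨q⟩.denominator z} eq)) (equal z≈A))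

  degree : Subset m → ℕ
  degree F = (rE ∸ rk F) ℕ.* d ℕ.+ ∣ F ∣ ℕ.* (d ∸ 1)

  monic-term : ∀ F → NonnegativeMonic (degree F) (term F)
  monic-term F = monic-* (monic-^ monic-S (rE ∸ rk F)) (monic-^ monic-D ∣ F ∣)

  full-degree : ∀ F → (rE ∸ rk F) ℕ.* d ℕ.+ d ℕ.* rk F ≡ d ℕ.* rE
  full-degree F = trans (cong ((rE ∸ rk F) ℕ.* d ℕ.+_) (ℕ.*-comm d (rk F)))
    (trans (sym (ℕ.*-distribʳ-+ d (rE ∸ rk F) (rk F))) (trans (cong (ℕ._* d) (ℕ.m∸n+n≡m (rk≤rE F))) (ℕ.*-comm rE d)))

  degree-⊥ : degree ⊥ ≡ d ℕ.* rE
  degree-⊥ = trans (cong₂ (λ k s → (rE ∸ k) ℕ.* d ℕ.+ s ℕ.* (d ∸ 1)) (ℕ.n≤0⇒n≡0 (subst (rk ⊥ ≤_) (∣⊥∣≡0 m) (rk≤∣∣ ⊥))) (∣⊥∣≡0 m))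
    (trans (ℕ.+-identityʳ _) (ℕ.*-comm rE d))

  term-nonnegative : ∀ i F → 0ℤ ℤ.≤ coeff (term F) i
  term-nonnegative i F = nonnegative (monic-term F) i

  leading-⊥ : coeff (term ⊥) (d ℕ.* rE) ≡ 1ℤ
  leading-⊥ = subst (λ k → coeff (term ⊥) k ≡ 1ℤ) degree-⊥ (leading (monic-term ⊥))

  -- A set F that is not sparse has a term of degree at least d rE. If the degree is larger, a
  -- coefficient that should vanish is at least 1; if it is equal, the terms of ∅ and F make the
  -- leading coefficient at least 2.
  monic⇒sparse : MonicOfDegree (d ℕ.* rE) A → Sparse rk d
  monic⇒sparse (lead , vanish) F F≢∅ = ℕ.+-cancelˡ-< ((rE ∸ rk F) ℕ.* d) _ _
    (subst₂ _<_ (cong ((rE ∸ rk F) ℕ.* d ℕ.+_) (ℕ.*-comm ∣ F ∣ (d ∸ 1))) (sym (full-degree F))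
      (ℕ.≰⇒> too-large))
    where
    contribution : ∀ {i} → degree F ≡ i → coeff (term F) i ≡ 1ℤ
    contribution refl = leading (monic-term F)
    too-large : ¬ d ℕ.* rE ≤ degree F
    too-large le with ℕ.m≤n⇒m<n∨m≡n le
    ... | inj₁ lt = ℤ.<⇒≱ (ℤ.+<+ (s≤s z≤n))
          (subst₂ ℤ._≤_ (contribution refl) (trans (sym (coeff-sum term (degree F))) (vanish (degree F) lt))
            (term≤sum (λ K → coeff (term K) (degree F)) (term-nonnegative (degree F)) F))
    ... | inj₂ eq = ℤ.<⇒≱ (ℤ.+<+ (s≤s (s≤s z≤n)))
          (subst₂ ℤ._≤_ (cong₂ ℤ._+_ leading-⊥ (contribution (sym eq)))
            (trans (sym (coeff-sum term (d ℕ.* rE))) lead)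
            (two-terms≤sum (λ F → coeff (term F) (d ℕ.* rE)) (term-nonnegative (d ℕ.* rE)) F F≢∅))

  sparse⇒monic : Sparse rk d → MonicOfDegree (d ℕ.* rE) A
  sparse⇒monic sparse =
      trans (coeff-sum term (d ℕ.* rE)) (trans (sum-⊥ _ λ F F≢∅ → vanishing (monic-term F) _ (small F F≢∅)) leading-⊥)
    , λ i lt → trans (coeff-sum term i) (trans (sum-⊥ _ λ F F≢∅ → vanishing (monic-term F) i (ℕ.<-trans (small F F≢∅) lt))
                 (vanishing (monic-term ⊥) i (subst (_< i) (sym degree-⊥) lt)))
    where
    small : ∀ F → Nonempty F → degree F < d ℕ.* rE
    small F F≢∅ = subst₂ _<_ (cong ((rE ∸ rk F) ℕ.* d ℕ.+_) (ℕ.*-comm (d ∸ 1) ∣ F ∣)) (full-degree F)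
      (ℕ.+-monoʳ-< ((rE ∸ rk F) ℕ.* d) (sparse F F≢∅))

  monic⇔sparse : ∀ {N} → N ≡ rE → (∃ λ P → z ≈𝕢 fromPoly P × MonicOfDegree (d ℕ.* N) P) ⇔ Sparse rk d
  monic⇔sparse refl = mk⇔
    (λ (P , eq , lead , vanish) → let P≃A = coeff-≡ (z-unique P eq) in
       monic⇒sparse (trans (sym (P≃A _)) lead , λ i lt → trans (sym (P≃A i)) (vanish i lt)))
    (λ sparse → A , z≈A , sparse⇒monic sparse)

module QuantumIntegers where
  open ≡ using (refl; sym)
  open PolynomialRing
  open Identities ℤ[q]-commutativeRing

  monic-[d]-1 : ∀ {d} → 2 ≤ d → NonnegativeMonic (d ∸ 1) ([ d ]q -ₚ 1ₚ)
  monic-[d]-1 (s≤s (s≤s {n = n} z≤n)) = monic-0∷ (monic-[] n)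

  monic-S : ∀ d → NonnegativeMonic d ([ 2 ]q *ₚ [ d ]q +ₚ negₚ 1ₚ *ₚ ([ d ]q -ₚ 1ₚ))
  monic-S d = monic-cong S≃[d+1] (monic-[] d)
    where
    S≃[d+1] : 1ℤ ∷ [ d ]q ≃ₚ [ 2 ]q *ₚ [ d ]q +ₚ negₚ 1ₚ *ₚ ([ d ]q -ₚ 1ₚ)
    S≃[d+1] = ≃-trans (equal λ { zero → refl ; (suc i) → sym (coeff-≡ (+-identityʳ [ d ]q) i) })
      (≃-trans (S-expansion [ d ]q (0ℤ ∷ [ d ]q)) (+-cong {r = negₚ 1ₚ *ₚ ([ d ]q -ₚ 1ₚ)} two-times ≃-refl))
      where
      two-times : [ d ]q +ₚ (0ℤ ∷ [ d ]q) ≃ₚ [ 2 ]q *ₚ [ d ]q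
      two-times = ≃-sym (+-cong (scale-1 [ d ]q) (∷-cong 0ℤ (*-identityˡ [ d ]q)))

module _ (G : Graph) (d : ℕ) (2≤d : 2 ≤ d) where
  open ≡ using (refl; sym; trans; subst; subst₂)
  open Graph G using (ends; v)
  open GraphicRank {v}
  open RankOfGraph G

  r≤rE : ∀ F → r G F ≤ r G ⊤
  r≤rE F = subst₂ _≤_ (sym (r≡ρ F)) (sym (r≡ρ ⊤)) (ρ-mono ends {F} {⊤} ⊆⊤)

  r≤∣∣ : ∀ F → r G F ≤ ∣ F ∣
  r≤∣∣ F = subst (_≤ ∣ F ∣) (sym (r≡ρ F)) (ρ≤∣∣ ends F)

  v∸c≡r : v ∸ c G ≡ r G ⊤
  v∸c≡r = trans v∸c≡ρ (sym (r≡ρ ⊤))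

  -- The exponent becomes a variable, so that `v ∸ c G` can be exchanged for `r G ⊤` by rewriting.
  specialization-power : ∀ k → k ≡ v ∸ c G → specialization G d 2≤d ≡
    RawRing._*_ ℚ⟨q⟩-rawRing
      (RawSemiringDefs._^_ (RawRing.rawSemiring ℚ⟨q⟩-rawRing) (fromPoly ([ d ]q -ₚ 1ₚ)) k)
      (Tutte.tutte ℚ⟨q⟩-rawRing G (fraction ([ 2 ]q *ₚ [ d ]q) ([ d ]q -ₚ 1ₚ) ([d]-1≉0 2≤d)) (fromPoly [ d ]q))
  specialization-power k refl = refl

  specialization-monic⇔sparse :
    (∃ λ P → specialization G d 2≤d ≈𝕢 fromPoly P × MonicOfDegree (d ℕ.* (v ∸ c G)) P) ⇔ Sparse (r G) d
  specialization-monic⇔sparse =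
    subst (λ s → (∃ λ P → s ≈𝕢 fromPoly P × MonicOfDegree (d ℕ.* (v ∸ c G)) P) ⇔ Sparse (r G) d)
      (sym (specialization-power (r G ⊤) (sym v∸c≡r)))
      (Expansion.monic⇔sparse (r G) (r G ⊤) r≤rE r≤∣∣ ([ 2 ]q *ₚ [ d ]q) [ d ]q ([d]-1≉0 2≤d) d
        (QuantumIntegers.monic-[d]-1 2≤d) (QuantumIntegers.monic-S d) v∸c≡r)

-- Forest coverings

module Sums where
  open ≡ using (refl; trans; cong; cong₂)
  open Algebra.Properties.Monoid.Sum ℕ.+-0-monoid using (sum; sum-cong-≗)
  open import Data.Nat using (_+_)
  sum-mono : ∀ {d} {f g : Fin d → ℕ} → (∀ i → f i ≤ g i) → sum f ≤ sum g
  sum-mono {zero}  f≤g = z≤n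
  sum-mono {suc d} f≤g = ℕ.+-mono-≤ (f≤g zero) (sum-mono (f≤g ∘ suc))

  sum-mono-< : ∀ {d} {f g : Fin d → ℕ} → (∀ i → f i ≤ g i) → ∀ i → f i < g i → sum f < sum g
  sum-mono-< f≤g zero    fi<gi = ℕ.+-mono-<-≤ fi<gi (sum-mono (f≤g ∘ suc))
  sum-mono-< f≤g (suc i) fi<gi = ℕ.+-mono-≤-< (f≤g zero) (sum-mono-< (f≤g ∘ suc) i fi<gi)

  sum-+ : ∀ {d} (f g : Fin d → ℕ) → sum (λ i → f i + g i) ≡ sum f + sum g
  sum-+ {zero}  f g = refl
  sum-+ {suc d} f g = trans (cong (f zero + g zero +_) (sum-+ (f ∘ suc) (g ∘ suc)))
                            (interchange (f zero) (g zero) (sum (f ∘ suc)) (sum (g ∘ suc)))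
    where
    interchange : ∀ a b c d → (a + b) + (c + d) ≡ (a + c) + (b + d)
    interchange = solve-∀

  sum-squeeze : ∀ {d} {f g : Fin d → ℕ} → (∀ i → f i ≤ g i) → sum g ≤ sum f → ∀ i → f i ≡ g i
  sum-squeeze f≤g Σg≤Σf i = ℕ.≤-antisym (f≤g i)
    (ℕ.≮⇒≥ λ fi<gi → ℕ.<⇒≱ (sum-mono-< f≤g i fi<gi) Σg≤Σf)

  sum-increment : ∀ {d} {f g : Fin d → ℕ} i → (∀ j → j ≢ i → g j ≡ f j) → g i ≡ suc (f i) → sum g ≡ suc (sum f)
  sum-increment zero    same bump = cong₂ _+_ bump (sum-cong-≗ λ j → same (suc j) λ ())
  sum-increment (suc i) same bump = trans
    (cong₂ _+_ (same zero λ ()) (sum-increment i (λ j j≢i → same (suc j) (j≢i ∘ Fin.suc-injective)) bump))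
    (ℕ.+-suc _ _)

  sum-const : ∀ d c → sum {d} (const c) ≡ d ℕ.* c
  sum-const zero    c = refl
  sum-const (suc d) c = cong (c +_) (sum-const d c)

module Weights where
  open ≡ using (refl; sym; trans; cong; cong₂)
  open import Data.Nat using (_+_)
  weight : ∀ {m} → (Fin m → ℕ) → Subset m → ℕ
  weight w []            = 0
  weight w (outside ∷ A) = weight (w ∘ suc) A
  weight w (inside ∷ A)  = w zero + weight (w ∘ suc) A

  weight-modular : ∀ {m} (w : Fin m → ℕ) A B → weight w (A ∪ B) + weight w (A ∩ B) ≡ weight w A + weight w B
  weight-modular w []            []            = refl
  weight-modular w (outside ∷ A) (outside ∷ B) = weight-modular (w ∘ suc) A B
  weight-modular w (outside ∷ A) (inside ∷ B)  = trans (ℕ.+-assoc (w zero) _ _)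
    (trans (cong (w zero +_) (weight-modular (w ∘ suc) A B)) (swap (w zero) (weight (w ∘ suc) A) (weight (w ∘ suc) B)))
    where
    swap : ∀ x a b → x + (a + b) ≡ a + (x + b)
    swap = solve-∀
  weight-modular w (inside ∷ A) (outside ∷ B)  = trans (ℕ.+-assoc (w zero) _ _)
    (trans (cong (w zero +_) (weight-modular (w ∘ suc) A B)) (sym (ℕ.+-assoc (w zero) _ _)))
  weight-modular w (inside ∷ A) (inside ∷ B)   =
    trans (pull (w zero) (weight (w ∘ suc) (A ∪ B)) (weight (w ∘ suc) (A ∩ B)))
      (trans (cong (λ k → w zero + (w zero + k)) (weight-modular (w ∘ suc) A B))
        (sym (pull (w zero) (weight (w ∘ suc) A) (weight (w ∘ suc) B))))
    where
    pull : ∀ x a b → x + a + (x + b) ≡ x + (x + (a + b))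
    pull = solve-∀

  weight-insert : ∀ {m} (w : Fin m → ℕ) {e A} → e ∉ˢ A → weight w (A ∪ ⁅ e ⁆) ≡ w e + weight w A
  weight-insert w {zero}  {inside ∷ A}  e∉A = ⊥-elim (e∉A here)
  weight-insert w {zero}  {outside ∷ A} e∉A = cong (λ B → w zero + weight (w ∘ suc) B) (∪-identityʳ A)
  weight-insert w {suc e} {outside ∷ A} e∉A = weight-insert (w ∘ suc) (e∉A ∘ there)
  weight-insert w {suc e} {inside ∷ A}  e∉A = trans (cong (w zero +_) (weight-insert (w ∘ suc) (e∉A ∘ there)))
    (swap (w zero) (w (suc e)) (weight (w ∘ suc) A))
    where
    swap : ∀ x a b → x + (a + b) ≡ a + (x + b)
    swap = solve-∀

  weight-cong : ∀ {m} {w w′ : Fin m → ℕ} A → (∀ {e} → e ∈ˢ A → w e ≡ w′ e) → weight w A ≡ weight w′ A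
  weight-cong []            _     = refl
  weight-cong (outside ∷ A) w≡w′ = weight-cong A (w≡w′ ∘ there)
  weight-cong (inside ∷ A)  w≡w′ = cong₂ _+_ (w≡w′ here) (weight-cong A (w≡w′ ∘ there))

  -- Written additively, so that it covers raising and lowering the weight of e without truncated
  -- subtraction.
  weight-exchange : ∀ {m} {w w′ : Fin m → ℕ} {e A} → (∀ f → f ≢ e → w′ f ≡ w f) →
                    e ∈ˢ A → weight w′ A + w e ≡ weight w A + w′ e
  weight-exchange {w = w} {w′} {A = inside ∷ A} same here =
    trans (cong (λ k → w′ zero + k + w zero) (weight-cong {w = w′ ∘ suc} {w ∘ suc} A λ _ → same _ λ ())) (swap (w′ zero) (weight (w ∘ suc) A) (w zero))
    where
    swap : ∀ a b c → a + b + c ≡ c + b + a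
    swap = solve-∀
  weight-exchange {A = outside ∷ A} same (there e∈A) =
    weight-exchange (λ f f≢e → same (suc f) (f≢e ∘ Fin.suc-injective)) e∈A
  weight-exchange {w = w} {w′} {A = inside ∷ A} same (there e∈A) = trans (ℕ.+-assoc (w′ zero) _ _)
    (trans (cong₂ _+_ (same zero λ ()) (weight-exchange (λ f f≢e → same (suc f) (f≢e ∘ Fin.suc-injective)) e∈A))
      (sym (ℕ.+-assoc (w zero) _ _)))

  weight-decrement : ∀ {m} {w w′ : Fin m → ℕ} {e A} → (∀ f → f ≢ e → w′ f ≡ w f) → suc (w′ e) ≡ w e →
                     e ∈ˢ A → suc (weight w′ A) ≡ weight w A
  weight-decrement {w = w} {w′} {e} {A} same drop e∈A = ℕ.+-cancelʳ-≡ (w′ e) _ _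
    (trans (sym (ℕ.+-suc (weight w′ A) (w′ e))) (trans (cong (weight w′ A +_) drop) (weight-exchange same e∈A)))

  weight-1 : ∀ {m} (A : Subset m) → weight (const 1) A ≡ ∣ A ∣
  weight-1 []            = refl
  weight-1 (outside ∷ A) = weight-1 A
  weight-1 (inside ∷ A)  = cong suc (weight-1 A)

  ∣∣-insert : ∀ {m} {e : Fin m} {A} → e ∉ˢ A → ∣ A ∪ ⁅ e ⁆ ∣ ≡ suc ∣ A ∣
  ∣∣-insert {e = e} {A} e∉A = trans (sym (weight-1 (A ∪ ⁅ e ⁆))) (trans (weight-insert (const 1) e∉A) (cong suc (weight-1 A)))

  bit : ∀ {m} → Subset m → Fin m → ℕ
  bit A e = if does (e ∈? A) then 1 else 0

  bit-∈ : ∀ {m} {A : Subset m} {e} → e ∈ˢ A → bit A e ≡ 1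
  bit-∈ {A = A} {e} e∈A with e ∈? A
  ... | yes _  = refl
  ... | no e∉A = ⊥-elim (e∉A e∈A)

  bit-∉ : ∀ {m} {A : Subset m} {e} → e ∉ˢ A → bit A e ≡ 0
  bit-∉ {A = A} {e} e∉A with e ∈? A
  ... | yes e∈A = ⊥-elim (e∉A e∈A)
  ... | no _    = refl

  bit≤1 : ∀ {m} (A : Subset m) e → bit A e ≤ 1
  bit≤1 A e with e ∈? A
  ... | yes _ = ℕ.≤-refl
  ... | no _  = z≤n

  bit-insert : ∀ {m} (A : Subset m) {e f} → f ≢ e → bit (A ∪ ⁅ e ⁆) f ≡ bit A f
  bit-insert A {e} {f} f≢e with f ∈? A
  ... | yes f∈A = bit-∈ (p⊆p∪q ⁅ e ⁆ f∈A)
  ... | no f∉A  = bit-∉ λ f∈ → [ f∉A , f≢e ∘ x∈⁅y⁆⇒x≡y e ]′ (x∈p∪q⁻ A ⁅ e ⁆ f∈)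

-- Nash-Williams' forest covering theorem, with an edge e to be used w e times.
-- The forests J i grow one edge at a time; adding e to J i fails exactly when
-- a tight set avoiding e spans e together with J i.  Tight sets are closed
-- under union, so if every i failed, one tight set would span e with every
-- J i, and adding e to it would violate the hypothesis.
module NashWilliams {n m : ℕ} (ends : Fin m → Fin n × Fin n) (d : ℕ) where
  open ≡ using (refl; sym; trans; cong; cong₂; subst; subst₂)
  open Algebra.Properties.Monoid.Sum ℕ.+-0-monoid using (sum; sum-cong-≗)
  open import Data.Nat using (_+_; pred)
  open Sums
  open Weights
  open GraphicRank {n}
  open Connectivity {n} using (∈⇒Joined)

  Family : Set
  Family = Fin d → Subset m

  size : Family → ℕ
  size J = sum λ i → ∣ J i ∣

  Σρ : Family → Subset m → ℕ
  Σρ J A = sum λ i → ρ ends (A ∪ J i)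

  count : Family → Fin m → ℕ
  count J e = sum λ i → bit (J i) e

  -- The invariant of the construction, w being the demand still to be met. For empty forests it is
  -- the bound of the theorem; for w = 0 and A = ∅ it says that the sizes of the J i do not exceed
  -- their ranks, so all J i are forests.
  Feasible : (Fin m → ℕ) → Family → Set
  Feasible w J = ∀ A → weight w A + size J ≤ Σρ J A

  ∪-least : ∀ {A B C : Subset m} → A ⊆ C → B ⊆ C → A ∪ B ⊆ C
  ∪-least {A} {B} A⊆C B⊆C x∈ = [ A⊆C , B⊆C ]′ (x∈p∪q⁻ A B x∈)

  module _ (w : Fin m → ℕ) (J : Family) (feasible : Feasible w J) where

    Tight : Subset m → Set
    Tight A = Σρ J A ≤ weight w A + size J

    tight-⊥ : Tight ⊥
    tight-⊥ = ℕ.≤-trans (sum-mono λ i → subst (λ A → ρ ends A ≤ ∣ J i ∣) (sym (∪-identityˡ (J i))) (ρ≤∣∣ ends (J i)))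
                        (ℕ.m≤n+m _ _)

    Σρ-submodular : ∀ A B → Σρ J (A ∪ B) + Σρ J (A ∩ B) ≤ Σρ J A + Σρ J B
    Σρ-submodular A B = subst₂ _≤_
      (sum-+ {d} (λ i → ρ ends ((A ∪ B) ∪ J i)) (λ i → ρ ends ((A ∩ B) ∪ J i)))
      (sum-+ {d} (λ i → ρ ends (A ∪ J i)) (λ i → ρ ends (B ∪ J i))) (sum-mono λ i →
      ℕ.≤-trans (ℕ.+-mono-≤
        (ρ-mono ends (∪-least (∪-least (p⊆p∪q (B ∪ J i) ∘ p⊆p∪q (J i)) (q⊆p∪q (A ∪ J i) _ ∘ p⊆p∪q (J i)))
                              (p⊆p∪q (B ∪ J i) ∘ q⊆p∪q A _)))
        (ρ-mono ends (∪-least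
          (λ x∈ → x∈p∩q⁺ (p⊆p∪q (J i) (proj₁ (x∈p∩q⁻ A B x∈)) , p⊆p∪q (J i) (proj₂ (x∈p∩q⁻ A B x∈))))
          (λ x∈ → x∈p∩q⁺ (q⊆p∪q A _ x∈ , q⊆p∪q B _ x∈)))))
        (ρ-submodular ends (A ∪ J i) (B ∪ J i)))

    -- Uncrossing: `Σρ` is submodular, `weight` is modular, and feasibility bounds `Σρ` on A ∩ B
    -- from below.
    tight-∪ : ∀ A B → Tight A → Tight B → Tight (A ∪ B)
    tight-∪ A B tightA tightB = ℕ.+-cancelʳ-≤ (weight w (A ∩ B) + size J) _ _ (begin
      Σρ J (A ∪ B) + (weight w (A ∩ B) + size J)                  ≤⟨ ℕ.+-monoʳ-≤ (Σρ J (A ∪ B)) (feasible (A ∩ B)) ⟩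
      Σρ J (A ∪ B) + Σρ J (A ∩ B)                                 ≤⟨ Σρ-submodular A B ⟩
      Σρ J A + Σρ J B                                             ≤⟨ ℕ.+-mono-≤ tightA tightB ⟩
      (weight w A + size J) + (weight w B + size J)               ≡⟨ interchange (weight w A) (weight w B) (size J) ⟩
      (weight w A + weight w B) + (size J + size J)               ≡⟨ cong (_+ (size J + size J)) (weight-modular w A B) ⟨
      (weight w (A ∪ B) + weight w (A ∩ B)) + (size J + size J)   ≡⟨ interchange (weight w (A ∪ B)) (weight w (A ∩ B)) (size J) ⟨
      (weight w (A ∪ B) + size J) + (weight w (A ∩ B) + size J)   ∎)
      where
      open ℕ.≤-Reasoning
      interchange : ∀ a b c → (a + c) + (b + c) ≡ (a + b) + (c + c)
      interchange = solve-∀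

    module _ (e : Fin m) where

      Blocking : Fin d → Subset m → Set
      Blocking i A = e ∉ˢ A × Tight A × Spans ends (A ∪ J i) e

      blocked? : ∀ i → Dec (∃ (Blocking i))
      blocked? i = anySubset? λ A → ¬? (e ∈? A) ×-dec ((_ ℕ.≤? _) ×-dec spans? ends (A ∪ J i) e)

      combine : ∀ {k} (g : Fin k → Fin d) → (∀ j → ∃ (Blocking (g j))) →
                ∃ λ A → e ∉ˢ A × Tight A × ∀ j → Spans ends (A ∪ J (g j)) e
      combine {zero}  g blocked = ⊥ , ∉⊥ , tight-⊥ , λ ()
      combine {suc k} g blocked with blocked zero | combine (g ∘ suc) (blocked ∘ suc)
      ... | A , e∉A , tightA , spansA | B , e∉B , tightB , spansB =
          A ∪ B , (λ e∈ → [ e∉A , e∉B ]′ (x∈p∪q⁻ A B e∈)) , tight-∪ A B tightA tightB , λ where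
            zero    → spans-mono ends {A ∪ J (g zero)} {_} {e} (∪-least (p⊆p∪q _ ∘ p⊆p∪q B) (q⊆p∪q (A ∪ B) _)) spansA
            (suc j) → spans-mono ends {B ∪ J (g (suc j))} {_} {e} (∪-least (p⊆p∪q _ ∘ q⊆p∪q A B) (q⊆p∪q (A ∪ B) _)) (spansB j)

      not-all-blocked : 0 < w e → ¬ (∀ i → ∃ (Blocking i))
      not-all-blocked w>0 blocked with combine id blocked
      ... | A , e∉A , tightA , spans = ℕ.<⇒≱ w>0 (ℕ.+-cancelʳ-≤ (weight w A + size J) (w e) 0 (begin
        w e + (weight w A + size J)     ≡⟨ ℕ.+-assoc (w e) _ _ ⟨
        w e + weight w A + size J       ≡⟨ cong (_+ size J) (weight-insert w e∉A) ⟨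
        weight w (A ∪ ⁅ e ⁆) + size J   ≤⟨ feasible (A ∪ ⁅ e ⁆) ⟩
        Σρ J (A ∪ ⁅ e ⁆)                ≤⟨ sum-mono (λ i → ρ-spanned ends {A ∪ J i} {(A ∪ ⁅ e ⁆) ∪ J i} (spanned i)) ⟩
        Σρ J A                          ≤⟨ tightA ⟩
        weight w A + size J             ∎))
        where
        open ℕ.≤-Reasoning
        spanned : ∀ i {f} → f ∈ˢ (A ∪ ⁅ e ⁆) ∪ J i → Spans ends (A ∪ J i) f
        spanned i f∈ with x∈p∪q⁻ (A ∪ ⁅ e ⁆) (J i) f∈
        ... | inj₂ f∈J = ∈⇒Joined (∈-select⁺ ends (q⊆p∪q A _ f∈J))
        ... | inj₁ f∈  with x∈p∪q⁻ A ⁅ e ⁆ f∈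
        ...   | inj₁ f∈A = ∈⇒Joined (∈-select⁺ ends (p⊆p∪q (J i) f∈A))
        ...   | inj₂ f∈e = subst (Spans ends (A ∪ J i)) (sym (x∈⁅y⁆⇒x≡y e f∈e)) (spans i)

      module Extend (w>0 : 0 < w e) (i : Fin d) (unblocked : ¬ ∃ (Blocking i)) where
        w′ : Fin m → ℕ
        w′ = updateAt w e pred

        J′ : Family
        J′ = updateAt J i (_∪ ⁅ e ⁆)

        w′-same : ∀ f → f ≢ e → w′ f ≡ w f
        w′-same f f≢e = updateAt-minimal f e w f≢e

        w′-drop : suc (w′ e) ≡ w e
        w′-drop = trans (cong suc (updateAt-updates e w)) (ℕ.suc-pred (w e) {{ℕ.>-nonZero w>0}})

        J′-same : ∀ j → j ≢ i → J′ j ≡ J j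
        J′-same j j≢i = updateAt-minimal j i J j≢i

        J′-insert : J′ i ≡ J i ∪ ⁅ e ⁆
        J′-insert = updateAt-updates i J

        e∉Ji : e ∉ˢ J i
        -- The empty set is tight and, together with J i, spans every edge of J i; it would block e.
        e∉Ji e∈ = unblocked (⊥ , ∉⊥ , tight-⊥ , ∈⇒Joined (∈-select⁺ ends (q⊆p∪q ⊥ _ e∈)))

        J⊆J′ : ∀ j → J j ⊆ J′ j
        J⊆J′ j with j Fin.≟ i
        ... | yes refl = subst (J i ⊆_) (sym J′-insert) (p⊆p∪q ⁅ e ⁆)
        ... | no j≢i   = subst (J j ⊆_) (sym (J′-same j j≢i)) id

        size-suc : size J′ ≡ suc (size J)
        size-suc = sum-increment i (λ j j≢i → cong ∣_∣ (J′-same j j≢i)) (trans (cong ∣_∣ J′-insert) (∣∣-insert e∉Ji))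

        count-e : count J′ e ≡ suc (count J e)
        count-e = sum-increment i (λ j j≢i → cong (λ A → bit A e) (J′-same j j≢i))
          (trans (cong (λ A → bit A e) J′-insert)
            (trans (bit-∈ {A = J i ∪ ⁅ e ⁆} (q⊆p∪q (J i) ⁅ e ⁆ (x∈⁅x⁆ e))) (cong suc (sym (bit-∉ e∉Ji)))))

        count-same : ∀ f → f ≢ e → count J′ f ≡ count J f
        count-same f f≢e = sum-cong-≗ λ j → same j
          where
          same : ∀ j → bit (J′ j) f ≡ bit (J j) f
          same j with j Fin.≟ i
          ... | yes refl = trans (cong (λ A → bit A f) J′-insert) (bit-insert (J i) f≢e)
          ... | no j≢i   = cong (λ A → bit A f) (J′-same j j≢i)

        ∪-mono : ∀ A j → A ∪ J j ⊆ A ∪ J′ j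
        ∪-mono A j = ∪-least (p⊆p∪q (J′ j)) (q⊆p∪q A (J′ j) ∘ J⊆J′ j)

        Σρ-mono : ∀ A → Σρ J A ≤ Σρ J′ A
        Σρ-mono A = sum-mono λ j → ρ-mono ends (∪-mono A j)

        -- If e lies in A, the lost unit of weight compensates for the gained unit of size.
        -- Otherwise the left side grows by one and the old inequality has to become strict: either
        -- A is not tight, or e is not spanned by A ∪ J i and raises its rank.
        feasible-suc : ∀ A → weight w′ A + suc (size J) ≤ Σρ J′ A
        feasible-suc A with e ∈? A
        ... | yes e∈A = ℕ.≤-trans (ℕ.≤-reflexive (trans (ℕ.+-suc _ _) (cong (_+ size J) (weight-decrement w′-same w′-drop e∈A))))
                          (ℕ.≤-trans (feasible A) (Σρ-mono A))
        ... | no e∉A = subst (_≤ Σρ J′ A)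
                         (trans (cong (λ k → suc (k + size J)) (weight-cong A λ f∈A → sym (w′-same _ λ { refl → e∉A f∈A })))
                                (sym (ℕ.+-suc _ _))) strict
          where
          strict : weight w A + size J < Σρ J′ A
          strict with ρ-insert ends (A ∪ J i) e
          ... | inj₁ (spans , _) = ℕ.<-≤-trans (ℕ.≰⇒> λ tight → unblocked (A , e∉A , tight , spans)) (Σρ-mono A)
          ... | inj₂ (_ , eq) = ℕ.≤-<-trans (feasible A) (sum-mono-< (λ j → ρ-mono ends (∪-mono A j)) i
                  (ℕ.≤-trans (ℕ.≤-reflexive (sym eq)) (ρ-mono ends (∪-least (∪-mono A i)
                    (λ f∈e → q⊆p∪q A (J′ i) (subst (_ ∈ˢ_) (sym J′-insert) (q⊆p∪q (J i) ⁅ e ⁆ f∈e)))))))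

        feasible′ : Feasible w′ J′
        feasible′ A = subst (λ k → weight w′ A + k ≤ Σρ J′ A) (sym size-suc) (feasible-suc A)

  Covering : (Fin m → ℕ) → Family → Set
  Covering w J = ∃ λ K → size K ≡ weight w ⊤ + size J × (∀ e → count K e ≡ w e + count J e) ×
                         size K ≤ sum λ i → ρ ends (K i)

  -- The number k is the total demand left, on which the recursion terminates.
  extend : ∀ k w J → weight w ⊤ ≡ k → Feasible w J → Covering w J
  extend k w J total feasible with Fin.any? (λ e → 0 ℕ.<? w e)
  ... | no none = J , cong (_+ size J) (sym total≡0) , (λ e → cong (_+ count J e) (sym (w≡0 e)))
                , ℕ.≤-trans (ℕ.m≤n+m (size J) (weight w ⊥)) (ℕ.≤-trans (feasible ⊥)
                    (ℕ.≤-reflexive (sum-cong-≗ λ i → cong (ρ ends) (∪-identityˡ (J i)))))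
    where
    w≡0 : ∀ e → w e ≡ 0
    w≡0 e = ℕ.n≤0⇒n≡0 (ℕ.≮⇒≥ λ w>0 → none (e , w>0))
    total≡0 : weight w ⊤ ≡ 0
    total≡0 = trans (weight-cong {w′ = const 0} ⊤ λ {e} _ → w≡0 e) (weight-0 {m} ⊤)
      where
      weight-0 : ∀ {m} (A : Subset m) → weight (const 0) A ≡ 0
      weight-0 []            = refl
      weight-0 (outside ∷ A) = weight-0 A
      weight-0 (inside ∷ A)  = weight-0 A
  ... | yes (e , w>0) with Fin.any? (λ i → ¬? (blocked? w J feasible e i))
  ...   | no blocked = ⊥-elim (not-all-blocked w J feasible e w>0 λ i →
            decidable-stable (blocked? w J feasible e i) λ unblocked → blocked (i , unblocked))
  ...   | yes (i , unblocked) = grow k total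
    where
    open Extend w J feasible e w>0 i unblocked
    total′ : suc (weight w′ ⊤) ≡ weight w ⊤
    total′ = weight-decrement w′-same w′-drop ∈⊤
    grow : ∀ k → weight w ⊤ ≡ k → Covering w J
    grow zero    total with () ← trans total′ total
    grow (suc k) total with extend k w′ J′ (ℕ.suc-injective (trans total′ total)) feasible′
    ... | K , size-K , count-K , rank-K = K
        , trans size-K (trans (cong (weight w′ ⊤ +_) size-suc) (trans (ℕ.+-suc _ _) (cong (_+ size J) total′)))
        , count-K′ , rank-K
      where
      count-K′ : ∀ f → count K f ≡ w f + count J f
      count-K′ f with f Fin.≟ e
      ... | yes refl = trans (count-K e) (trans (cong (w′ e +_) count-e) (trans (ℕ.+-suc _ _) (cong (_+ count J e) w′-drop)))
      ... | no f≢e   = trans (count-K f) (cong₂ _+_ (w′-same f f≢e) (count-same f f≢e))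

  size-⊥ : size (const ⊥) ≡ 0
  size-⊥ = trans (sum-cong-≗ {d} λ i → ∣⊥∣≡0 m) (trans (sum-const d 0) (ℕ.*-zeroʳ d))

  count-⊥ : ∀ e → count (const ⊥) e ≡ 0
  count-⊥ e = trans (sum-cong-≗ {d} λ i → bit-∉ {A = ⊥} {e} ∉⊥) (trans (sum-const d 0) (ℕ.*-zeroʳ d))

  nash-williams : ∀ w → (∀ A → weight w A ≤ d ℕ.* ρ ends A) →
    ∃ λ K → size K ≡ weight w ⊤ × (∀ e → count K e ≡ w e) × (∀ i → ρ ends (K i) ≡ ∣ K i ∣)
  nash-williams w bound with extend (weight w ⊤) w (const ⊥) refl feasible
    where
    feasible : Feasible w (const ⊥)
    feasible A = subst₂ _≤_ (sym (trans (cong (weight w A +_) size-⊥) (ℕ.+-identityʳ _)))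
      (trans (sym (sum-const d (ρ ends A))) (sum-cong-≗ {d} λ i → cong (ρ ends) (sym (∪-identityʳ A)))) (bound A)
  ... | K , size-K , count-K , rank-K = K
      , trans size-K (trans (cong (weight w ⊤ +_) size-⊥) (ℕ.+-identityʳ _))
      , (λ e → trans (count-K e) (trans (cong (w e +_) (count-⊥ e)) (ℕ.+-identityʳ _)))
      , sum-squeeze (λ i → ρ≤∣∣ ends (K i)) rank-K

module SpanningForests {n m : ℕ} (ends : Fin m → Fin n × Fin n) where
  open import Data.List using (allFin)
  open import Data.List.Membership.Propositional using () renaming (_∈_ to _∈ˡ_)
  open import Data.List.Membership.Propositional.Properties using (∈-allFin)
  open import Data.List.Relation.Unary.Any using (here; there)
  open Connectivity {n}
  open GraphicRank {n}
  open Weights using (∣∣-insert)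

  extend-forest : ∀ J → ρ ends J ≡ ∣ J ∣ → (es : List (Fin m)) →
    ∃ λ T → J ⊆ T × ρ ends T ≡ ∣ T ∣ × (∀ {e} → e ∈ˡ es → Spans ends T e)
  extend-forest J forest []       = J , id , forest , λ ()
  extend-forest J forest (e ∷ es) with extend-forest J forest es
  ... | T , J⊆T , forestT , spans with ρ-insert ends T e
  ...   | inj₁ (spans-e , _)   = T , J⊆T , forestT , λ { (here ≡.refl) → spans-e ; (there f∈) → spans f∈ }
  ...   | inj₂ (¬spans-e , eq) = T ∪ ⁅ e ⁆ , p⊆p∪q ⁅ e ⁆ ∘ J⊆T
      , ≡.trans eq (≡.trans (≡.cong suc forestT) (≡.sym (∣∣-insert {A = T} λ e∈T → ¬spans-e (∈⇒Joined (∈-select⁺ ends e∈T)))))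
      , λ { (here ≡.refl) → ∈⇒Joined (∈-select⁺ ends (q⊆p∪q T ⁅ e ⁆ (x∈⁅x⁆ e)))
          ; {f} (there f∈) → spans-mono ends {T} {T ∪ ⁅ e ⁆} {f} (p⊆p∪q ⁅ e ⁆) (spans f∈) }

  spanning-forest : ∀ J → ρ ends J ≡ ∣ J ∣ → ∃ λ T → J ⊆ T × ρ ends T ≡ ∣ T ∣ × ∀ e → Spans ends T e
  spanning-forest J forest with extend-forest J forest (allFin m)
  ... | T , J⊆T , forestT , spans = T , J⊆T , forestT , λ e → spans (∈-allFin e)

-- Vertex functions with given differences along edges

module Potentials (R : CommutativeRing 0ℓ 0ℓ) {n : ℕ} where
  open import Relation.Binary.Construct.Closure.ReflexiveTransitive using (ε; _◅_)
  open import Relation.Binary.Construct.Closure.Symmetric using (fwd; bwd)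
  open import Data.List using (lookup)
  open import Data.List.Membership.Propositional.Properties using (∈-lookup)
  open CommutativeRing R hiding (zero)
  open RingSolver R
  open Elimination R using (δ; δ-off-diagonal; sum-δ; sum-0)
  open Algebra.Properties.Semiring.Sum semiring using (sum; sum-cong-≋; ∑-distrib-+; *-distribˡ-sum)
  open Relation.Binary.Reasoning.Setoid setoid
  open Connectivity {n}
  open GraphicRank {n}

  difference : (Fin n → Carrier) → Fin n × Fin n → Carrier
  difference p (a , b) = p a - p b

  module _ {m : ℕ} (ends : Fin m → Fin n × Fin n) where

    -- Signed edge counts of a walk in J between the ends of e. They do not depend on p, so the
    -- equations built from them have fixed scalar coefficients.
    record PathCoefficients (J : Subset m) (e : Fin n × Fin n) : Set where
      field
        coefficients : Fin m → Carrier
        supported    : ∀ {f} → f ∉ˢ J → coefficients f ≈ 0#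
        expansion    : ∀ p → difference p e ≈ sum λ f → coefficients f * difference p (ends f)
    open PathCoefficients

    add-edge : ∀ {J a b b′ f} s → f ∈ˢ J → (∀ p → difference p (a , b′) ≈ s * difference p (ends f)) →
               PathCoefficients J (b′ , b) → PathCoefficients J (a , b)
    add-edge {J} {a} {b} {b′} {f} s f∈J first rest = record
      { coefficients = λ g → s * δ f g + coefficients rest g
      ; supported    = λ {g} g∉J → trans (+-cong (trans (*-congˡ (δ-off-diagonal {i = f} {g} λ { ≡.refl → g∉J f∈J })) (zeroʳ s)) (supported rest g∉J))
                                         (+-identityʳ 0#)
      ; expansion    = λ p → begin
          p a - p b                                                ≈⟨ telescope (p a) (p b′) (p b) ⟨
          difference p (a , b′) + difference p (b′ , b)            ≈⟨ +-cong (first p) (expansion rest p) ⟩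
          s * z p f + sum (λ g → coefficients rest g * z p g)      ≈⟨ +-congʳ (*-congˡ (sum-δ f (z p))) ⟨
          s * sum (λ g → δ f g * z p g) + sum (λ g → coefficients rest g * z p g)
            ≈⟨ +-congʳ (*-distribˡ-sum s (λ g → δ f g * z p g)) ⟩
          sum (λ g → s * (δ f g * z p g)) + sum (λ g → coefficients rest g * z p g)
            ≈⟨ ∑-distrib-+ (λ g → s * (δ f g * z p g)) (λ g → coefficients rest g * z p g) ⟨
          sum (λ g → s * (δ f g * z p g) + coefficients rest g * z p g)
            ≈⟨ sum-cong-≋ (λ g → factor s (δ f g) (z p g) (coefficients rest g)) ⟩
          sum (λ g → (s * δ f g + coefficients rest g) * z p g)    ∎
      }
      where
      z : (Fin n → Carrier) → Fin m → Carrier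
      z p g = difference p (ends g)
      telescope : ∀ a b c → (a - b) + (b - c) ≈ a - c
      telescope = solve 3 (λ a b c → (a :- b) :+ (b :- c) := a :- c) refl
      factor : ∀ s d z c → s * (d * z) + c * z ≈ (s * d + c) * z
      factor = solve 4 (λ s d z c → s :* (d :* z) :+ c :* z := (s :* d :+ c) :* z) refl

    path-coefficients : ∀ {J a b} → Joined (select ends J) (a , b) → PathCoefficients J (a , b)
    path-coefficients {J} (joined path) = go path
      where
      go : ∀ {a b} → Connected (lookup (select ends J)) a b → PathCoefficients J (a , b)
      go {a} ε = record
        { coefficients = λ _ → 0#
        ; supported    = λ _ → refl
        ; expansion    = λ p → trans (-‿inverseʳ (p a))
            (sym (sum-0 (λ f → 0# * difference p (ends f)) λ f → zeroˡ _)) }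
      go (fwd (i , eq) ◅ path) with ∈-select⁻ ends J (∈-lookup i)
      ... | f , f∈J , eq′ = add-edge 1# f∈J (λ p → trans (reflexive (≡.cong (difference p) (≡.sym (≡.trans eq′ eq))))
                                                       (sym (*-identityˡ _))) (go path)
      go (bwd (i , eq) ◅ path) with ∈-select⁻ ends J (∈-lookup i)
      ... | f , f∈J , eq′ = add-edge (- 1#) f∈J (λ p → trans (flip _ _)
              (*-congˡ (reflexive (≡.cong (difference p) (≡.sym (≡.trans eq′ eq)))))) (go path)
        where
        open import Algebra.Properties.Ring ring using (-1*x≈-x)
        reverse : ∀ x y → x - y ≈ - (y - x)
        reverse = solve 2 (λ x y → x :- y := :- (y :- x)) refl
        flip : ∀ x y → x - y ≈ - 1# * (y - x)
        flip x y = trans (reverse x y) (sym (-1*x≈-x (y - x)))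

  forest-potential : ∀ {m} (ends : Fin m → Fin n × Fin n) J → ρ ends J ≡ ∣ J ∣ → (z : Fin m → Carrier) →
    ∃ λ p → ∀ {e} → e ∈ˢ J → difference p (ends e) ≈ z e
  forest-potential ends []            forest z = (λ _ → 0#) , λ ()
  forest-potential ends (outside ∷ J) forest z with forest-potential (ends ∘ suc) J forest (z ∘ suc)
  ... | p , p-z = p , λ { (there e∈J) → p-z e∈J }
  forest-potential ends (inside ∷ J)  forest z with rank-∷ (ends zero) (select (ends ∘ suc) J)
  ... | inj₁ (_ , eq) = ⊥-elim (ℕ.<-irrefl ≡.refl (ℕ.≤-trans (ℕ.≤-reflexive (≡.sym (≡.trans (≡.sym eq) forest)))
                                                            (ρ≤∣∣ (ends ∘ suc) J)))
  ... | inj₂ (¬joins , eq) with forest-potential (ends ∘ suc) J (ℕ.suc-injective (≡.trans (≡.sym eq) forest)) (z ∘ suc)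
  ...   | p , p-z = p′ , λ { here → new-edge ; {suc e} (there e∈J) → trans (old-edge e∈J) (p-z e∈J) }
    where
    l = select (ends ∘ suc) J
    a = proj₁ (ends zero)
    b = proj₂ (ends zero)
    t = z zero - difference p (ends zero)

    bump : ∀ {v} → Dec (Joined l (a , v)) → Carrier
    bump (yes _) = t
    bump (no _)  = 0#

    -- The component of a is translated so that the new edge gets its value.
    p′ : Fin n → Carrier
    p′ v = p v + bump (joined? l (a , v))

    bump-yes : ∀ {v} (joins? : Dec (Joined l (a , v))) → Joined l (a , v) → bump joins? ≈ t
    bump-yes (yes _)    _  = refl
    bump-yes (no ¬join) av = ⊥-elim (¬join av)

    bump-no : ∀ {v} (joins? : Dec (Joined l (a , v))) → ¬ Joined l (a , v) → bump joins? ≈ 0#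
    bump-no (yes av) ¬join = ⊥-elim (¬join av)
    bump-no (no _)   _     = refl

    bump-cong : ∀ {v w} (v? : Dec (Joined l (a , v))) (w? : Dec (Joined l (a , w))) → Joined l (v , w) → bump v? ≈ bump w?
    bump-cong (yes av) w?      vw = sym (bump-yes w? (transitive av vw))
    bump-cong (no ¬av) (yes aw) vw = ⊥-elim (¬av (transitive aw (symmetric vw)))
    bump-cong (no _)   (no _)   vw = refl

    shift : ∀ x y c → (x + c) - (y + c) ≈ x - y
    shift = solve 3 (λ x y c → (x :+ c) :- (y :+ c) := x :- y) refl

    old-edge : ∀ {e} → e ∈ˢ J → difference p′ (ends (suc e)) ≈ difference p (ends (suc e))
    old-edge {e} e∈J = trans (+-congˡ (-‿cong (+-congˡ (sym (bump-cong (joined? l (a , v)) (joined? l (a , w)) vw)))))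
                             (shift (p v) (p w) (bump (joined? l (a , v))))
      where
      v = proj₁ (ends (suc e))
      w = proj₂ (ends (suc e))
      vw : Joined l (v , w)
      vw = ∈⇒Joined (∈-select⁺ (ends ∘ suc) e∈J)

    adjust : ∀ x y z o → (x + (z - (x - y))) - (y + o) ≈ z - o
    adjust = solve 4 (λ x y z o → (x :+ (z :- (x :- y))) :- (y :+ o) := z :- o) refl

    open import Algebra.Properties.Ring ring using (-0#≈0#)

    new-edge : difference p′ (ends zero) ≈ z zero
    new-edge = begin
      p′ a - p′ b                              ≈⟨ +-cong (+-congˡ (bump-yes (joined? l (a , a)) (joined ε)))
                                                         (-‿cong (+-congˡ (bump-no (joined? l (a , b)) ¬joins))) ⟩
      (p a + (z zero - (p a - p b))) - (p b + 0#)   ≈⟨ adjust (p a) (p b) (z zero) 0# ⟩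
      z zero - 0#                              ≈⟨ trans (+-congˡ -0#≈0#) (+-identityʳ _) ⟩
      z zero                                   ∎

-- Realising prescribed directions

module WeightBounds where
  open Weights
  open Sums
  open Algebra.Properties.Monoid.Sum ℕ.+-0-monoid using (sum)

  weight-const : ∀ {m} k (A : Subset m) → weight (const k) A ≡ k ℕ.* ∣ A ∣
  weight-const k []            = ≡.sym (ℕ.*-zeroʳ k)
  weight-const k (outside ∷ A) = weight-const k A
  weight-const k (inside ∷ A)  = ≡.trans (≡.cong (k ℕ.+_) (weight-const k A)) (≡.sym (ℕ.*-suc k ∣ A ∣))

  weight-increment : ∀ {m} (w : Fin m → ℕ) e A → weight (updateAt w e suc) A ≤ suc (weight w A)
  weight-increment w e A with e ∈? A
  ... | yes e∈A = ℕ.≤-reflexive (≡.sym (weight-decrement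
                    (λ f f≢e → ≡.sym (updateAt-minimal f e w f≢e)) (≡.sym (updateAt-updates e w)) e∈A))
  ... | no e∉A  = ℕ.m≤n⇒m≤1+n (ℕ.≤-reflexive (weight-cong A λ {f} f∈A → updateAt-minimal f e w λ { ≡.refl → e∉A f∈A }))

  count-misses : ∀ {d} {f : Fin d → ℕ} → (∀ i → f i ≤ 1) → ∀ i → f i ≡ 0 → sum f < d
  count-misses {d} {f} f≤1 i fi≡0 = ≡.subst (sum f <_) (≡.trans (sum-const d 1) (ℕ.*-identityʳ d))
    (sum-mono-< f≤1 i (s≤s (ℕ.≤-reflexive fi≡0)))

  -- Comparison with the function g that is 0 at i and 1 elsewhere: f lies below g everywhere and
  -- strictly below it at j.
  count-two-misses : ∀ {d} {f : Fin d → ℕ} → (∀ i → f i ≤ 1) → ∀ i j → i ≢ j → f i ≡ 0 → f j ≡ 0 → suc (sum f) < d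
  count-two-misses {d} {f} f≤1 i j i≢j fi≡0 fj≡0 =
    ≡.subst (suc (sum f) <_) (≡.trans (≡.sym g+1) (≡.trans (sum-const d 1) (ℕ.*-identityʳ d))) (s≤s (sum-mono-< f≤g j fj<gj))
    where
    g : Fin d → ℕ
    g = updateAt (const 1) i (const 0)
    g+1 : sum (const {B = Fin d} 1) ≡ suc (sum g)
    g+1 = sum-increment i (λ k k≢i → ≡.sym (updateAt-minimal k i (const 1) k≢i))
                          (≡.cong suc (≡.sym (updateAt-updates i (const 1))))
    f≤g : ∀ k → f k ≤ g k
    f≤g k with k Fin.≟ i
    ... | yes ≡.refl = ℕ.≤-trans (ℕ.≤-reflexive fi≡0) z≤n
    ... | no k≢i     = ≡.subst (f k ≤_) (≡.sym (updateAt-minimal k i (const 1) k≢i)) (f≤1 k)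
    fj<gj : f j < g j
    fj<gj = ≡.subst₂ _<_ (≡.sym fj≡0) (≡.sym (updateAt-minimal j i (const 1) (i≢j ∘ ≡.sym))) (s≤s z≤n)

module Configurations (R : CommutativeRing 0ℓ 0ℓ) where
  open CommutativeRing R hiding (zero)
  open RingSolver R
  open Elimination R
  open PolynomialMaps R
  open import Algebra.Properties.Ring ring using (-0#≈0#)

  -- Row e of the system says, in coordinate slot e, that the edge vector of e
  -- is the combination of the edge vectors of the other edges given by co e.
  module Rows {m d : ℕ} (slot : Fin m → Maybe (Fin d)) (co : Fin m → Fin m → Carrier) where

    -- An edge without a slot imposes no condition on directions. Its identity row keeps the matrix
    -- square and lets the right-hand side prescribe its scalar.
    row : Maybe (Fin d) → Point m d → Fin m → Fin m → Carrier
    row nothing  x e f = δ e f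
    row (just i) x e f = (δ e f - co e f) * x f i

    matrix : Point m d → Matrix m
    matrix x e = row (slot e) x e

    -- Off the diagonal there are two reasons for a zero: an edge f with the slot of e is missed by
    -- the same forest, so no path coefficient sits on it; for any other f the product of
    -- coefficient and coordinate vanishes.
    identity-at : ∀ x → (∀ f i → slot f ≡ just i → x f i ≈ 1#) →
      (∀ e f i → slot e ≡ just i → slot f ≡ just i → co e f ≈ 0#) →
      (∀ e f i → slot e ≡ just i → slot f ≢ just i → co e f * x f i ≈ 0#) →
      ∀ e f → matrix x e f ≈ δ e f
    identity-at x x≈1 same different e f with slot e in slot-e
    ... | nothing = refl
    ... | just i with Maybe.≡-dec Fin._≟_ (slot f) (just i)
    ...   | yes slot-f = trans (*-cong (trans (+-congˡ (trans (-‿cong (same e f i slot-e slot-f)) -0#≈0#)) (+-identityʳ _))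
                                       (x≈1 f i slot-f)) (*-identityʳ _)
    ...   | no ¬slot-f = trans (distribute (δ e f) (co e f) (x f i)) (trans
              (+-cong (trans (*-congʳ δ≈0) (zeroˡ _)) (trans (-‿cong (different e f i slot-e ¬slot-f)) -0#≈0#))
              (trans (+-identityʳ 0#) (sym δ≈0)))
      where
      δ≈0 : δ e f ≈ 0#
      δ≈0 = δ-off-diagonal {i = e} {f} λ { ≡.refl → ¬slot-f slot-e }
      distribute : ∀ a b c → (a - b) * c ≈ a * c - b * c
      distribute = solve 3 (λ a b c → (a :- b) :* c := a :* c :- b :* c) refl

  pivotsᵖ : ∀ {n k l} {A : Point k l → Matrix n} → (∀ i j → PolynomialMap (λ x → A x i j)) →
            PolynomialMap (λ x → pivots (A x))
  reduceᵖ : ∀ {n k l} {A : Point k l → Matrix (suc n)} → (∀ i j → PolynomialMap (λ x → A x i j)) →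
            ∀ i j → PolynomialMap (λ x → reduce (A x) i j)
  reduceᵖ A i j = A zero zero *ᵖ A (suc i) (suc j) +ᵖ negateᵖ (A (suc i) zero *ᵖ A zero (suc j))
  pivotsᵖ {zero}  A = constantᵖ 1#
  pivotsᵖ {suc n} A = A zero zero *ᵖ pivotsᵖ (reduceᵖ A)

  solutionᵖ : ∀ {n k l} {A : Point k l → Matrix n} {b : Point k l → Fin n → Carrier} →
    (∀ i j → PolynomialMap (λ x → A x i j)) → (∀ i → PolynomialMap (λ x → b x i)) →
    ∀ i → PolynomialMap (λ x → solution (A x) (b x) i)
  solutionᵖ {suc n} A b zero    = pivotsᵖ (reduceᵖ A) *ᵖ b zero +ᵖ
    negateᵖ (sumᵖ λ j → A zero (suc j) *ᵖ solutionᵖ (reduceᵖ A)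
      (λ i → A zero zero *ᵖ b (suc i) +ᵖ negateᵖ (A (suc i) zero *ᵖ b zero)) j)
  solutionᵖ {suc n} A b (suc j) = A zero zero *ᵖ solutionᵖ (reduceᵖ A)
      (λ i → A zero zero *ᵖ b (suc i) +ᵖ negateᵖ (A (suc i) zero *ᵖ b zero)) j

module Slots {n m : ℕ} (ends : Fin m → Fin n × Fin n) (d : ℕ) where
  open GraphicRank {n}

  -- The slot of an edge is the coordinate in which it yields an equation: the forest there misses
  -- the edge but joins its ends.
  record SlottedForests : Set where
    field
      forest     : Fin d → Subset m
      slot       : Fin m → Maybe (Fin d)
      slot-∉     : ∀ {e i} → slot e ≡ just i → e ∉ˢ forest i
      slot-spans : ∀ {e i} → slot e ≡ just i → Spans ends (forest i) e

  module Coefficients (R : CommutativeRing 0ℓ 0ℓ) (family : SlottedForests) where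
    open SlottedForests family
    open CommutativeRing R hiding (zero)
    open RingSolver R
    open Elimination R
    open Configurations R
    open Potentials R {n}
    open PathCoefficients
    open Algebra.Properties.Semiring.Sum semiring using (sum; sum-cong-≋; ∑-distrib-+; *-distribˡ-sum)
    open Algebra.Properties.Ring ring using (-1*x≈-x)
    open Relation.Binary.Reasoning.Setoid setoid

    co-at : ∀ e s → slot e ≡ s → Fin m → Carrier
    co-at e nothing  eq f = 0#
    co-at e (just i) eq f = coefficients (path-coefficients ends {forest i} (slot-spans eq)) f

    co : Fin m → Fin m → Carrier
    co e = co-at e (slot e) ≡.refl

    co-expansion : ∀ {e i} → slot e ≡ just i → ∀ p → difference p (ends e) ≈ sum λ f → co e f * difference p (ends f)
    co-expansion {e} {i} slot-e p = at (slot e) ≡.refl slot-e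
      where
      at : ∀ s eq → s ≡ just i → difference p (ends e) ≈ sum λ f → co-at e s eq f * difference p (ends f)
      at (just i) eq ≡.refl = expansion (path-coefficients ends {forest i} (slot-spans eq)) p

    co-supported : ∀ {e f i} → slot e ≡ just i → f ∉ˢ forest i → co e f ≈ 0#
    co-supported {e} {f} {i} slot-e f∉ = at (slot e) ≡.refl slot-e
      where
      at : ∀ s eq → s ≡ just i → co-at e s eq f ≈ 0#
      at (just i) eq ≡.refl = supported (path-coefficients ends {forest i} (slot-spans eq)) f∉

    open Rows slot co public

    row-sum : ∀ e (z : Fin m → Carrier) → sum (λ f → (δ e f - co e f) * z f) ≈ z e - sum (λ f → co e f * z f)
    row-sum e z = begin
      sum (λ f → (δ e f - co e f) * z f)
        ≈⟨ sum-cong-≋ (λ f → trans (distribute (δ e f) (co e f) (z f)) (+-congˡ (sym (-1*x≈-x _)))) ⟩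
      sum (λ f → δ e f * z f + - 1# * (co e f * z f))
        ≈⟨ ∑-distrib-+ (λ f → δ e f * z f) (λ f → - 1# * (co e f * z f)) ⟩
      sum (λ f → δ e f * z f) + sum (λ f → - 1# * (co e f * z f))
        ≈⟨ +-cong (sum-δ e z) (trans (sym (*-distribˡ-sum (- 1#) (λ f → co e f * z f))) (-1*x≈-x _)) ⟩
      z e - sum (λ f → co e f * z f) ∎
      where
      distribute : ∀ a c z → (a - c) * z ≈ a * z + - (c * z)
      distribute = solve 3 (λ a c z → (a :- c) :* z := a :* z :+ :- (c :* z)) refl

-- In dimension suc d, with d copies of every edge and one more of e₀.
module ForestFamilies {n m : ℕ} (ends : Fin m → Fin n × Fin n) (d : ℕ) where
  open GraphicRank {n}
  open Weights
  open WeightBounds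
  open SpanningForests ends
  open NashWilliams ends (suc d)
  open Slots ends (suc d) using (SlottedForests; module SlottedForests)

  record ForestFamily (e₀ : Fin m) : Set where
    field
      slotted     : SlottedForests
    open SlottedForests slotted public
    field
      independent : ∀ i → ρ ends (forest i) ≡ ∣ forest i ∣
      slot-unique : ∀ {e i} → e ∉ˢ forest i → slot e ≡ just i
      slot-e₀     : slot e₀ ≡ nothing

  module _ (sparse : Sparse (ρ ends) (suc d)) (e₀ : Fin m) where
    w : Fin m → ℕ
    w = updateAt (const d) e₀ suc

    -- The strictness of the sparsity inequality pays for the additional copy of e₀. Sparsity is
    -- silent about the empty set, whose weight is 0.
    w-bound : ∀ A → weight w A ≤ suc d ℕ.* ρ ends A
    w-bound A with nonempty? A
    ... | yes A≢∅ = ℕ.≤-trans (weight-increment (const d) e₀ A)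
                      (≡.subst (λ k → suc k ≤ suc d ℕ.* ρ ends A) (≡.sym (weight-const d A)) (sparse A A≢∅))
    ... | no A≡∅  = ℕ.≤-trans (ℕ.≤-reflexive (≡.trans (≡.cong (weight w) (Empty-unique A≡∅)) (weight-⊥ w))) z≤n
      where
      weight-⊥ : ∀ {m} (w : Fin m → ℕ) → weight w ⊥ ≡ 0
      weight-⊥ {zero}  w = ≡.refl
      weight-⊥ {suc m} w = weight-⊥ (w ∘ suc)

    w≥d : ∀ e → d ≤ w e
    w≥d e with e Fin.≟ e₀
    ... | yes ≡.refl = ≡.subst (d ≤_) (≡.sym (updateAt-updates e₀ (const d))) (ℕ.n≤1+n d)
    ... | no e≢e₀    = ℕ.≤-reflexive (≡.sym (updateAt-minimal e e₀ (const d) e≢e₀))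

    forestFamily : ForestFamily e₀
    forestFamily with nash-williams w w-bound
    ... | K , _ , count-K , forest-K = record
      { slotted     = record
        { forest     = T
        ; slot       = slot
        ; slot-∉     = λ {e} → slot-∉ e
        ; slot-spans = λ {e} {i} _ → proj₂ (proj₂ (proj₂ (extended i))) e }
      ; independent = λ i → proj₁ (proj₂ (proj₂ (extended i)))
      ; slot-unique = λ {e} {i} → slot-unique e i
      ; slot-e₀     = slot-e₀
      }
      where
      -- The forests K i may fail to span. Enlarging them creates no new misses, so the counts for K
      -- still limit how often an edge is missed.
      extended : ∀ i → ∃ λ T → K i ⊆ T × ρ ends T ≡ ∣ T ∣ × ∀ e → Spans ends T e
      extended i = spanning-forest (K i) (forest-K i)

      T : Fin (suc d) → Subset m
      T i = proj₁ (extended i)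

      miss : ∀ {e i} → e ∉ˢ T i → bit (K i) e ≡ 0
      miss {e} {i} e∉T = bit-∉ (e∉T ∘ proj₁ (proj₂ (extended i)))

      missing? : ∀ e → Dec (∃ λ i → e ∉ˢ T i)
      missing? e = Fin.any? λ i → ¬? (e ∈? T i)

      slot-of : ∀ {e} → Dec (∃ λ i → e ∉ˢ T i) → Maybe (Fin (suc d))
      slot-of (yes (i , _)) = just i
      slot-of (no _)        = nothing

      slot : Fin m → Maybe (Fin (suc d))
      slot e = slot-of (missing? e)

      slot-∉ : ∀ e {i} → slot e ≡ just i → e ∉ˢ T i
      slot-∉ e eq with missing? e
      slot-∉ e ≡.refl | yes (i , e∉T) = e∉T

      slot-unique : ∀ e i → e ∉ˢ T i → slot e ≡ just i
      slot-unique e i e∉T with missing? e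
      ... | no none = ⊥-elim (none (i , e∉T))
      ... | yes (j , e∉Tj) with j Fin.≟ i
      ...   | yes ≡.refl = ≡.refl
      -- Two misses leave at most d - 1 of the d + 1 forests for e, but e occurs at least d times.
      ...   | no j≢i     = ⊥-elim (ℕ.<-irrefl ≡.refl (ℕ.<-≤-trans
                (count-two-misses (λ k → bit≤1 (K k) e) j i j≢i (miss e∉Tj) (miss e∉T))
                (s≤s (≡.subst (d ≤_) (≡.sym (count-K e)) (w≥d e)))))

      slot-e₀ : slot e₀ ≡ nothing
      slot-e₀ with missing? e₀
      ... | no _          = ≡.refl
      ... | yes (i , e∉T) = ⊥-elim (ℕ.<-irrefl
                (≡.trans (count-K e₀) (updateAt-updates e₀ (const d)))
                (count-misses (λ k → bit≤1 (K k) e₀) i (miss e∉T)))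

module Dominance (R : CommutativeRing 0ℓ 0ℓ)
  (stable : ∀ x → ¬ ¬ CommutativeRing._≈_ R x (CommutativeRing.0# R) → CommutativeRing._≈_ R x (CommutativeRing.0# R))
  (domain : ∀ x y → CommutativeRing._≈_ R (CommutativeRing._*_ R x y) (CommutativeRing.0# R) →
            ¬ CommutativeRing._≈_ R x (CommutativeRing.0# R) → CommutativeRing._≈_ R y (CommutativeRing.0# R))
  (characteristic : ∀ k → ¬ CommutativeRing._≈_ R
     (Algebra.Properties.Semiring.Mult._×_ (CommutativeRing.semiring R) (suc k) (CommutativeRing.1# R)) (CommutativeRing.0# R))
  {n m : ℕ} (ends : Fin m → Fin n × Fin n) (d : ℕ) where
  open import Data.Fin using (toℕ; combine; remQuot)
  open CommutativeRing R hiding (zero)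
  open RingSolver R
  open Elimination R
  open PolynomialMaps R
  open Nonvanishing stable domain characteristic
  open Configurations R
  open Potentials R {n}
  open GraphicRank {n}
  open Algebra.Properties.Semiring.Sum semiring using (sum; sum-cong-≋; ∑-distrib-+; *-distribˡ-sum; *-distribʳ-sum)
  open Algebra.Properties.Semiring.Exp semiring using (_^_)
  open Algebra.Properties.Monoid.Sum *-monoid using () renaming (sum to product)
  open Relation.Binary.Reasoning.Setoid setoid
  open PolynomialMap

  edge-vectors : ∀ {l} → Point n l → Point m l
  edge-vectors p e i = difference (λ v → p v i) (ends e)

  1≉0 : ¬ 1# ≈ 0#
  1≉0 1≈0 = characteristic 0 (trans (+-identityʳ 1#) 1≈0)

  Distinct : ∀ {l} → Point n l → Set
  Distinct p = ∀ {a b} → a ≢ b → ¬ (∀ i → p a i ≈ p b i)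

  difference≈0⇒≈ : ∀ x y → x - y ≈ 0# → x ≈ y
  difference≈0⇒≈ x y x-y≈0 = trans (sym (restore y x)) (trans (+-congˡ x-y≈0) (+-identityʳ y))

  edge-vectorsᵖ : ∀ {l} {H : Point m l → Carrier} → PolynomialMap H → PolynomialMap (H ∘ edge-vectors)
  edge-vectorsᵖ H-poly = record
    { respects = λ p≈q → respects H-poly λ e i → +-cong (p≈q _ i) (-‿cong (p≈q _ i))
    ; on-lines = λ p q → let (k , deg) = on-lines H-poly (edge-vectors p) (edge-vectors q) in
        k , Degree<-cong k (λ s → respects H-poly λ e i → regroup _ _ _ _ (ι s)) deg
    }
    where
    regroup : ∀ x x′ y y′ s → (x - x′) + s * ((y - y′) - (x - x′)) ≈ (x + s * (y - x)) - (x′ + s * (y′ - x′))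
    regroup = solve 5 (λ x x′ y y′ s →
      (x :- x′) :+ s :* ((y :- y′) :- (x :- x′)) := (x :+ s :* (y :- x)) :- (x′ :+ s :* (y′ :- x′))) refl

  -- Its nonvanishing forces a and b apart, already in the first coordinate. On the diagonal it is
  -- the constant 1, so that all pairs can be treated as one finite family of nonzero polynomials.
  separation : Fin n × Fin n → Point n (suc d) → Carrier
  separation (a , b) p with a Fin.≟ b
  ... | yes _ = 1#
  ... | no _  = p a zero - p b zero

  separationᵖ : ∀ e → PolynomialMap (separation e)
  separationᵖ (a , b) with a Fin.≟ b
  ... | yes _ = constantᵖ 1#
  ... | no _  = coordinateᵖ a zero +ᵖ negateᵖ (coordinateᵖ b zero)

  separation-nonzero : ∀ e → ∃ λ p → ¬ separation e p ≈ 0#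
  separation-nonzero (a , b) = (λ v _ → ι (toℕ v)) , nonzero
    where
    nonzero : ¬ separation (a , b) (λ v _ → ι (toℕ v)) ≈ 0#
    nonzero with a Fin.≟ b
    ... | yes _  = 1≉0
    ... | no a≢b with ℕ.<-cmp (toℕ a) (toℕ b)
    ...   | tri< a<b _ _ = λ eq → ι-injective a<b (trans (+-congʳ (sym (difference≈0⇒≈ _ _ eq))) (-‿inverseʳ _))
    ...   | tri≈ _ a≡b _ = ⊥-elim (a≢b (Fin.toℕ-injective a≡b))
    ...   | tri> _ _ b<a = ι-injective b<a

  separated⇒distinct : ∀ p → (∀ e → ¬ separation e p ≈ 0#) → Distinct p
  separated⇒distinct p separated {a} {b} a≢b p≈ = separated (a , b) vanishes
    where
    vanishes : separation (a , b) p ≈ 0#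
    vanishes with a Fin.≟ b
    ... | yes a≡b = ⊥-elim (a≢b a≡b)
    ... | no _    = trans (+-congʳ (p≈ zero)) (-‿inverseʳ _)

  -- Points built from solutions of the linear systems may coincide, while vanishing is assumed for
  -- distinct points only. Distinctness is the nonvanishing of finitely many polynomials, so it can
  -- be removed by density.
  vanishes-on-edge-vectors : ∀ {H : Point m (suc d) → Carrier} → PolynomialMap H →
    (∀ p → Distinct p → H (edge-vectors p) ≈ 0#) → ∀ p → H (edge-vectors p) ≈ 0#
  vanishes-on-edge-vectors H-poly vanishes = vanishes-everywhere (edge-vectorsᵖ H-poly)
    (separationᵖ ∘ remQuot {n} n) (separation-nonzero ∘ remQuot {n} n)
    λ p separated → vanishes p (separated⇒distinct p λ (a , b) →
      ≡.subst (λ e → ¬ separation e p ≈ 0#) (Fin.remQuot-combine a b) (separated (combine a b)))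

  open ForestFamilies ends d using (ForestFamily)

  module Solutions (e₀ : Fin m) (family : ForestFamily e₀) where
    open ForestFamily family
    open Slots.Coefficients ends (suc d) R slotted

    t : Point m (suc d) → Fin m → Carrier
    t x = solution (matrix x) (δ e₀)

    row-poly : ∀ {k l} {X : Point k l → Point m (suc d)} → (∀ e i → PolynomialMap (λ y → X y e i)) →
               ∀ s e f → PolynomialMap (λ y → row s (X y) e f)
    row-poly X nothing  e f = constantᵖ (δ e f)
    row-poly X (just i) e f = constantᵖ (δ e f - co e f) *ᵖ X f i

    tᵖ : ∀ {k l} {X : Point k l → Point m (suc d)} → (∀ e i → PolynomialMap (λ y → X y e i)) →
         ∀ e → PolynomialMap (λ y → t (X y) e)
    tᵖ X = solutionᵖ (λ e → row-poly X (slot e) e) (λ e → constantᵖ (δ e₀ e))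

    base : Point m (suc d)
    base f i with Maybe.≡-dec Fin._≟_ (slot f) (just i)
    ... | yes _ = 1#
    ... | no _  = 0#

    base-1 : ∀ f i → slot f ≡ just i → base f i ≈ 1#
    base-1 f i eq with Maybe.≡-dec Fin._≟_ (slot f) (just i)
    ... | yes _ = refl
    ... | no ≢  = ⊥-elim (≢ eq)

    base-0 : ∀ f i → slot f ≢ just i → base f i ≈ 0#
    base-0 f i ≢ with Maybe.≡-dec Fin._≟_ (slot f) (just i)
    ... | yes eq = ⊥-elim (≢ eq)
    ... | no _   = refl

    t-base : t base e₀ ≈ 1#
    t-base = trans (solution-identity (matrix base) (δ e₀)
        (identity-at base base-1
          (λ e f i slot-e slot-f → co-supported slot-e (slot-∉ slot-f))
          (λ e f i _ slot-f → trans (*-congˡ (base-0 f i slot-f)) (zeroʳ _))) e₀)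
      (δ-diagonal e₀)

    -- In coordinate i the values on the i-th forest define the points, and a missed edge agrees
    -- with them exactly when its equation holds. These equations are homogeneous: the right-hand
    -- side is supported at e₀, which has no slot.
    t-coboundary : ∀ x → ∃ λ p → ∀ e i → edge-vectors p e i ≈ t x e * x e i
    t-coboundary x = (λ v i → proj₁ (potential i) v) , realised
      where
      z : Fin (suc d) → Fin m → Carrier
      z i e = t x e * x e i

      potential : ∀ i → ∃ λ p → ∀ {e} → e ∈ˢ forest i → difference p (ends e) ≈ z i e
      potential i = forest-potential ends (forest i) (independent i) (z i)

      row-equation : ∀ e i → slot e ≡ just i → z i e ≈ sum λ f → co e f * z i f
      row-equation e i eq = difference≈0⇒≈ _ _ (begin
        z i e - sum (λ f → co e f * z i f)
          ≈⟨ row-sum e (z i) ⟨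
        sum (λ f → (δ e f - co e f) * (t x f * x f i))
          ≈⟨ sum-cong-≋ (λ f → regroup (δ e f - co e f) (t x f) (x f i)) ⟩
        sum (λ f → (δ e f - co e f) * x f i * t x f)
          ≈⟨ sum-cong-≋ (λ f → *-congʳ (reflexive (≡.cong (λ s → row s x e f) (≡.sym eq)))) ⟩
        sum (λ f → matrix x e f * t x f)
          ≈⟨ solution-solves (matrix x) (δ e₀) e ⟩
        pivots (matrix x) * δ e₀ e
          ≈⟨ trans (*-congˡ (δ-off-diagonal {i = e₀} {e} λ { ≡.refl → not-free (≡.trans (≡.sym slot-e₀) eq) })) (zeroʳ _) ⟩
        0# ∎)
        where
        not-free : ¬ nothing ≡ just i
        not-free ()
        regroup : ∀ a t x → a * (t * x) ≈ a * x * t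
        regroup = solve 3 (λ a t x → a :* (t :* x) := a :* x :* t) refl

      realised : ∀ e i → difference (proj₁ (potential i)) (ends e) ≈ z i e
      realised e i with e ∈? forest i
      ... | yes e∈ = proj₂ (potential i) e∈
      ... | no e∉  = begin
        difference p (ends e)                        ≈⟨ co-expansion eq p ⟩
        sum (λ f → co e f * difference p (ends f))   ≈⟨ sum-cong-≋ on-forest ⟩
        sum (λ f → co e f * z i f)                   ≈⟨ row-equation e i eq ⟨
        z i e                                        ∎
        where
        p = proj₁ (potential i)
        eq = slot-unique e∉
        on-forest : ∀ f → co e f * difference p (ends f) ≈ co e f * z i f
        on-forest f with f ∈? forest i
        ... | yes f∈ = *-congˡ (proj₂ (potential i) f∈)
        ... | no f∉  = trans (trans (*-congʳ (co-supported eq f∉)) (zeroˡ _))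
                             (sym (trans (*-congʳ (co-supported eq f∉)) (zeroˡ _)))

  product-nonzero : ∀ {k} (f : Fin k → Carrier) → (∀ j → ¬ f j ≈ 0#) → ¬ product f ≈ 0#
  product-nonzero {zero}  f f≉0 = 1≉0
  product-nonzero {suc k} f f≉0 eq = product-nonzero (f ∘ suc) (f≉0 ∘ suc) (domain _ _ eq (f≉0 zero))

  power-nonzero : ∀ {x} → ¬ x ≈ 0# → ∀ k → ¬ x ^ k ≈ 0#
  power-nonzero x≉0 zero    = 1≉0
  power-nonzero x≉0 (suc k) eq = power-nonzero x≉0 k (domain _ _ eq x≉0)

  -- Edge vectors t e · x e with t ≠ 0 realise the directions x; a
  -- combination of the solutions t for all choices of e₀, with coefficients
  -- as extra parameters, makes every t e nonzero generically.
  dominance : (∀ e₀ → ForestFamily e₀) → ∀ {H : Point m (suc d) → Carrier} (degree : Fin m → ℕ) → PolynomialMap H →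
    (∀ t x → H (λ e i → t e * x e i) ≈ product (λ e → t e ^ degree e) * H x) →
    (∀ p → Distinct p → H (edge-vectors p) ≈ 0#) → ∀ x → H x ≈ 0#
  dominance family {H} degree H-poly homogeneous vanishes x = vanishes-everywhere H′-poly T-poly T-nonzero H′-vanishes λ e → λ where
      zero    → 0#
      (suc i) → x e i
    where
    module S e₀ = Solutions e₀ (family e₀)
    open S using (t; tᵖ; base; t-base; t-coboundary)

    -- Each edge receives one coordinate more than its direction: coordinate `zero` is the
    -- coefficient of its solution in the combination `T`.
    directions-of : Point m (suc (suc d)) → Point m (suc d)
    directions-of y e i = y e (suc i)

    T : Fin m → Point m (suc (suc d)) → Carrier
    T e y = sum λ e₀ → y e₀ zero * t e₀ (directions-of y) e

    H′-poly : PolynomialMap (H ∘ directions-of)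
    H′-poly = record
      { respects = λ y≈y′ → respects H-poly λ e i → y≈y′ e (suc i)
      ; on-lines = λ y y′ → on-lines H-poly (directions-of y) (directions-of y′) }

    T-poly : ∀ e → PolynomialMap (T e)
    T-poly e = sumᵖ λ e₀ → coordinateᵖ e₀ zero *ᵖ tᵖ e₀ (λ f i → coordinateᵖ f (suc i)) e

    T-nonzero : ∀ e → ∃ λ y → ¬ T e y ≈ 0#
    -- Here y selects the single solution with e₀ = e, at the base point where its value at e is 1.
    T-nonzero e = y , λ T≈0 → 1≉0 (trans (sym (trans (sum-δ e λ e₀ → t e₀ (base e) e) (t-base e))) T≈0)
      where
      y : Point m (suc (suc d))
      y f zero    = δ e f
      y f (suc i) = base e f i

    H′-vanishes : ∀ y → (∀ e → ¬ T e y ≈ 0#) → H (directions-of y) ≈ 0#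
    -- By homogeneity, H at the edge vectors of p is a product of powers of the nonzero T e times H
    -- at the directions.
    H′-vanishes y T≉0 = domain _ _
      (trans (sym (homogeneous (λ e → T e y) (directions-of y)))
        (trans (respects H-poly λ e i → sym (realised e i))
               (vanishes-on-edge-vectors H-poly vanishes p)))
      (product-nonzero (λ e → T e y ^ degree e) λ e → power-nonzero (T≉0 e) (degree e))
      where
      part : Fin m → Point n (suc d)
      part e₀ = proj₁ (t-coboundary e₀ (directions-of y))

      p : Point n (suc d)
      p v i = sum λ e₀ → y e₀ zero * part e₀ v i

      realised : ∀ e i → edge-vectors p e i ≈ T e y * y e (suc i)
      realised e i = begin
        sum (λ e₀ → y e₀ zero * part e₀ a i) - sum (λ e₀ → y e₀ zero * part e₀ b i)
          ≈⟨ +-congˡ (trans (sym (-1*x≈-x _)) (*-distribˡ-sum (- 1#) (λ e₀ → y e₀ zero * part e₀ b i))) ⟩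
        sum (λ e₀ → y e₀ zero * part e₀ a i) + sum (λ e₀ → - 1# * (y e₀ zero * part e₀ b i))
          ≈⟨ ∑-distrib-+ (λ e₀ → y e₀ zero * part e₀ a i) (λ e₀ → - 1# * (y e₀ zero * part e₀ b i)) ⟨
        sum (λ e₀ → y e₀ zero * part e₀ a i + - 1# * (y e₀ zero * part e₀ b i))
          ≈⟨ sum-cong-≋ (λ e₀ → trans (+-congˡ (-1*x≈-x _)) (trans (factor (y e₀ zero) (part e₀ a i) (part e₀ b i))
               (trans (*-congˡ (proj₂ (t-coboundary e₀ (directions-of y)) e i)) (sym (*-assoc _ _ _))))) ⟩
        sum (λ e₀ → y e₀ zero * t e₀ (directions-of y) e * y e (suc i))
          ≈⟨ *-distribʳ-sum (y e (suc i)) (λ e₀ → y e₀ zero * t e₀ (directions-of y) e) ⟨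
        T e y * y e (suc i) ∎
        where
        open import Algebra.Properties.Ring ring using (-1*x≈-x)
        a = proj₁ (ends e)
        b = proj₂ (ends e)
        factor : ∀ l u v → l * u + - (l * v) ≈ l * (u - v)
        factor = solve 3 (λ l u v → l :* u :+ :- (l :* v) := l :* (u :- v)) refl

-- Equations satisfied by directions

-- The edges with a slot form a set F on which every forest is spanning.
module ForestPackings {n m : ℕ} (ends : Fin m → Fin n × Fin n) (d : ℕ) where
  open GraphicRank {n}
  open Sums
  open Weights
  open WeightBounds
  open Algebra.Properties.Monoid.Sum ℕ.+-0-monoid using (sum; sum-cong-≗)
  open NashWilliams ends (suc d)
  open Slots ends (suc d) using (SlottedForests; module SlottedForests)

  record ForestPacking : Set where
    field
      slotted : SlottedForests
    open SlottedForests slotted public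
    field
      slotless  : ∀ {e i} → slot e ≡ nothing → e ∉ˢ forest i
      some-edge : ∃ λ e → ∃ λ i → slot e ≡ just i

  SparseOn : Subset m → Set
  SparseOn B = d ℕ.* ∣ B ∣ < suc d ℕ.* ρ ends B

  module Minimal (F : Subset m) (e₁ : Fin m) (e₁∈F : e₁ ∈ˢ F)
                 (dependent : suc d ℕ.* ρ ends F ≤ d ℕ.* ∣ F ∣)
                 (minimal : ∀ B → Nonempty B → B ⊆ F → ¬ F ⊆ B → SparseOn B) where

    proper-bound : ∀ B → B ⊆ F → ¬ F ⊆ B → d ℕ.* ∣ B ∣ ≤ suc d ℕ.* ρ ends B
    proper-bound B B⊆F F⊈B with nonempty? B
    ... | yes B≢∅ = ℕ.<⇒≤ (minimal B B≢∅ B⊆F F⊈B)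
    ... | no B≡∅  = ℕ.≤-trans (ℕ.≤-reflexive (≡.trans (≡.cong (λ A → d ℕ.* ∣ A ∣) (Empty-unique B≡∅))
                      (≡.trans (≡.cong (d ℕ.*_) (∣⊥∣≡0 m)) (ℕ.*-zeroʳ d)))) z≤n

    excess : ℕ
    excess = d ℕ.* ∣ F ∣ ∸ suc d ℕ.* ρ ends F

    -- Deleting e₁ lowers d ∣F∣ by d and leaves a proper subset, which minimality keeps within the
    -- bound, with rank at most that of F. So the weight of the single edge e₁ can absorb the whole
    -- excess.
    excess≤d : excess ≤ d
    excess≤d = ℕ.m≤n+o⇒m∸n≤o (d ℕ.* ∣ F ∣) (suc d ℕ.* ρ ends F) (begin
      d ℕ.* ∣ F ∣                      ≤⟨ ℕ.*-monoʳ-≤ d (p⊆q⇒∣p∣≤∣q∣ F⊆) ⟩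
      d ℕ.* ∣ (F ∖ e₁) ∪ ⁅ e₁ ⁆ ∣        ≡⟨ ≡.cong (d ℕ.*_) (∣∣-insert {A = F ∖ e₁} e₁∉) ⟩
      d ℕ.* suc ∣ F ∖ e₁ ∣             ≡⟨ ℕ.*-suc d ∣ F ∖ e₁ ∣ ⟩
      d ℕ.+ d ℕ.* ∣ F ∖ e₁ ∣           ≡⟨ ℕ.+-comm d _ ⟩
      d ℕ.* ∣ F ∖ e₁ ∣ ℕ.+ d           ≤⟨ ℕ.+-monoˡ-≤ d (ℕ.≤-trans (proper-bound (F ∖ e₁) F-e₁⊆F (λ F⊆ → e₁∉ (F⊆ e₁∈F)))
                                            (ℕ.*-monoʳ-≤ (suc d) (ρ-mono ends {F ∖ e₁} {F} F-e₁⊆F))) ⟩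
      suc d ℕ.* ρ ends F ℕ.+ d         ∎)
      where
      open ℕ.≤-Reasoning
      F-e₁⊆F : F ∖ e₁ ⊆ F
      F-e₁⊆F = p─q⊆p F ⁅ e₁ ⁆
      e₁∉ : e₁ ∉ˢ F ∖ e₁
      e₁∉ = x∉p-x F e₁
        where
        x∉p-x : ∀ {m} (p : Subset m) x → x ∉ˢ p ∖ x
        x∉p-x (_ ∷ p) zero    ()
        x∉p-x (_ ∷ p) (suc x) (there x∈) = x∉p-x p x x∈
      F⊆ : F ⊆ (F ∖ e₁) ∪ ⁅ e₁ ⁆
      F⊆ {x} x∈F with x Fin.≟ e₁
      ... | yes ≡.refl = x∈p∪q⁺ {p = F ∖ e₁} (inj₂ (x∈⁅x⁆ e₁))
      ... | no x≢e₁    = x∈p∪q⁺ (inj₁ (x∈p∧x≢y⇒x∈p-y x∈F x≢e₁))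

    -- Giving d copies to each edge of F and withdrawing the excess at e₁ makes the total exactly (d
    -- + 1) ρ(F), which forces all d + 1 forests to span F.
    w₀ w : Fin m → ℕ
    w₀ e = d ℕ.* bit F e
    w = updateAt w₀ e₁ (_∸ excess)

    w₀-F : ∀ {e} → e ∈ˢ F → w₀ e ≡ d
    w₀-F e∈F = ≡.trans (≡.cong (d ℕ.*_) (bit-∈ e∈F)) (ℕ.*-identityʳ d)

    w≤w₀ : ∀ e → w e ≤ w₀ e
    w≤w₀ e with e Fin.≟ e₁
    ... | yes ≡.refl = ≡.subst (_≤ w₀ e₁) (≡.sym (updateAt-updates e₁ w₀)) (ℕ.m∸n≤m (w₀ e₁) excess)
    ... | no e≢e₁    = ℕ.≤-reflexive (updateAt-minimal e e₁ w₀ e≢e₁)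

    w≤d : ∀ e → w e ≤ d
    w≤d e = ℕ.≤-trans (w≤w₀ e) (ℕ.≤-trans (ℕ.*-monoʳ-≤ d (bit≤1 F e)) (ℕ.≤-reflexive (ℕ.*-identityʳ d)))

    w-∉ : ∀ e → e ∉ˢ F → w e ≡ 0
    w-∉ e e∉F = ℕ.n≤0⇒n≡0 (ℕ.≤-trans (w≤w₀ e) (ℕ.≤-reflexive (≡.trans (≡.cong (d ℕ.*_) (bit-∉ e∉F)) (ℕ.*-zeroʳ d))))

    weight-mono : ∀ {m} {u v : Fin m → ℕ} A → (∀ e → u e ≤ v e) → weight u A ≤ weight v A
    weight-mono []            u≤v = z≤n
    weight-mono (outside ∷ A) u≤v = weight-mono A (u≤v ∘ suc)
    weight-mono (inside ∷ A)  u≤v = ℕ.+-mono-≤ (u≤v zero) (weight-mono A (u≤v ∘ suc))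

    weight-∩ : ∀ {m} (u : Fin m → ℕ) A B → (∀ e → e ∉ˢ B → u e ≡ 0) → weight u A ≡ weight u (A ∩ B)
    weight-∩ u []            []            _   = ≡.refl
    weight-∩ u (outside ∷ A) (_ ∷ B)       u≡0 = weight-∩ (u ∘ suc) A B λ e e∉B → u≡0 (suc e) λ { (there e∈B) → e∉B e∈B }
    weight-∩ u (inside ∷ A)  (inside ∷ B)  u≡0 = ≡.cong (u zero ℕ.+_)
      (weight-∩ (u ∘ suc) A B λ e e∉B → u≡0 (suc e) λ { (there e∈B) → e∉B e∈B })
    weight-∩ u (inside ∷ A)  (outside ∷ B) u≡0 = ≡.trans (≡.cong (ℕ._+ weight (u ∘ suc) A) (u≡0 zero λ ()))
      (weight-∩ (u ∘ suc) A B λ e e∉B → u≡0 (suc e) λ { (there e∈B) → e∉B e∈B })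

    weight-F : weight w F ≡ suc d ℕ.* ρ ends F
    weight-F = ≡.trans (≡.sym (ℕ.m+n∸n≡m (weight w F) excess)) (≡.trans (≡.cong (_∸ excess) total) (ℕ.m∸[m∸n]≡n dependent))
      where
      w₀-total : weight w₀ F ≡ d ℕ.* ∣ F ∣
      w₀-total = ≡.trans (weight-cong F w₀-F) (weight-const d F)
      total : weight w F ℕ.+ excess ≡ d ℕ.* ∣ F ∣
      total = ℕ.+-cancelʳ-≡ (w e₁) _ _ (begin
        weight w F ℕ.+ excess ℕ.+ w e₁          ≡⟨ ℕ.+-assoc (weight w F) excess (w e₁) ⟩
        weight w F ℕ.+ (excess ℕ.+ w e₁)        ≡⟨ ≡.cong (λ k → weight w F ℕ.+ (excess ℕ.+ k)) (updateAt-updates e₁ w₀) ⟩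
        weight w F ℕ.+ (excess ℕ.+ (w₀ e₁ ∸ excess))
          ≡⟨ ≡.cong (weight w F ℕ.+_) (ℕ.m+[n∸m]≡n (≡.subst (excess ≤_) (≡.sym (w₀-F e₁∈F)) excess≤d)) ⟩
        weight w F ℕ.+ w₀ e₁                    ≡⟨ weight-exchange (λ f f≢e → updateAt-minimal f e₁ w₀ f≢e) e₁∈F ⟩
        weight w₀ F ℕ.+ w e₁                    ≡⟨ ≡.cong (ℕ._+ w e₁) w₀-total ⟩
        d ℕ.* ∣ F ∣ ℕ.+ w e₁                    ∎)
        where open ≡.≡-Reasoning

    -- All weight lies on A ∩ F. Either this is F, where `weight-F` is exact, or it is a proper
    -- subset, where minimality applies.
    w-bound : ∀ A → weight w A ≤ suc d ℕ.* ρ ends A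
    w-bound A with F ⊆? (A ∩ F)
    ... | yes F⊆ = begin
      weight w A                 ≡⟨ weight-∩ w A F w-∉ ⟩
      weight w (A ∩ F)           ≡⟨ ≡.cong (weight w) (⊆-antisym (p∩q⊆q A F) F⊆) ⟩
      weight w F                 ≡⟨ weight-F ⟩
      suc d ℕ.* ρ ends F         ≤⟨ ℕ.*-monoʳ-≤ (suc d) (ρ-mono ends {F} {A} (p∩q⊆p A F ∘ F⊆)) ⟩
      suc d ℕ.* ρ ends A         ∎
      where open ℕ.≤-Reasoning
    ... | no F⊈ = begin
      weight w A                 ≡⟨ weight-∩ w A F w-∉ ⟩
      weight w (A ∩ F)           ≤⟨ weight-mono (A ∩ F) w≤d ⟩
      weight (const d) (A ∩ F)   ≡⟨ weight-const d (A ∩ F) ⟩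
      d ℕ.* ∣ A ∩ F ∣            ≤⟨ proper-bound (A ∩ F) (p∩q⊆q A F) F⊈ ⟩
      suc d ℕ.* ρ ends (A ∩ F)   ≤⟨ ℕ.*-monoʳ-≤ (suc d) (ρ-mono ends {A ∩ F} {A} (p∩q⊆p A F)) ⟩
      suc d ℕ.* ρ ends A         ∎
      where open ℕ.≤-Reasoning

    packing : ForestPacking
    packing with nash-williams w w-bound
    ... | K , size-K , count-K , forest-K = record
      { slotted   = record
        { forest     = K
        ; slot       = slot
        ; slot-∉     = λ {e} → proj₂ ∘ slot-just e
        ; slot-spans = λ {e} {i} eq → spans i e (proj₁ (slot-just e eq)) }
      ; slotless  = λ {e} {i} eq e∈K → not-nothing e i (K⊆F i e∈K) eq
      ; some-edge = e₁ , slot-of-F e₁ e₁∈F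
      }
      where
      K⊆F : ∀ i → K i ⊆ F
      K⊆F i {e} e∈K = decidable-stable (e ∈? F) λ e∉F → ℕ.<⇒≱
        (sum-mono-< {f = const 0} {g = λ j → bit (K j) e} (λ _ → z≤n) i (≡.subst (0 <_) (≡.sym (bit-∈ e∈K)) (s≤s z≤n)))
        (≡.subst (_≤ sum {suc d} (const 0)) (≡.sym (≡.trans (count-K e) (w-∉ e e∉F))) z≤n)

      -- The d + 1 forests lie in F and have total size (d + 1) ρ(F), so none can fall short of
      -- ρ(F).
      ρK≡ρF : ∀ i → ρ ends (K i) ≡ ρ ends F
      ρK≡ρF = sum-squeeze (λ i → ρ-mono ends {K i} {F} (K⊆F i)) (ℕ.≤-reflexive (begin
        sum {suc d} (const (ρ ends F))     ≡⟨ sum-const (suc d) (ρ ends F) ⟩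
        suc d ℕ.* ρ ends F                 ≡⟨ weight-F ⟨
        weight w F                         ≡⟨ ≡.cong (weight w) (∩-identityˡ F) ⟨
        weight w (⊤ ∩ F)                   ≡⟨ weight-∩ w ⊤ F w-∉ ⟨
        weight w ⊤                         ≡⟨ size-K ⟨
        size K                             ≡⟨ sum-cong-≗ forest-K ⟨
        sum (λ i → ρ ends (K i))           ∎))
        where open ≡.≡-Reasoning

      spans : ∀ i e → e ∈ˢ F → Spans ends (K i) e
      spans i e e∈F with ρ-insert ends (K i) e
      ... | inj₁ (spans , _) = spans
      ... | inj₂ (_ , eq)    = ⊥-elim (ℕ.<⇒≱ (ℕ.≤-reflexive (≡.sym (≡.trans eq (≡.cong suc (ρK≡ρF i)))))
              (ρ-mono ends {K i ∪ ⁅ e ⁆} {F} λ f∈ →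
                [ K⊆F i , (λ f∈e → ≡.subst (_∈ˢ F) (≡.sym (x∈⁅y⁆⇒x≡y e f∈e)) e∈F) ]′ (x∈p∪q⁻ (K i) ⁅ e ⁆ f∈)))

      missing? : ∀ e → Dec (∃ λ i → e ∉ˢ K i)
      missing? e = Fin.any? λ i → ¬? (e ∈? K i)

      -- An edge has at most d copies for d + 1 forests, so it has a slot whenever it lies in F.
      not-everywhere : ∀ e → ¬ (∀ i → e ∈ˢ K i)
      not-everywhere e e∈K = ℕ.<⇒≱ (s≤s (w≤d e)) (ℕ.≤-reflexive (≡.trans
        (≡.sym (≡.trans (sum-const (suc d) 1) (ℕ.*-identityʳ (suc d))))
        (≡.trans (sum-cong-≗ λ i → ≡.sym (bit-∈ (e∈K i))) (count-K e))))

      slot-of : ∀ {e} → Dec (e ∈ˢ F) → Dec (∃ λ i → e ∉ˢ K i) → Maybe (Fin (suc d))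
      slot-of (yes _) (yes (i , _)) = just i
      slot-of (yes _) (no _)        = nothing
      slot-of (no _)  _             = nothing

      slot : Fin m → Maybe (Fin (suc d))
      slot e = slot-of (e ∈? F) (missing? e)

      slot-just : ∀ e {i} → slot e ≡ just i → e ∈ˢ F × e ∉ˢ K i
      slot-just e eq with e ∈? F | missing? e
      slot-just e ≡.refl | yes e∈F | yes (i , e∉K) = e∈F , e∉K

      slot-of-F : ∀ e → e ∈ˢ F → ∃ λ i → slot e ≡ just i
      slot-of-F e e∈F with e ∈? F | missing? e
      ... | no e∉F | _             = ⊥-elim (e∉F e∈F)
      ... | yes _  | yes (i , _)   = i , ≡.refl
      ... | yes _  | no none       = ⊥-elim (not-everywhere e λ i →
              decidable-stable (e ∈? K i) λ e∉K → none (i , e∉K))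

      not-nothing : ∀ e (i : Fin (suc d)) → e ∈ˢ F → ¬ slot e ≡ nothing
      not-nothing e _ e∈F eq with slot-of-F e e∈F
      ... | i , eq′ with () ← ≡.trans (≡.sym eq) eq′

  ⊈-witness : (F B : Subset m) → ¬ F ⊆ B → ∃ λ x → x ∈ˢ F × x ∉ˢ B
  ⊈-witness F B F⊈B with Fin.any? (λ x → (x ∈? F) ×-dec ¬? (x ∈? B))
  ... | yes found = found
  ... | no none   = ⊥-elim (F⊈B λ {x} x∈F → decidable-stable (x ∈? B) λ x∉B → none (x , x∈F , x∉B))

  -- Induction on the size of F provides minimality: the proper nonempty subsets of F are already
  -- sparse, so a failure at F would produce a packing.
  no-packing⇒sparse : ¬ ForestPacking → Sparse (ρ ends) (suc d)
  no-packing⇒sparse no-packing F F≢∅ = go F F≢∅ (<-wellFounded ∣ F ∣)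
    where
    go : ∀ F → Nonempty F → Acc _<_ ∣ F ∣ → SparseOn F
    go F (e , e∈F) (acc smaller) = ℕ.≰⇒> λ dependent → no-packing
      (Minimal.packing F e e∈F dependent λ B B≢∅ B⊆F F⊈B →
        go B B≢∅ (smaller (p⊂q⇒∣p∣<∣q∣ (B⊆F , ⊈-witness F B F⊈B))))

module Dependence (R : CommutativeRing 0ℓ 0ℓ) {n m : ℕ} (ends : Fin m → Fin n × Fin n) (d : ℕ)
                  (packing : ForestPackings.ForestPacking ends d) where
  open ForestPackings.ForestPacking packing
  open CommutativeRing R hiding (zero)
  open Elimination R
  open PolynomialMaps R using (Point)
  open Potentials R {n}
  open Slots.Coefficients ends (suc d) R slotted public
  open Algebra.Properties.Semiring.Sum semiring using (sum; sum-cong-≋)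
  open Algebra.Properties.Ring ring using (-0#≈0#)
  open Relation.Binary.Reasoning.Setoid setoid

  -- Nonzero also at the edges without a slot, whose coordinates do not matter.
  base-at : Maybe (Fin (suc d)) → Fin (suc d) → Carrier
  base-at nothing  j = 1#
  base-at (just i) j = δ i j

  base : Point m (suc d)
  base f = base-at (slot f)

  pivots-base : pivots (matrix base) ≈ 1#
  pivots-base = pivots-identity (matrix base) (identity-at base base-1
      (λ e f i slot-e slot-f → co-supported slot-e (slot-∉ slot-f)) different)
    where
    base-1 : ∀ f i → slot f ≡ just i → base f i ≈ 1#
    base-1 f i eq = trans (reflexive (≡.cong (λ s → base-at s i) eq)) (δ-diagonal i)
    different : ∀ e f i → slot e ≡ just i → slot f ≢ just i → co e f * base f i ≈ 0#
    different e f i slot-e slot-f≢ with slot f in slot-f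
    ... | nothing = trans (*-congʳ (co-supported slot-e (slotless slot-f))) (zeroˡ _)
    ... | just j  = trans (*-congˡ (δ-off-diagonal {i = j} {i} λ { ≡.refl → slot-f≢ ≡.refl })) (zeroʳ _)

  -- The kernel vector at edge vectors of actual points: scalar 1 on F, and 0 elsewhere to satisfy
  -- the identity rows.
  indicator-at : Maybe (Fin (suc d)) → Carrier
  indicator-at nothing  = 0#
  indicator-at (just _) = 1#

  pivots-edge-vectors : (p : Point n (suc d)) → pivots (matrix (λ e i → difference (λ v → p v i) (ends e))) ≈ 0#
  pivots-edge-vectors p with some-edge
  ... | e , i , eq = trans (sym (*-identityʳ _)) (trans (*-congˡ (reflexive (≡.cong indicator-at (≡.sym eq))))
                       (cramer (matrix x) (indicator-at ∘ slot) kernel e))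
    where
    x : Point m (suc d)
    x e i = difference (λ v → p v i) (ends e)

    slotted-row : ∀ e i → slot e ≡ just i → sum (λ f → (δ e f - co e f) * x f i * indicator-at (slot f)) ≈ 0#
    slotted-row e i slot-e = begin
      sum (λ f → (δ e f - co e f) * x f i * indicator-at (slot f))   ≈⟨ sum-cong-≋ drop ⟩
      sum (λ f → (δ e f - co e f) * x f i)                           ≈⟨ row-sum e (λ f → x f i) ⟩
      x e i - sum (λ f → co e f * x f i)                             ≈⟨ +-congˡ (-‿cong (co-expansion slot-e (λ v → p v i))) ⟨
      x e i - x e i                                                  ≈⟨ -‿inverseʳ (x e i) ⟩
      0#                                                             ∎
      where
      -- The indicator removes only edges without a slot, which lie in no forest and have
      -- coefficient 0 in this row.
      drop : ∀ f → (δ e f - co e f) * x f i * indicator-at (slot f) ≈ (δ e f - co e f) * x f i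
      drop f with slot f in slot-f
      ... | just _  = *-identityʳ _
      ... | nothing = trans (zeroʳ _) (sym (trans (*-congʳ (trans (+-cong
              (δ-off-diagonal {i = e} {f} λ { ≡.refl → not-nothing (≡.trans (≡.sym slot-f) slot-e) })
              (trans (-‿cong (co-supported slot-e (slotless slot-f))) -0#≈0#)) (+-identityʳ 0#))) (zeroˡ _)))
        where
        not-nothing : ¬ nothing ≡ just i
        not-nothing ()

    kernel : ∀ e → sum (λ f → matrix x e f * indicator-at (slot f)) ≈ 0#
    kernel e with slot e in slot-e
    ... | just i  = slotted-row e i slot-e
    ... | nothing = trans (sum-δ e (indicator-at ∘ slot)) (reflexive (≡.cong indicator-at slot-e))

-- Multihomogeneous polynomials

module Multihomogeneous (R : CommutativeRing 0ℓ 0ℓ) (m d : ℕ) where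
  open CommutativeRing R hiding (zero)
  open RingSolver R
  open Elimination R
  open PolynomialMaps R
  open Algebra.Properties.Semiring.Exp semiring using (_^_; ^-homo-*)
  open Algebra.Properties.CommutativeSemiring.Exp commutativeSemiring using (^-distrib-*)
  open Algebra.Properties.CommutativeMonoid.Sum *-commutativeMonoid using ()
    renaming (sum to product; sum-cong-≋ to product-cong; ∑-distrib-+ to product-distrib)
  open Algebra.Properties.CommutativeMonoid.Sum ℕ.+-0-commutativeMonoid using ()
    renaming (sum to sumℕ; ∑-distrib-+ to sumℕ-distrib)
  open Algebra.Properties.Ring ring using (-‿distribˡ-*; -‿+-comm; -0#≈0#)
  open Relation.Binary.Reasoning.Setoid setoid

  -- Mirrors `Term` over an arbitrary commutative ring, where the ring laws can be applied;
  -- `ComplexPolynomials` translates between the two.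
  record Monomial (degree : Fin m → ℕ) : Set where
    constructor monomial
    field
      coefficient : Carrier
      exponent    : Fin m → Fin d → ℕ
      multidegree : ∀ e → sumℕ (exponent e) ≡ degree e
  open Monomial

  powers : (Fin m → Fin d → ℕ) → Point m d → Carrier
  powers a x = product λ e → product λ i → x e i ^ a e i

  evalMonomial : ∀ {δs} → Monomial δs → Point m d → Carrier
  evalMonomial t x = coefficient t * powers (exponent t) x

  evaluate : ∀ {δs} → List (Monomial δs) → Point m d → Carrier
  evaluate ts x = List.foldr (λ t s → evalMonomial t x + s) 0# ts

  powers-+ : ∀ a b x → powers (λ e i → a e i ℕ.+ b e i) x ≈ powers a x * powers b x
  powers-+ a b x = trans
    (product-cong {m} λ e → trans (product-cong {d} λ i → ^-homo-* (x e i) (a e i) (b e i))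
                                  (product-distrib {d} (λ i → x e i ^ a e i) (λ i → x e i ^ b e i)))
    (product-distrib {m} (λ e → product λ i → x e i ^ a e i) (λ e → product λ i → x e i ^ b e i))

  product-1 : ∀ {k} (f : Fin k → Carrier) → (∀ j → f j ≈ 1#) → product f ≈ 1#
  product-1 {zero}  f f≈1 = refl
  product-1 {suc k} f f≈1 = trans (*-cong (f≈1 zero) (product-1 (f ∘ suc) (f≈1 ∘ suc))) (*-identityˡ 1#)

  product-single : ∀ {k} (f : Fin k → Carrier) j → (∀ i → i ≢ j → f i ≈ 1#) → product f ≈ f j
  product-single f zero    f≈1 = trans (*-congˡ (product-1 (f ∘ suc) λ i → f≈1 (suc i) λ ())) (*-identityʳ _)
  product-single f (suc j) f≈1 = trans (*-cong (f≈1 zero λ ())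
    (product-single (f ∘ suc) j λ i i≢j → f≈1 (suc i) (i≢j ∘ Fin.suc-injective))) (*-identityˡ _)

  unit : ∀ {k} → Fin k → Fin k → ℕ
  unit zero    zero    = 1
  unit zero    (suc j) = 0
  unit (suc i) zero    = 0
  unit (suc i) (suc j) = unit i j

  unit-diagonal : ∀ {k} (i : Fin k) → unit i i ≡ 1
  unit-diagonal zero    = ≡.refl
  unit-diagonal (suc i) = unit-diagonal i

  unit-off : ∀ {k} {i j : Fin k} → j ≢ i → unit i j ≡ 0
  unit-off {i = zero}  {zero}  j≢i with () ← j≢i ≡.refl
  unit-off {i = zero}  {suc j} j≢i = ≡.refl
  unit-off {i = suc i} {zero}  j≢i = ≡.refl
  unit-off {i = suc i} {suc j} j≢i = unit-off (j≢i ∘ ≡.cong suc)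

  sum-0s : ∀ k → sumℕ {k} (const 0) ≡ 0
  sum-0s zero    = ≡.refl
  sum-0s (suc k) = sum-0s k

  sum-unit : ∀ {k} (i : Fin k) → sumℕ (unit i) ≡ 1
  sum-unit {suc k} zero    = ≡.cong suc (sum-0s k)
  sum-unit {suc k} (suc i) = sum-unit i

  Multihomogeneous : (Fin m → ℕ) → (Point m d → Carrier) → Set
  Multihomogeneous δs F = Σ (List (Monomial δs)) λ ts → ∀ x → evaluate ts x ≈ F x

  resp-≈ : ∀ {δs F G} → (∀ x → F x ≈ G x) → Multihomogeneous δs F → Multihomogeneous δs G
  resp-≈ F≈G (ts , eq) = ts , λ x → trans (eq x) (F≈G x)

  zeroʰ : ∀ {δs} → Multihomogeneous δs (const 0#)
  zeroʰ = [] , λ x → refl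

  constantʰ : ∀ c → Multihomogeneous (const 0) (const c)
  constantʰ c = monomial c (λ _ _ → 0) (λ e → sum-0s d) ∷ [] , λ x →
    trans (+-identityʳ _) (trans (*-congˡ (product-1 {m} _ λ e → product-1 {d} _ λ i → refl)) (*-identityʳ c))

  coordinateʰ : ∀ f i → Multihomogeneous (unit f) (λ x → x f i)
  coordinateʰ f i = monomial 1# (λ e j → unit f e ℕ.* unit i j) degrees ∷ [] , λ x →
      trans (+-identityʳ _) (trans (*-identityˡ _) (trans
        (product-single _ f λ e e≢f → product-1 _ λ j → reflexive (≡.cong (λ u → x e j ^ (u ℕ.* unit i j)) (unit-off e≢f)))
        (trans (product-single _ i λ j j≢i → reflexive (≡.cong (x f j ^_) (≡.trans (≡.cong (unit f f ℕ.*_) (unit-off j≢i)) (ℕ.*-zeroʳ (unit f f)))))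
          (trans (reflexive (≡.cong (x f i ^_) (≡.cong₂ ℕ._*_ (unit-diagonal f) (unit-diagonal i)))) (*-identityʳ _)))))
    where
    scaled : ∀ k {l} (u : Fin l → ℕ) → sumℕ (λ j → k ℕ.* u j) ≡ k ℕ.* sumℕ u
    scaled k {zero}  u = ≡.sym (ℕ.*-zeroʳ k)
    scaled k {suc l} u = ≡.trans (≡.cong (k ℕ.* u zero ℕ.+_) (scaled k (u ∘ suc))) (≡.sym (ℕ.*-distribˡ-+ k (u zero) (sumℕ (u ∘ suc))))
    degrees : ∀ e → sumℕ (λ j → unit f e ℕ.* unit i j) ≡ unit f e
    degrees e = ≡.trans (scaled (unit f e) (unit i)) (≡.trans (≡.cong (unit f e ℕ.*_) (sum-unit i)) (ℕ.*-identityʳ _))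

  evaluate-++ : ∀ {δs} (ts us : List (Monomial δs)) x → evaluate (ts ++ us) x ≈ evaluate ts x + evaluate us x
  evaluate-++ []       us x = sym (+-identityˡ _)
  evaluate-++ (t ∷ ts) us x = trans (+-congˡ (evaluate-++ ts us x)) (sym (+-assoc _ _ _))

  _+ʰ_ : ∀ {δs F G} → Multihomogeneous δs F → Multihomogeneous δs G → Multihomogeneous δs (λ x → F x + G x)
  (ts , eq) +ʰ (us , eq′) = ts ++ us , λ x → trans (evaluate-++ ts us x) (+-cong (eq x) (eq′ x))

  negateʰ : ∀ {δs F} → Multihomogeneous δs F → Multihomogeneous δs (λ x → - F x)
  negateʰ (ts , eq) = List.map negate ts , λ x → trans (evaluate-negate ts x) (-‿cong (eq x))
    where
    negate : ∀ {δs} → Monomial δs → Monomial δs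
    negate (monomial c a deg) = monomial (- c) a deg
    evaluate-negate : ∀ {δs} (ts : List (Monomial δs)) x → evaluate (List.map negate ts) x ≈ - evaluate ts x
    evaluate-negate []       x = sym -0#≈0#
    evaluate-negate (t ∷ ts) x = trans (+-cong (sym (-‿distribˡ-* _ _)) (evaluate-negate ts x)) (-‿+-comm _ _)

  _*ʰ_ : ∀ {δs εs F G} → Multihomogeneous δs F → Multihomogeneous εs G →
         Multihomogeneous (λ e → δs e ℕ.+ εs e) (λ x → F x * G x)
  (ts , eq) *ʰ (us , eq′) = times ts , λ x → trans (evaluate-times ts x) (*-cong (eq x) (eq′ x))
    where
    multiply : ∀ {δs εs} → Monomial δs → Monomial εs → Monomial (λ e → δs e ℕ.+ εs e)
    multiply (monomial c a deg) (monomial c′ a′ deg′) = monomial (c * c′) (λ e i → a e i ℕ.+ a′ e i)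
      λ e → ≡.trans (sumℕ-distrib (a e) (a′ e)) (≡.cong₂ ℕ._+_ (deg e) (deg′ e))
    times : List (Monomial _) → List (Monomial _)
    times []       = []
    times (t ∷ ts) = List.map (multiply t) us ++ times ts
    interchange : ∀ c c′ p p′ → (c * c′) * (p * p′) ≈ (c * p) * (c′ * p′)
    interchange = solve 4 (λ c c′ p p′ → (c :* c′) :* (p :* p′) := (c :* p) :* (c′ :* p′)) refl
    evaluate-map : ∀ t us x → evaluate (List.map (multiply t) us) x ≈ evalMonomial t x * evaluate us x
    evaluate-map t []       x = sym (zeroʳ _)
    evaluate-map t (u ∷ us) x = trans
      (+-cong (trans (*-congˡ (powers-+ (exponent t) (exponent u) x)) (interchange _ _ _ _)) (evaluate-map t us x))
      (sym (distribˡ _ _ _))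
    evaluate-times : ∀ ts x → evaluate (times ts) x ≈ evaluate ts x * evaluate us x
    evaluate-times []       x = sym (zeroˡ _)
    evaluate-times (t ∷ ts) x = trans (evaluate-++ (List.map (multiply t) us) (times ts) x)
      (trans (+-cong (evaluate-map t us x) (evaluate-times ts x)) (sym (distribʳ _ _ _)))

  -- Reducing a matrix whose columns are homogeneous adds the multidegree of
  -- the first column to that of every other column.
  pivotsʰ : ∀ {k} {A : Point m d → Matrix k} (δs : Fin k → Fin m → ℕ) →
    (∀ i j → Multihomogeneous (δs j) (λ x → A x i j)) → ∃ λ δ′ → Multihomogeneous δ′ (λ x → pivots (A x))
  pivotsʰ {zero}  δs A = const 0 , constantʰ 1#
  pivotsʰ {suc k} δs A with pivotsʰ (λ j e → δs zero e ℕ.+ δs (suc j) e)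
                             (λ i j → (A zero zero *ʰ A (suc i) (suc j)) +ʰ negateʰ (A (suc i) zero *ʰ A zero (suc j)))
  ... | δ′ , P = (λ e → δs zero e ℕ.+ δ′ e) , A zero zero *ʰ P

  evaluateᵖ : ∀ {δs} (ts : List (Monomial δs)) → PolynomialMap (evaluate ts)
  evaluateᵖ []       = constantᵖ 0#
  evaluateᵖ (t ∷ ts) =
    constantᵖ (coefficient t) *ᵖ productᵖ (λ e → productᵖ λ i → coordinateᵖ e i ^ᵖ exponent t e i) +ᵖ evaluateᵖ ts

  product-powers : ∀ {k} t (a : Fin k → ℕ) → product (λ i → t ^ a i) ≈ t ^ sumℕ a
  product-powers {zero}  t a = refl
  product-powers {suc k} t a = trans (*-congˡ (product-powers t (a ∘ suc))) (sym (^-homo-* t (a zero) (sumℕ (a ∘ suc))))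

  evaluate-scale : ∀ {δs} (ts : List (Monomial δs)) (t : Fin m → Carrier) (x : Point m d) →
    evaluate ts (λ e i → t e * x e i) ≈ product (λ e → t e ^ δs e) * evaluate ts x
  evaluate-scale []              t x = sym (zeroʳ _)
  evaluate-scale {δs} (monomial c a deg ∷ ts) t x = trans
    (+-cong (trans (*-congˡ scale-powers) (swap c _ _)) (evaluate-scale ts t x))
    (sym (distribˡ _ _ _))
    where
    swap : ∀ c u v → c * (u * v) ≈ u * (c * v)
    swap = solve 3 (λ c u v → c :* (u :* v) := u :* (c :* v)) refl
    scale-powers : powers a (λ e i → t e * x e i) ≈ product (λ e → t e ^ δs e) * powers a x
    scale-powers = trans
      (product-cong {m} λ e → trans (product-cong {d} λ i → ^-distrib-* (t e) (x e i) (a e i))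
        (trans (product-distrib {d} (λ i → t e ^ a e i) (λ i → x e i ^ a e i))
          (*-congʳ (trans (product-powers (t e) (a e)) (reflexive (≡.cong (t e ^_) (deg e)))))))
      (product-distrib {m} (λ e → t e ^ δs e) (λ e → product λ i → x e i ^ a e i))

module DependencePolynomial (R : CommutativeRing 0ℓ 0ℓ) {n m : ℕ} (ends : Fin m → Fin n × Fin n) (d : ℕ)
                            (packing : ForestPackings.ForestPacking ends d) where
  open ForestPackings.ForestPacking packing
  open CommutativeRing R hiding (zero)
  open Dependence R ends d packing public
  open Elimination R
  open PolynomialMaps R using (Point)
  open Multihomogeneous R m (suc d)
  open Algebra.Properties.Ring ring using (-0#≈0#)

  column-degree : Maybe (Fin (suc d)) → Fin m → Fin m → ℕ
  column-degree nothing  f = λ _ → 0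
  column-degree (just _) f = unit f

  contradictory : ∀ {s : Maybe (Fin (suc d))} {i} {A : Set} → s ≡ nothing → s ≡ just i → A
  contradictory ≡.refl ()

  -- `pivotsʰ` requires one multidegree for each column. The column of a slotted edge f is linear in
  -- x f, and any other column is constant; the entries that break this pattern are zero, hence of
  -- every multidegree.
  entryʰ : ∀ e f → Multihomogeneous (column-degree (slot f) f) (λ x → matrix x e f)
  entryʰ e f with slot e in slot-e | slot f in slot-f
  ... | nothing | nothing = constantʰ (δ e f)
  ... | nothing | just _  = resp-≈ (λ x → sym (δ-off-diagonal {i = e} {f} λ { ≡.refl → contradictory slot-e slot-f })) zeroʰ
  ... | just i  | just _  = constantʰ (δ e f - co e f) *ʰ coordinateʰ f i
  ... | just i  | nothing = resp-≈ (λ x → sym (trans (*-congʳ (trans (+-cong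
          (δ-off-diagonal {i = e} {f} λ { ≡.refl → contradictory slot-f slot-e })
          (trans (-‿cong (co-supported slot-e (slotless slot-f))) -0#≈0#)) (+-identityʳ 0#))) (zeroˡ _))) zeroʰ

  homogeneous : ∃ λ δ′ → Multihomogeneous δ′ (λ x → pivots (matrix x))
  homogeneous = pivotsʰ (λ f → column-degree (slot f) f) entryʰ

  equation : List (Monomial (proj₁ homogeneous))
  equation = proj₁ (proj₂ homogeneous)

  equation-base : evaluate equation base ≈ 1#
  equation-base = trans (proj₂ (proj₂ homogeneous) base) pivots-base

  equation-edge-vectors : (p : Point n (suc d)) → evaluate equation (λ e i → p (proj₁ (ends e)) i - p (proj₂ (ends e)) i) ≈ 0#
  equation-edge-vectors p = trans (proj₂ (proj₂ homogeneous) _) (pivots-edge-vectors p)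

  base-nonzero : ¬ 1# ≈ 0# → ∀ e → ¬ (∀ j → base e j ≈ 0#)
  base-nonzero 1≉0 e with slot e
  ... | nothing = λ zeros → 1≉0 (zeros zero)
  ... | just i  = λ zeros → 1≉0 (trans (sym (δ-diagonal i)) (zeros i))

module ComplexPolynomials (m d : ℕ) where
  open ComplexNumbers
  open Multihomogeneous ℂ-commutativeRing m d
  private
    module C = CommutativeRing ℂ-commutativeRing
  open Algebra.Properties.Semiring.Exp C.semiring using (_^_)
  open Algebra.Properties.Monoid.Sum C.*-monoid using (sum-cong-≗)

  toTerm : ∀ {δ} → Monomial δ → Term m d δ
  toTerm (monomial c a deg) = record { coefficient = c ; exponent = a ; multidegree = deg }

  fromTerm : ∀ {δ} → Term m d δ → Monomial δ
  fromTerm t = monomial coefficient exponent multidegree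
    where open Term t

  -- The two powers are taken in raw structures with different equalities, so
  -- they agree only by induction.
  power-≡ : ∀ z n → RawSemiringDefs._^_ (RawRing.rawSemiring ℂ-rawRing) z n ≡ z ^ n
  power-≡ z zero    = ≡.refl
  power-≡ z (suc n) = ≡.cong (z C.*_) (power-≡ z n)

  eval-toTerm : ∀ {δ} (t : Monomial δ) x → evalTerm m d (toTerm t) x ≡ evalMonomial t x
  eval-toTerm t x = ≡.cong (Monomial.coefficient t C.*_)
    (sum-cong-≗ {m} λ e → sum-cong-≗ {d} λ i → power-≡ (x e i) (Monomial.exponent t e i))

  toPolynomial : ∀ {δ} → List (Monomial δ) → MultihomogeneousPolynomial m d
  toPolynomial {δ} ts = record { degree = δ ; terms = List.map toTerm ts }

  eval-toPolynomial : ∀ {δ} (ts : List (Monomial δ)) x → eval m d (toPolynomial ts) x ≡ evaluate ts x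
  eval-toPolynomial []       x = ≡.refl
  eval-toPolynomial (t ∷ ts) x = ≡.cong₂ C._+_ (eval-toTerm t x) (eval-toPolynomial ts x)

  monomials : (f : MultihomogeneousPolynomial m d) → List (Monomial (MultihomogeneousPolynomial.degree f))
  monomials f = List.map fromTerm (MultihomogeneousPolynomial.terms f)

  evaluate-monomials : ∀ f x → evaluate (monomials f) x ≡ eval m d f x
  evaluate-monomials f x = go (MultihomogeneousPolynomial.terms f)
    where
    go : ∀ ts → evaluate (List.map fromTerm ts) x ≡ List.foldr (λ t s → evalTerm m d t x C.+ s) C.0# ts
    go []       = ≡.refl
    go (t ∷ ts) = ≡.cong₂ C._+_ (≡.sym (eval-toTerm (fromTerm t) x)) (go ts)

  evaluate-0 : ∀ f x → evaluate (monomials f) x ≋ C.0# → RawRing._≈_ ℂ-rawRing (eval m d f x) C.0#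
  evaluate-0 f x eq = ≋⇒≈ (eval m d f x) C.0# (≡.subst (_≋ C.0#) (evaluate-monomials f x) eq)

  0-evaluate : ∀ f x → RawRing._≈_ ℂ-rawRing (eval m d f x) C.0# → evaluate (monomials f) x ≋ C.0#
  0-evaluate f x eq = ≡.subst (_≋ C.0#) (≡.sym (evaluate-monomials f x)) (≈⇒≋ (eval m d f x) C.0# eq)

  eval-0 : ∀ {δ} (ts : List (Monomial δ)) x → evaluate ts x ≋ C.0# → RawRing._≈_ ℂ-rawRing (eval m d (toPolynomial ts) x) C.0#
  eval-0 ts x eq = ≋⇒≈ (eval m d (toPolynomial ts) x) C.0# (≡.subst (_≋ C.0#) (≡.sym (eval-toPolynomial ts x)) eq)

  0-eval : ∀ {δ} (ts : List (Monomial δ)) x → RawRing._≈_ ℂ-rawRing (eval m d (toPolynomial ts) x) C.0# → evaluate ts x ≋ C.0#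
  0-eval ts x eq = ≡.subst (_≋ C.0#) (eval-toPolynomial ts x) (≈⇒≋ (eval m d (toPolynomial ts) x) C.0# eq)

-- Sparsity and parallel independence

module _ (G : Graph) (d : ℕ) where
  open import Relation.Binary.Construct.Closure.ReflexiveTransitive using (ε)
  open Graph G using (v; size; ends)
  open ComplexNumbers
  open ComplexPolynomials size (suc d)
  open Multihomogeneous ℂ-commutativeRing size (suc d)
  open Connectivity {v}
  open GraphicRank {v}
  private
    module C = CommutativeRing ℂ-commutativeRing
  open Dominance ℂ-commutativeRing ℂ-stable ℂ-domain ℂ-characteristic ends d

  loop-rank : ∀ e → Loop G e → ρ ends ⁅ e ⁆ ≡ 0
  loop-rank e loop with ρ-insert ends ⊥ e
  ... | inj₁ (_ , eq) = ≡.trans (≡.cong (ρ ends) (≡.sym (∪-identityˡ ⁅ e ⁆))) (≡.trans eq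
        (ℕ.n≤0⇒n≡0 (≡.subst (ρ ends ⊥ ≤_) (∣⊥∣≡0 size) (ρ≤∣∣ ends ⊥))))
  ... | inj₂ (¬spans , _) = ⊥-elim (¬spans (≡.subst (λ a → Joined (select ends ⊥) (a , proj₂ (ends e))) (≡.sym loop) (joined ε)))

  sparse⇒loopless : Sparse (ρ ends) (suc d) → Loopless G
  sparse⇒loopless sparse e loop = ℕ.n≮0 (≡.subst (d ℕ.* ∣ ⁅ e ⁆ ∣ <_)
    (≡.trans (≡.cong (suc d ℕ.*_) (loop-rank e loop)) (ℕ.*-zeroʳ (suc d))) (sparse ⁅ e ⁆ (e , x∈⁅x⁆ e)))

  distinct-points : ∀ p → Distinct p → DistinctPoints v (suc d)
  distinct-points p distinct = record
    { position = p ; distinct = λ {a} {b} a≢b p≈ → distinct a≢b λ i → ≈⇒≋ (p a i) (p b i) (p≈ i) }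

  -- A closed set containing the image is cut out by polynomials vanishing there, so `dominance`
  -- applies to each of them separately.
  sparse⇒independent : Sparse (ρ ends) (suc d) → ParallelIndependent (suc d) G
  sparse⇒independent sparse = loopless , λ f vanishes x i → evaluate-0 (f i) (ℙ[ℂ^_].coords ∘ x)
      (dominance (ForestFamilies.forestFamily ends d sparse) {evaluate (monomials (f i))}
        (MultihomogeneousPolynomial.degree (f i))
        (evaluateᵖ (monomials (f i))) (evaluate-scale (monomials (f i)))
        (λ p distinct → 0-evaluate (f i) (edge-vectors p) (vanishes (distinct-points p distinct) i))
        (ℙ[ℂ^_].coords ∘ x))
    where
    loopless : Loopless G
    loopless = sparse⇒loopless sparse

  module _ (packing : ForestPackings.ForestPacking ends d) where
    open DependencePolynomial ℂ-commutativeRing ends d packing using (equation; equation-base; equation-edge-vectors; base; base-nonzero)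

    packing⇒dependent : ¬ ParallelIndependent (suc d) G
    packing⇒dependent (loopless , dense) = 1≉0 (C.trans (C.sym equation-base)
        (0-eval equation base (dense (λ (_ : Unit.⊤) → toPolynomial equation) vanishes base-point Unit.tt)))
      where
      vanishes : ∀ a → ZeroLocus size (suc d) (λ (_ : Unit.⊤) → toPolynomial equation) (directions G loopless a)
      vanishes a _ = eval-0 equation (edge-vectors position) (equation-edge-vectors position)
        where open DistinctPoints a
      base-point : Fin size → ℙ[ℂ^ suc d ]
      base-point e = point (base e) λ zeros → base-nonzero 1≉0 e λ j → ≈⇒≋ (base e j) C.0# (zeros j)

  independent⇒sparse : ParallelIndependent (suc d) G → Sparse (ρ ends) (suc d)
  independent⇒sparse independent =
    ForestPackings.no-packing⇒sparse ends d λ packing → packing⇒dependent packing independent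

open import Data.Nat using (_*_)

theorem14 : (G : Graph) (d : ℕ) (2≤d : 2 ≤ d) →
    ParallelIndependent d G ⇔
    (∃ λ P → specialization G d 2≤d ≈𝕢 fromPoly P
    × MonicOfDegree (d * (Graph.v G ∸ c G)) P)
theorem14 G (suc d) 2≤d = mk⇔
  (λ independent → Equivalence.from monic⇔sparse λ F F≢∅ →
    ≡.subst (λ k → d * ∣ F ∣ < suc d * k) (≡.sym (r≡ρ F)) (independent⇒sparse G d independent F F≢∅))
  (λ monic → sparse⇒independent G d λ F F≢∅ →
    ≡.subst (λ k → d * ∣ F ∣ < suc d * k) (r≡ρ F) (Equivalence.to monic⇔sparse monic F F≢∅))
  where
  open RankOfGraph G using (r≡ρ)
  monic⇔sparse = specialization-monic⇔sparse G (suc d) 2≤d
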